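{- Let $\lambda$ be a shifted pavable partition with 2-quotient $(\mu,\nu)$. Then $$\sum_{T}x^T = P_{\mu}\,P_{\nu},$$ where the sum runs over all shifted domino tableaux $T$ of shape $\lambda$ in which no domino on the diagonal $D_0$ is labelled by a primed letter.
   Context: Diagrams. A partition is a finite non-increasing sequence of positive integers; its length is its number of parts. The Young diagram of $\lambda=(\lambda_1,\dots,\lambda_\ell)$ is drawn in $\mathbb{R}^2$ with the first row at the bottom: it consists of the unit cells with lower-left corners $(x,y)$, $0\le y<\ell$, $0\le x<\lambda_{y+1}$. For an integer $k$, $D_k$ is the line of equation $Y=X+k$; the cell with lower-left corner $(x,y)$ is cut by the unique diagonal $D_{y-x}$. The part $\mathrm{up}(\lambda)$ consists of the cells cut by $D_k$ with $k>0$; the other cells form $\mathrm{down}(\lambda)$. 2-core and 2-quotient. A domino is a $1\times2$ or $2\times1$ rectangle of cells. The 2-core of $\lambda$ is obtained by successively removing from the diagram dominoes having no cell above them or to their right, until this is no longer possible (the result does not depend on the order). $\lambda$ is pavable if its 2-core is empty. The 2-quotient $(\mu,\nu)$ of $\lambda=(\lambda_1,\dots,\lambda_\ell)$ is defined as follows: let $L$ be the $\ell$-tuple with $L_i=\lambda_i+\ell-i$; let $M$ be obtained from $L$ by replacing, from right to left, the even entries successively by $0,2,4,\dots$ and the odd entries successively by $1,3,5,\dots$; then $\mu$ is the sequence of the values $(L_i-M_i)/2$ over the $i$ with $L_i$ even, and $\nu$ the sequence of these values over the $i$ with $L_i$ odd (zero parts are dropped). Pavings. A paving of a pavable partition $\lambda$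 is a tiling of its diagram by dominoes. Each domino is cut by exactly one diagonal of even index $D_{2k}$; it is said to be on $D_{2k}$. In a paving, $\mathrm{up}'(\lambda)$ is the set of dominoes on $D_{2k}$ with $k>0$, and $\mathrm{down}'(\lambda)$ is the set of the remaining dominoes. Shifted pavable partitions. A pavable partition $\lambda$ with 2-quotient $(\mu,\nu)$ is a shifted pavable partition if the last part of $\mu$ is at least the length of $\mu$ and the last part of $\nu$ is at least the length of $\nu$ (an empty partition being allowed), and it is considered only with pavings satisfying: there is no vertical domino $d$ on $D_0$ which has adjacent dominoes on its left, all of them belonging to $\mathrm{up}'(\lambda)$. Shifted domino tableaux. A shifted domino tableau of shape $\lambda$ is a paving of $\lambda$ satisfying this last condition, together with a filling of the dominoes of $\mathrm{up}'(\lambda)$ by the symbol $X$ and of the dominoes of $\mathrm{down}'(\lambda)$ by letters of the ordered alphabet $\{1'<1<2'<2<\cdots\}$ such that, disregarding the $X$'s: rows are non-decreasing from left to right and columns are non-decreasing from bottom to top; each unprimed letter appears in at most one domino of each column; each primed letter appears in at most one domino of each row. Two shifted domino tableaux of shape $\lambda$ whose labelled dominoes in $\mathrm{down}'(\lambda)$ coincide are regarded as equal (only the lower part matters). Shifted Young tableaux and P-Schur functions. For a partition $\mu$ whose last part is at least its length $\ell$ (or $\mu$ empty), a shifted Young tableau of shape $\mu$ is a filling of the cells of $\mathrm{up}(\mu)$ by $X$ and of the cells of $\mathrm{down}(\mu)$ by letters of $\{1'<1<2'<2<\cdots\}$ such that, disregarding the $X$'s: rows are non-decreasing from left to right and columns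 non-decreasing from bottom to top; each unprimed letter appears at most once in each column; each primed letter appears at most once in each row. (Deleting the $X$'s gives a usual shifted tableau on the shifted diagram of the strict partition $(\mu_1,\mu_2-1,\dots,\mu_\ell-\ell+1)$.) For a shifted Young tableau or shifted domino tableau $T$, put $x^T=x_1^{a_1}x_2^{a_2}\cdots$, where $a_i$ is the number of cells (respectively dominoes) of $T$ labelled $i$ or $i'$. Then $P_\mu=\sum_t x^t$, the sum being over all shifted Young tableaux $t$ of shape $\mu$ in which the cells on $D_0$ carry no primed letter; equivalently, $P_\mu$ is the usual P-Schur function of the strict partition $(\mu_1,\mu_2-1,\dots,\mu_\ell-\ell+1)$. -}

module Defs where

open import Level using (0ℓ)
open import Data.Bool.Base using (true; false; if_then_else_)
open import Data.Empty using (⊥)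
open import Data.Fin.Base using (Fin; zero; suc)
open import Data.Integer.Base as ℤ using (ℤ; +_; 0ℤ; _⊖_; ∣_∣)
import Data.Integer.Divisibility as ℤ
import Data.Integer.Properties as ℤ
open import Data.List.Base hiding (find; sum; partition)
open import Data.Nat.ListAction using (sum)
open import Data.List.Membership.Propositional using (_∈_; lose; find)
open import Data.List.Membership.Propositional.Properties
  using (∈-filter⁺; ∈-filter⁻; ∈-map⁺; ∈-map⁻; ∈-concatMap⁺; ∈-concatMap⁻; ∈-upTo⁺; ∈-upTo⁻; ∈-cartesianProductWith⁺; ∈-++⁺ˡ; ∈-++⁺ʳ; ∈-lookup)
open import Data.List.Properties using (filter-none; filter-some)
open import Data.List.Relation.Unary.All as All using (All; []; _∷_)
open import Data.List.Relation.Unary.AllPairs using (AllPairs; []; _∷_)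
open import Data.List.Relation.Unary.Any as Any using (Any; here; there)
open import Data.List.Relation.Unary.Any.Properties using (lookup-index)
open import Data.List.Relation.Unary.Enumerates.Setoid using (IsEnumeration)
import Data.List.Relation.Unary.Enumerates.Setoid.Properties as Enumerates
open import Data.List.Relation.Unary.Linked using (Linked)
import Data.List.Relation.Unary.Unique.DecSetoid.Properties as Unique
import Data.Maybe.Relation.Unary.All as Maybe
open import Data.Nat.Base
open import Data.Nat.Divisibility as ℕ using (_∣?_)
open import Data.Nat.Properties as ℕ using (_≟_; _≤?_; _<?_)
open import Data.Product.Base using (Σ; ∃; ∃-syntax; _×_; _,_; proj₁; proj₂)
open import Data.Product.Properties using (≡-dec)
open import Data.Unit.Base using (⊤; tt)
open import Function.Base using (_∘_; id; case_of_)
open import Function.Bundles using (Inverse; _⇔_; mk⇔; Equivalence)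
open import Relation.Binary.Bundles using (Setoid; DecSetoid)
open import Relation.Binary.Construct.Closure.ReflexiveTransitive using (Star)
open import Relation.Binary.PropositionalEquality
open import Relation.Nullary using (¬_; Dec; yes; no; contradiction)
open import Relation.Nullary.Decidable using (map′; ¬?; _×-dec_; _→-dec_)

IsPartition : List ℕ → Set
IsPartition Λ = Linked _≥_ Λ × All (0 <_) Λ

-- The cell (x , y) has lower-left corner (x , y); rows are indexed from
-- the bottom, starting with y = 0.

Cell : Set
Cell = ℕ × ℕ

_≟ᶜ_ : (c c′ : Cell) → Dec (c ≡ c′)
_≟ᶜ_ = ≡-dec _≟_ _≟_

rowLength : List ℕ → ℕ → ℕ
rowLength []      _       = 0
rowLength (p ∷ _) zero    = p
rowLength (_ ∷ Λ) (suc y) = rowLength Λ y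

infix 4 _∈ᵞ_ _∈ᵈ_ _∈ᵖ_ _⟶_ _≤ᴸ_

_∈ᵞ_ : Cell → List ℕ → Set
(x , y) ∈ᵞ Λ = x < rowLength Λ y

cells : List ℕ → List Cell
cells Λ = concatMap (λ y → map (_, y) (upTo (rowLength Λ y))) (upTo (length Λ))

-- The cell c is cut by the line Y = X + content c.

content : Cell → ℤ
content (x , y) = y ⊖ x

Up : Cell → Set
Up c = 0ℤ ℤ.< content c

-- The argument is the lower-left cell.

data Domino : Set where
  horizontal vertical : Cell → Domino

corner : Domino → Cell
corner (horizontal c) = c
corner (vertical   c) = c

dominoCells : Domino → List Cell
dominoCells (horizontal (x , y)) = (x , y) ∷ (suc x , y) ∷ []
dominoCells (vertical   (x , y)) = (x , y) ∷ (x , suc y) ∷ []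

_∈ᵈ_ : Cell → Domino → Set
c ∈ᵈ d = c ∈ dominoCells d

CutBy : ℤ → Domino → Set
CutBy k d = Any (λ c → content c ≡ k) (dominoCells d)

-- The domino lies on a diagonal of even index 2k with k > 0.

Up′ : Domino → Set
Up′ d = Any (λ c → (+ 2) ℤ.∣ content c × Up c) (dominoCells d)

Up′? : ∀ d → Dec (Up′ d)
Up′? d = Any.any? (λ c → (2 ∣? ∣ content c ∣) ×-dec (0ℤ ℤ.<? content c)) (dominoCells d)

record _⟶_ (Λ κ : List ℕ) : Set where
  field
    domino    : Domino
    inside    : ∀ {c} → c ∈ᵈ domino → c ∈ᵞ Λ
    noneRight : ∀ {x y} → (x , y) ∈ᵈ domino → (suc x , y) ∈ᵞ Λ → (suc x , y) ∈ᵈ domino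
    noneAbove : ∀ {x y} → (x , y) ∈ᵈ domino → (x , suc y) ∈ᵞ Λ → (x , suc y) ∈ᵈ domino
    partition : IsPartition κ
    remaining : ∀ c → c ∈ᵞ κ ⇔ (c ∈ᵞ Λ × ¬ c ∈ᵈ domino)

IsTwoCore : List ℕ → List ℕ → Set
IsTwoCore Λ κ = Star _⟶_ Λ κ × (∀ κ′ → ¬ κ ⟶ κ′)

IsPavable : List ℕ → Set
IsPavable Λ = IsTwoCore Λ []

Even Odd : ℕ → Set
Even n = 2 ℕ.∣ n
Odd  n = ¬ Even n

even? : ∀ n → Dec (Even n)
even? n = 2 ∣? n

odd? : ∀ n → Dec (Odd n)
odd? n = ¬? (even? n)

-- ℓ - i is the number of parts after the i-th one.

tupleL : List ℕ → List ℕ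
tupleL []      = []
tupleL (p ∷ Λ) = p + length Λ ∷ tupleL Λ

-- An even (odd) entry becomes 2k (2k + 1), where k is the number of even
-- (odd) entries to its right.

tupleM : List ℕ → List ℕ
tupleM []      = []
tupleM (a ∷ L) =
  (if Dec.does (even? a) then 2 * length (filter even? L)
                         else suc (2 * length (filter odd? L)))
  ∷ tupleM L

quotientParts : {P : ℕ → Set} → (∀ n → Dec (P n)) → List ℕ → List ℕ
quotientParts P? Λ =
  filter (0 <?_)
    (map (λ (l , m) → (l ∸ m) / 2)
      (filter (λ (l , _) → P? l) (zip L (tupleM L))))
  where
  L = tupleL Λ

twoQuotient : List ℕ → List ℕ × List ℕ
twoQuotient Λ = quotientParts even? Λ , quotientParts odd? Λ

LastPartAtLeastLength : List ℕ → Set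
LastPartAtLeastLength μ = Maybe.All (length μ ≤_) (last μ)

record IsShiftedPavable (Λ : List ℕ) : Set where
  field
    isPartition : IsPartition Λ
    isPavable   : IsPavable Λ
    shiftedˡ    : LastPartAtLeastLength (proj₁ (twoQuotient Λ))
    shiftedʳ    : LastPartAtLeastLength (proj₂ (twoQuotient Λ))

-- The alphabet 1′ < 1 < 2′ < 2 < ⋯ ; index i stands for the letter i + 1.

data Letter : Set where
  primed unprimed : ℕ → Letter

index : Letter → ℕ
index (primed   i) = i
index (unprimed i) = i

rank : Letter → ℕ
rank (primed   i) = 2 * i
rank (unprimed i) = suc (2 * i)

_≤ᴸ_ : Letter → Letter → Set
a ≤ᴸ b = rank a ≤ rank b

Primed Unprimed : Letter → Set
Primed (primed   _) = ⊤
Primed (unprimed _) = ⊥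
Unprimed a = ¬ Primed a

-- Pieces (cells or dominoes) carry letters: piece c is the piece containing
-- the cell c, and only the cells satisfying Low, those of the lower part,
-- are taken into account; the others carry the symbol X.

record IsTableau {A : Set} (Low : Cell → Set) (piece : Cell → A) (label : A → Letter) : Set where
  field
    rows    : ∀ {x x′ y} → Low (x , y) → Low (x′ , y) → x ≤ x′ →
              label (piece (x , y)) ≤ᴸ label (piece (x′ , y))
    columns : ∀ {x y y′} → Low (x , y) → Low (x , y′) → y ≤ y′ →
              label (piece (x , y)) ≤ᴸ label (piece (x , y′))
    unprimedOncePerColumn :
              ∀ {x y y′} → Low (x , y) → Low (x , y′) →
              Unprimed (label (piece (x , y))) →
              label (piece (x , y)) ≡ label (piece (x , y′)) →
              piece (x , y) ≡ piece (x , y′)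
    primedOncePerRow :
              ∀ {x x′ y} → Low (x , y) → Low (x′ , y) →
              Primed (label (piece (x , y))) →
              label (piece (x , y)) ≡ label (piece (x′ , y)) →
              piece (x , y) ≡ piece (x′ , y)

-- Power series have coefficients in ℕ and variables x₁, x₂, …; the monomial
-- x₁^a₁ ⋯ xₙ^aₙ is the list a₁ ∷ ⋯ ∷ aₙ ∷ [], trailing zeros being allowed.

Monomial : Set
Monomial = List ℕ

-- The exponent of x_{i+1}.

exponent : Monomial → ℕ → ℕ
exponent []      _       = 0
exponent (a ∷ _) zero    = a
exponent (_ ∷ α) (suc i) = exponent α i

PowerSeries : Set
PowerSeries = Monomial → ℕ

factorizations : Monomial → List (Monomial × Monomial)
factorizations []      = ([] , []) ∷ []
factorizations (a ∷ α) =
  cartesianProductWith (λ b (β , γ) → (b ∷ β , a ∸ b ∷ γ)) (upTo (suc a)) (factorizations α)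

infixl 7 _*ˢ_

_*ˢ_ : PowerSeries → PowerSeries → PowerSeries
(F *ˢ G) α = sum (map (λ (β , γ) → F β * G γ) (factorizations α))

-- A family of objects T with x^T = ∏ x_{i+1} ^ weight T i.

record WeightedFamily : Set₁ where
  field
    objects : Setoid 0ℓ 0ℓ
  open Setoid objects public
  field
    weight  : Carrier → ℕ → ℕ

module _ (S : WeightedFamily) where
  open WeightedFamily S

  OfWeight : Monomial → Setoid 0ℓ 0ℓ
  OfWeight α = record
    { Carrier       = Σ Carrier λ T → ∀ i → weight T i ≡ exponent α i
    ; _≈_           = λ T U → proj₁ T ≈ proj₁ U
    ; isEquivalence = record
      { refl  = Setoid.refl objects
      ; sym   = Setoid.sym objects
      ; trans = Setoid.trans objects
      }
    }

-- Σx^ S ≈ F says that F is the sum of x^T over the T in S, each counted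
-- once up to the equality of S: for all α, exactly F α of them have
-- x^T = x^α.

infix 4 Σx^_≈_

Σx^_≈_ : WeightedFamily → PowerSeries → Set
Σx^ S ≈ F = ∀ α → Inverse (OfWeight S α) (setoid (Fin (F α)))

-- A tiling is given by the domino covering each cell of the diagram; the
-- values of tile outside the diagram are irrelevant.

record Paving (Λ : List ℕ) : Set where
  field
    tile       : Cell → Domino
    covers     : ∀ {c} → c ∈ᵞ Λ → c ∈ᵈ tile c
    inside     : ∀ {c c′} → c ∈ᵞ Λ → c′ ∈ᵈ tile c → c′ ∈ᵞ Λ
    consistent : ∀ {c c′} → c ∈ᵞ Λ → c′ ∈ᵈ tile c → tile c′ ≡ tile c

_∈ᵖ_ : ∀ {Λ} → Domino → Paving Λ → Set
_∈ᵖ_ {Λ} d P = ∃[ c ] c ∈ᵞ Λ × Paving.tile P c ≡ d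

LeftAdjacent : Domino → Domino → Set
LeftAdjacent d′ d = ∃[ x ] ∃[ y ] (x , y) ∈ᵈ d′ × (suc x , y) ∈ᵈ d

IsAdmissible : ∀ {Λ} → Paving Λ → Set
IsAdmissible P =
  ∀ c → vertical c ∈ᵖ P → CutBy 0ℤ (vertical c) →
  ¬ ((∃[ d ] d ∈ᵖ P × LeftAdjacent d (vertical c)) ×
     (∀ d → d ∈ᵖ P → LeftAdjacent d (vertical c) → Up′ d))

-- Only the values of label on the lower dominoes are relevant.

record ShiftedDominoTableau (Λ : List ℕ) : Set where
  field
    paving     : Paving Λ
    admissible : IsAdmissible paving
    label      : Domino → Letter
  open Paving paving public
  field
    isTableau  : IsTableau (λ c → c ∈ᵞ Λ × ¬ Up′ (tile c)) tile label

  LowDomino : Domino → Set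
  LowDomino d = d ∈ᵖ paving × ¬ Up′ d

  -- Each domino is counted at its corner.

  weight : ℕ → ℕ
  weight i = length (filter counted? (cells Λ))
    where
    counted? : ∀ c → Dec (corner (tile c) ≡ c × ¬ Up′ (tile c) × index (label (tile c)) ≡ i)
    counted? c = (corner (tile c) ≟ᶜ c) ×-dec ¬? (Up′? (tile c)) ×-dec (index (label (tile c)) ≟ i)

  NoPrimedOnD₀ : Set
  NoPrimedOnD₀ = ∀ d → d ∈ᵖ paving → CutBy 0ℤ d → Unprimed (label d)

record SameLowerPart {Λ} (T U : ShiftedDominoTableau Λ) : Set where
  private
    module T = ShiftedDominoTableau T
    module U = ShiftedDominoTableau U
  field
    lowDominoes : ∀ d → T.LowDomino d ⇔ U.LowDomino d
    labels      : ∀ d → T.LowDomino d → T.label d ≡ U.label d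

dominoTableaux : List ℕ → WeightedFamily
dominoTableaux Λ = record
  { objects = record
    { Carrier       = Σ (ShiftedDominoTableau Λ) ShiftedDominoTableau.NoPrimedOnD₀
    ; _≈_           = λ T U → SameLowerPart (proj₁ T) (proj₁ U)
    ; isEquivalence = record
      { refl  = record { lowDominoes = λ _ → mk⇔ id id ; labels = λ _ _ → refl }
      ; sym   = λ p → record
        { lowDominoes = λ d → mk⇔ (from (lowDominoes p d)) (to (lowDominoes p d))
        ; labels      = λ d l → sym (labels p d (from (lowDominoes p d) l))
        }
      ; trans = λ p q → record
        { lowDominoes = λ d → mk⇔ (to (lowDominoes q d) ∘ to (lowDominoes p d))
                                  (from (lowDominoes p d) ∘ from (lowDominoes q d))
        ; labels      = λ d l → trans (labels p d l) (labels q d (to (lowDominoes p d) l))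
        }
      }
    }
  ; weight = ShiftedDominoTableau.weight ∘ proj₁
  }
  where
  open SameLowerPart
  open Equivalence using (to; from)

LowCell : List ℕ → Cell → Set
LowCell μ c = c ∈ᵞ μ × ¬ Up c

-- Only the values of fill on the lower cells are relevant.

record ShiftedYoungTableau (μ : List ℕ) : Set where
  field
    fill      : Cell → Letter
    isTableau : IsTableau (LowCell μ) id fill

lowCells : List ℕ → List Cell
lowCells μ = filter (λ c → ¬? (0ℤ ℤ.<? content c)) (cells μ)

fillWeight : List ℕ → (Cell → Letter) → ℕ → ℕ
fillWeight μ f i = length (filter (λ c → index (f c) ≟ i) (lowCells μ))

NoPrimedOnDiagonal : List ℕ → (Cell → Letter) → Set
NoPrimedOnDiagonal μ f = ∀ c → c ∈ᵞ μ → content c ≡ 0ℤ → Unprimed (f c)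

youngTableaux : List ℕ → WeightedFamily
youngTableaux μ = record
  { objects = record
    { Carrier       = Σ (ShiftedYoungTableau μ) (NoPrimedOnDiagonal μ ∘ fill)
    ; _≈_           = λ t u → ∀ c → LowCell μ c → fill (proj₁ t) c ≡ fill (proj₁ u) c
    ; isEquivalence = record
      { refl  = λ _ _ → refl
      ; sym   = λ p c l → sym (p c l)
      ; trans = λ p q c l → trans (p c l) (q c l)
      }
    }
  ; weight = fillWeight μ ∘ fill ∘ proj₁
  }
  where open ShiftedYoungTableau

-- The coefficients of P_μ are finite: for each monomial there are finitely
-- many shifted Young tableaux.

finite : (S : DecSetoid 0ℓ 0ℓ) → ∀ {xs} → IsEnumeration (DecSetoid.setoid S) xs →
         ∃[ n ] Inverse (DecSetoid.setoid S) (setoid (Fin n))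
finite S {xs} enum = length ys , record
  { to        = position
  ; from      = lookup ys
  ; to-cong   = λ {x} {y} x≈y → injective unique _ _
                  (≈.trans (≈.sym (at x)) (≈.trans x≈y (at y)))
  ; from-cong = λ { refl → ≈.refl }
  ; inverse   = (λ {i} {x} x≈ → injective unique _ _ (≈.trans (≈.sym (at x)) x≈))
              , (λ { {x} refl → ≈.sym (at x) })
  }
  where
  module ≈ = DecSetoid S
  open ≈ using (_≈_)
  ys = deduplicate ≈._≟_ xs
  unique = Unique.deduplicate-! S xs
  enum′ : IsEnumeration ≈.setoid ys
  enum′ = Enumerates.deduplicate⁺ S enum
  position : ≈.Carrier → Fin (length ys)
  position x = Any.index (enum′ x)
  at : ∀ x → x ≈ lookup ys (position x)
  at x = lookup-index (enum′ x)
  injective : ∀ {zs} → AllPairs (λ x y → ¬ x ≈ y) zs →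
              ∀ i j → lookup zs i ≈ lookup zs j → i ≡ j
  injective (_ ∷ _)  zero    zero    _ = refl
  injective (p ∷ _)  zero    (suc j) e = contradiction e (All.lookup p (∈-lookup j))
  injective (p ∷ _)  (suc i) zero    e = contradiction (≈.sym e) (All.lookup p (∈-lookup i))
  injective (_ ∷ ps) (suc i) (suc j) e = cong suc (injective ps i j e)

∈-cells⁺ : ∀ Λ {c} → c ∈ᵞ Λ → c ∈ cells Λ
∈-cells⁺ Λ {x , y} x<r =
  ∈-concatMap⁺ _ (lose (∈-upTo⁺ (y<length Λ y x<r)) (∈-map⁺ (_, y) (∈-upTo⁺ x<r)))
  where
  y<length : ∀ Λ y {x} → x < rowLength Λ y → y < length Λ
  y<length (_ ∷ _) zero    _ = z<s
  y<length (_ ∷ Λ) (suc y) p = s<s (y<length Λ y p)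

∈-cells⁻ : ∀ Λ {c} → c ∈ cells Λ → c ∈ᵞ Λ
∈-cells⁻ Λ c∈ with find (∈-concatMap⁻ _ {xs = upTo (length Λ)} c∈)
... | y , _ , p with ∈-map⁻ (_, y) p
... | x , x∈ , refl = ∈-upTo⁻ x∈

module _ (μ : List ℕ) where

  private
    low? : ∀ c → Dec (¬ Up c)
    low? c = ¬? (0ℤ ℤ.<? content c)

  ∈-lowCells⁺ : ∀ {c} → LowCell μ c → c ∈ lowCells μ
  ∈-lowCells⁺ (c∈ , ¬up) = ∈-filter⁺ low? (∈-cells⁺ μ c∈) ¬up

  ∈-lowCells⁻ : ∀ {c} → c ∈ lowCells μ → LowCell μ c
  ∈-lowCells⁻ c∈ with ∈-filter⁻ low? {xs = cells μ} c∈
  ... | c∈′ , ¬up = ∈-cells⁻ μ c∈′ , ¬up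

  private
    cs = lowCells μ

    allLow? : ∀ {P : Cell → Set} → (∀ c → Dec (P c)) → Dec (∀ c → LowCell μ c → P c)
    allLow? P? = map′ (λ a c l → All.lookup a (∈-lowCells⁺ l))
                      (λ f → All.tabulate λ c∈ → f _ (∈-lowCells⁻ c∈))
                      (All.all? P? cs)

    primed? : ∀ a → Dec (Primed a)
    primed? (primed   _) = yes tt
    primed? (unprimed _) = no λ ()

    _≟ᴸ_ : (a b : Letter) → Dec (a ≡ b)
    primed   i ≟ᴸ primed   j = map′ (cong primed)   (λ { refl → refl }) (i ≟ j)
    unprimed i ≟ᴸ unprimed j = map′ (cong unprimed) (λ { refl → refl }) (i ≟ j)
    primed   i ≟ᴸ unprimed j = no λ ()
    unprimed i ≟ᴸ primed   j = no λ ()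

    isTableau? : ∀ f → Dec (IsTableau (LowCell μ) id f)
    isTableau? f = map′
      (λ (r , c , u , p) → record
        { rows                  = λ l l′ → r _ l _ l′ refl
        ; columns               = λ l l′ → c _ l _ l′ refl
        ; unprimedOncePerColumn = λ l l′ → u _ l _ l′ refl
        ; primedOncePerRow      = λ l l′ → p _ l _ l′ refl
        })
      (λ t → let open IsTableau t in
          (λ { _ l _ l′ refl → rows l l′ })
        , (λ { _ l _ l′ refl → columns l l′ })
        , (λ { _ l _ l′ refl → unprimedOncePerColumn l l′ })
        , (λ { _ l _ l′ refl → primedOncePerRow l l′ }))
      (  (allLow? λ (x , y) → allLow? λ (x′ , y′) →
            (y ≟ y′) →-dec (x ≤? x′) →-dec (rank (f (x , y)) ≤? rank (f (x′ , y′))))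
       ×-dec (allLow? λ (x , y) → allLow? λ (x′ , y′) →
            (x ≟ x′) →-dec (y ≤? y′) →-dec (rank (f (x , y)) ≤? rank (f (x′ , y′))))
       ×-dec (allLow? λ (x , y) → allLow? λ (x′ , y′) →
            (x ≟ x′) →-dec ¬? (primed? (f (x , y))) →-dec
            (f (x , y) ≟ᴸ f (x′ , y′)) →-dec ((x , y) ≟ᶜ (x′ , y′)))
       ×-dec (allLow? λ (x , y) → allLow? λ (x′ , y′) →
            (y ≟ y′) →-dec primed? (f (x , y)) →-dec
            (f (x , y) ≟ᴸ f (x′ , y′)) →-dec ((x , y) ≟ᶜ (x′ , y′))))

    onDiagonal⇒low : ∀ {c} → c ∈ᵞ μ → content c ≡ 0ℤ → LowCell μ c
    onDiagonal⇒low c∈ e = c∈ , λ up → ℤ.<-irrefl (sym e) up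

    noPrimed? : ∀ f → Dec (NoPrimedOnDiagonal μ f)
    noPrimed? f = map′
      (λ g c c∈ e → g c (onDiagonal⇒low c∈ e) e)
      (λ g c l e → g c (proj₁ l) e)
      (allLow? λ c → (content c ℤ.≟ 0ℤ) →-dec ¬? (primed? (f c)))

    Agree : (Cell → Letter) → (Cell → Letter) → Set
    Agree f g = ∀ c → LowCell μ c → f c ≡ g c

    agree-isTableau : ∀ {f g} → Agree f g → IsTableau (LowCell μ) id f → IsTableau (LowCell μ) id g
    agree-isTableau e t = record
      { rows                  = λ l l′ → subst₂ _≤ᴸ_ (e _ l) (e _ l′) ∘ rows l l′
      ; columns               = λ l l′ → subst₂ _≤ᴸ_ (e _ l) (e _ l′) ∘ columns l l′
      ; unprimedOncePerColumn = λ l l′ u q → unprimedOncePerColumn l l′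
          (subst Unprimed (sym (e _ l)) u) (trans (e _ l) (trans q (sym (e _ l′))))
      ; primedOncePerRow      = λ l l′ u q → primedOncePerRow l l′
          (subst Primed (sym (e _ l)) u) (trans (e _ l) (trans q (sym (e _ l′))))
      }
      where open IsTableau t

    agree-weight : ∀ {f g} → Agree f g → ∀ i → fillWeight μ f i ≡ fillWeight μ g i
    agree-weight {f} {g} e i = cong length (go cs λ c c∈ → e c (∈-lowCells⁻ c∈))
      where
      go : ∀ ds → (∀ c → c ∈ ds → f c ≡ g c) →
           filter (λ c → index (f c) ≟ i) ds ≡ filter (λ c → index (g c) ≟ i) ds
      go []       _ = refl
      go (c ∷ ds) h rewrite h c (here refl) with index (g c) ≡ᵇ i
      ... | true  = cong (c ∷_) (go ds (λ c′ → h c′ ∘ there))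
      ... | false = go ds (λ c′ → h c′ ∘ there)

    letters : ℕ → List Letter
    letters n = map primed (upTo n) ++ map unprimed (upTo n)

    ∈-letters : ∀ {n} a → index a < n → a ∈ letters n
    ∈-letters     (primed   i) i<n = ∈-++⁺ˡ (∈-map⁺ primed (∈-upTo⁺ i<n))
    ∈-letters {n} (unprimed i) i<n = ∈-++⁺ʳ (map primed (upTo n)) (∈-map⁺ unprimed (∈-upTo⁺ i<n))

    update : Cell → Letter → (Cell → Letter) → Cell → Letter
    update c a f c′ with c ≟ᶜ c′
    ... | yes _ = a
    ... | no  _ = f c′

    fillings : ℕ → List Cell → List (Cell → Letter)
    fillings n []       = (λ _ → primed 0) ∷ []
    fillings n (c ∷ ds) = cartesianProductWith (update c) (letters n) (fillings n ds)

    fillings-complete : ∀ n ds (f : Cell → Letter) → (∀ c → c ∈ ds → index (f c) < n) →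
                        ∃[ g ] g ∈ fillings n ds × (∀ c → c ∈ ds → f c ≡ g c)
    fillings-complete n []       f b = _ , here refl , λ _ ()
    fillings-complete n (d ∷ ds) f b with fillings-complete n ds f (λ c → b c ∘ there)
    ... | g , g∈ , e =
      update d (f d) g
      , ∈-cartesianProductWith⁺ (update d) (∈-letters (f d) (b d (here refl))) g∈
      , agrees
      where
      agrees : ∀ c → c ∈ d ∷ ds → f c ≡ update d (f d) g c
      agrees c c∈ with d ≟ᶜ c
      ... | yes refl = refl
      agrees c (here refl) | no d≢c = contradiction refl d≢c
      agrees c (there c∈)  | no _   = e c c∈

    exponent-beyond : ∀ α i → length α ≤ i → exponent α i ≡ 0
    exponent-beyond []      _       _       = refl
    exponent-beyond (_ ∷ α) (suc i) (s≤s p) = exponent-beyond α i p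

  module _ (α : Monomial) where

    private
      open WeightedFamily (youngTableaux μ) using (Carrier; weight)
      open ShiftedYoungTableau

      HasWeight : (Cell → Letter) → Set
      HasWeight f = ∀ i → fillWeight μ f i ≡ exponent α i

      bounded : ∀ {f} → HasWeight f → ∀ c → LowCell μ c → index (f c) < length α
      bounded {f} w c l with index (f c) <? length α
      ... | yes p = p
      ... | no ¬p = contradiction
        (subst (0 <_) (trans (w (index (f c))) (exponent-beyond α _ (ℕ.≮⇒≥ ¬p)))
          (filter-some (λ c′ → index (f c′) ≟ index (f c)) (lose (∈-lowCells⁺ l) refl)))
        λ ()

      hasWeight? : ∀ f → Dec (HasWeight f)
      hasWeight? f = map′
        (λ (b , w) i → case i <? length α of λ where
          (yes p) → All.lookup w (∈-upTo⁺ p)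
          (no ¬p) → trans
            (cong length (filter-none (λ c → index (f c) ≟ i)
              (All.tabulate λ {c} c∈ e → ¬p (subst (_< length α) e (b c (∈-lowCells⁻ c∈))))))
            (sym (exponent-beyond α i (ℕ.≮⇒≥ ¬p))))
        (λ w → bounded {f} w , All.tabulate λ {i} _ → w i)
        ((allLow? λ c → index (f c) <? length α)
         ×-dec All.all? (λ i → fillWeight μ f i ≟ exponent α i) (upTo (length α)))

      Tableau : Set
      Tableau = Setoid.Carrier (OfWeight (youngTableaux μ) α)

      filling : Tableau → Cell → Letter
      filling ((t , _) , _) = fill t

      tableaux : List (Cell → Letter) → List Tableau
      tableaux []       = []
      tableaux (f ∷ fs) with isTableau? f | noPrimed? f | hasWeight? f
      ... | yes t | yes p | yes w = ((record { fill = f ; isTableau = t } , p) , w) ∷ tableaux fs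
      ... | _     | _     | _     = tableaux fs

      tableaux-complete : ∀ (t : Tableau) fs {g} → g ∈ fs → Agree (filling t) g →
                          Any (λ u → Agree (filling t) (filling u)) (tableaux fs)
      tableaux-complete t (f ∷ fs) g∈ e
        with isTableau? f | noPrimed? f | hasWeight? f
      tableaux-complete t (f ∷ fs) (here refl) e | yes _ | yes _ | yes _ = here e
      tableaux-complete t (f ∷ fs) (there g∈)  e | yes _ | yes _ | yes _ =
        there (tableaux-complete t fs g∈ e)
      tableaux-complete t (f ∷ fs) (there g∈)  e | no _  | _     | _     = tableaux-complete t fs g∈ e
      tableaux-complete t (f ∷ fs) (there g∈)  e | yes _ | no _  | _     = tableaux-complete t fs g∈ e
      tableaux-complete t (f ∷ fs) (there g∈)  e | yes _ | yes _ | no _  = tableaux-complete t fs g∈ e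
      tableaux-complete ((t , p) , w) (f ∷ fs) (here refl) e | no ¬t | _ | _ =
        contradiction (agree-isTableau e (isTableau t)) ¬t
      tableaux-complete ((t , p) , w) (f ∷ fs) (here refl) e | yes _ | no ¬p | _ =
        contradiction
          (λ c c∈ z → subst Unprimed (e c (onDiagonal⇒low c∈ z)) (p c c∈ z)) ¬p
      tableaux-complete ((t , p) , w) (f ∷ fs) (here refl) e | yes _ | yes _ | no ¬w =
        contradiction (λ i → trans (sym (agree-weight e i)) (w i)) ¬w

    youngTableaux-finite : ∃[ n ] Inverse (OfWeight (youngTableaux μ) α) (setoid (Fin n))
    youngTableaux-finite = finite
      (record
        { isDecEquivalence = record
          { isEquivalence = Setoid.isEquivalence (OfWeight (youngTableaux μ) α)
          ; _≟_ = λ t u → allLow? λ c → filling t c ≟ᴸ filling u c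
          } })
      λ t → let g , g∈ , e = fillings-complete (length α) cs (filling t)
                               (λ c c∈ → bounded {filling t} (proj₂ t) c (∈-lowCells⁻ c∈))
            in tableaux-complete t (fillings (length α) cs) g∈ λ c l → e c (∈-lowCells⁺ l)

-- schurP-sum is the defining property of schurP.

schurP : List ℕ → PowerSeries
schurP μ α = proj₁ (youngTableaux-finite μ α)

schurP-sum : ∀ μ → Σx^ youngTableaux μ ≈ schurP μ
schurP-sum μ α = proj₂ (youngTableaux-finite μ α)

{-# OPTIONS --safe #-}

-- A lower domino meets two consecutive diagonals, of contents -m and 1 - m;
-- call m ≥ 0 its subdiagonal.  Refine the letters to keys (by content, from
-- left to right for an unprimed letter, from bottom to top for a primed one),
-- so that distinct lower dominoes have distinct keys, and let A m τ be the
-- number of dominoes on the subdiagonal m with key less than τ.  Then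
-- N i τ = A i τ + A (i + 1) τ is the number of cells of content -i with key less
-- than τ, and the conditions on rows and columns say that
-- 0 ≤ N i τ - N (i + 1) τ ≤ 1 for all i and τ, that is, that
-- 0 ≤ A m τ - A (m + 2) τ ≤ 1.  These are the conditions on rows and columns for
-- two shifted Young tableaux, one given by the even m and one by the odd m.
-- So a domino tableau and a pair of Young tableaux are both the same as
-- the set of the keys which they use, their code.
--
-- A code is turned into a paving by adding the dominoes in the order of
-- their keys, the upper part being completed along the way; admissibility is
-- what makes the lower part of the paving depend on the code only.  That the
-- shapes match is the additivity of boundaries: in terms of the numbers
-- Lᵢ = λᵢ + ℓ - i, the boundary of λ is the sum of those of μ and ν.

module Submission where

open import Data.Bool.Base using (Bool; true; false; not; if_then_else_)
open import Data.Bool.Properties as Bool using (not-¬)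
open import Data.Empty using (⊥; ⊥-elim)
open import Data.Fin.Base using (Fin; _↑ˡ_; _↑ʳ_; splitAt; combine; remQuot)
open import Data.Fin.Properties using (splitAt-↑ˡ; splitAt-↑ʳ; join-splitAt; remQuot-combine; combine-remQuot)
open import Data.Integer.Base as ℤ using (0ℤ; ∣_∣; +<+)
import Data.Integer.Properties as ℤ
open import Data.List.Base using (List; []; _∷_; _++_; length; map; filter; upTo; downFrom; last; zip)
open import Data.List.Membership.Propositional using (_∈_; lose; find)
open import Data.List.Membership.Propositional.Properties
  using (∈-filter⁺; ∈-filter⁻; ∈-map⁺; ∈-map⁻; ∈-++⁺ˡ; ∈-++⁺ʳ; ∈-++⁻; ∈-upTo⁺; ∈-upTo⁻; ∈-downFrom⁺; ∈-downFrom⁻; ∈-cartesianProductWith⁺; ∈-cartesianProductWith⁻)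
open import Data.List.Membership.Propositional.Properties.WithK using (unique∧set⇒bag; unique⇒irrelevant)
open import Data.List.Properties using (length-map; length-++; filter-accept; filter-reject; ∷-injective)
open import Data.List.Relation.Binary.BagAndSetEquality using (∼bag⇒↭)
open import Data.List.Relation.Binary.Permutation.Propositional as ↭ using (_↭_)
open import Data.List.Relation.Binary.Permutation.Propositional.Properties using (↭-length)
open import Data.List.Relation.Unary.All as All using (All; []; _∷_)
import Data.List.Relation.Unary.All.Properties as All
open import Data.List.Relation.Unary.AllPairs as AllPairs using (AllPairs; []; _∷_)
import Data.List.Relation.Unary.AllPairs.Properties as AllPairs
open import Data.List.Relation.Unary.Any as Any using (Any; here; there)
open import Data.List.Relation.Unary.Linked using (Linked; []; [-]; _∷_)
open import Data.List.Relation.Unary.Unique.Propositional using (Unique)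
import Data.List.Relation.Unary.Unique.Propositional.Properties as Unique
import Data.Maybe.Relation.Unary.All as Maybe
open import Data.Nat.Base
open import Data.Nat.Divisibility as ℕ using (divides-refl; m∣m*n; ∣m+n∣m⇒∣n; ∣⇒≤)
open import Data.Nat.DivMod using (_/_; _%_; m≡m%n+[m/n]*n; m%n<n; [m+kn]%n≡m%n; m<n⇒m%n≡m; m<n⇒m/n≡0; m*n/n≡m; +-distrib-/-∣ʳ)
open import Data.Nat.ListAction using (sum)
open import Data.Nat.Properties
open import Data.Nat.Tactic.RingSolver using (solve-∀)
open import Data.Product.Base using (Σ; ∃-syntax; _×_; _,_; proj₁; proj₂)
open import Data.Product.Relation.Binary.Pointwise.NonDependent using (×-setoid)
open import Data.Sum.Base using (_⊎_; inj₁; inj₂; [_,_]′)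
open import Data.Unit.Base using (tt)
open import Defs
open import Function.Base using (_∘_; id; case_of_)
open import Function.Bundles using (Inverse; _⇔_; mk⇔; Equivalence)
import Function.Construct.Composition as Composition
open import Relation.Binary.Bundles using (Setoid)
open import Relation.Binary.Construct.Closure.ReflexiveTransitive as Star using (Star; _◅_)
open import Relation.Binary.Definitions using (tri<; tri≈; tri>)
open import Relation.Binary.PropositionalEquality
open import Relation.Nullary using (¬_; Dec; yes; no; contradiction)
open import Relation.Nullary.Decidable using (map′; ¬?; _×-dec_; decidable-stable; dec-true; dec-false)
open import Data.List.Membership.DecPropositional _≟ᶜ_ using (_∈?_)

-- Counters

-- Keys are natural numbers so that they can serve as times: "the j-th cell of a diagonal has key τ"
-- becomes "the counter of the diagonal passes from j to j + 1 at τ". Comparing neighbouring cells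
-- is then comparing two counters.
--
-- The obstacle is the main diagonal. The key of a lower cell gives the level of its domino, which
-- leaves two positions for the domino; elsewhere the wrong one would repeat a key on a diagonal. On
-- `D₀`, a domino of level 0 goes left or up to a cell of content 1, where keys are not compared.
-- Admissibility makes the vertical dominoes with corner on `D₀` an initial segment of the diagonal,
-- and this settles the choice. In the paving built from a code, the domino of level 0 added at τ is
-- vertical exactly when `A 1 τ` is 0, a condition that is never regained once lost, so that the
-- paving is admissible.
--
-- Pavability enters through the chessboard colouring: equally many cells of both colours means that
-- the even and the odd Lᵢ are equally many if ℓ is even, and that there is one more even one if ℓ
-- is odd. This places the main diagonals of μ and ν on the subdiagonals 0 and 1.

record Slow (n : ℕ → ℕ) : Set where
  field
    step : ∀ τ → n (suc τ) ≡ n τ ⊎ n (suc τ) ≡ suc (n τ)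

  suc-mono : ∀ τ → n τ ≤ n (suc τ)
  suc-mono τ with step τ
  ... | inj₁ e = ≤-reflexive (sym e)
  ... | inj₂ e = ≤-trans (n≤1+n _) (≤-reflexive (sym e))

  mono : ∀ {σ τ} → σ ≤ τ → n σ ≤ n τ
  mono {σ} σ≤τ with ≤⇒≤′ σ≤τ
  ... | p = go p
    where
    go : ∀ {τ} → σ ≤′ τ → n σ ≤ n τ
    go ≤′-refl        = ≤-refl
    go (≤′-step {τ} p) = ≤-trans (go p) (suc-mono τ)

At : (ℕ → ℕ) → ℕ → ℕ → Set
At n τ j = n τ ≡ j × n (suc τ) ≡ suc j

module _ {n : ℕ → ℕ} (slow : Slow n) where
  open Slow slow

  at : ∀ {τ j} → n τ ≤ j → j < n (suc τ) → At n τ j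
  at {τ} {j} p q with step τ
  ... | inj₁ e = contradiction (<-≤-trans q (≤-trans (≤-reflexive e) p)) (<-irrefl refl)
  ... | inj₂ e with ≤-antisym p (s≤s⁻¹ (subst (j <_) e q))
  ...   | refl = refl , e

  at-below : ∀ {τ j σ} → At n τ j → τ < σ → j < n σ
  at-below {τ} {j} (_ , e) τ<σ = subst (_≤ n _) e (mono τ<σ)

  at-above : ∀ {τ j σ} → At n τ j → j < n σ → τ < σ
  at-above {τ} {j} {σ} (e , _) j<nσ with τ <? σ
  ... | yes p = p
  ... | no ¬p = contradiction (<-≤-trans j<nσ (≤-trans (mono (≮⇒≥ ¬p)) (≤-reflexive e))) (<-irrefl refl)

  at-unique : ∀ {σ τ j} → At n σ j → At n τ j → σ ≡ τ
  at-unique {σ} {τ} p q = ≤-antisym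
    (s≤s⁻¹ (at-above p (at-below q ≤-refl)))
    (s≤s⁻¹ (at-above q (at-below p ≤-refl)))

search : (ℕ → ℕ) → ℕ → ℕ → ℕ
search n zero    j = 0
search n (suc R) j with j <? n R
... | yes _ = search n R j
... | no  _ = R

search-at : ∀ {n} → Slow n → ∀ R {j} → n 0 ≤ j → j < n R → At n (search n R j) j × search n R j < R
search-at slow zero    p q = contradiction (<-≤-trans q p) (<-irrefl refl)
search-at {n} slow (suc R) {j} p q with j <? n R
... | yes j<nR = let a , b = search-at slow R p j<nR in a , m<n⇒m<1+n b
... | no ¬j<nR = at slow (≮⇒≥ ¬j<nR) q , ≤-refl

-- By induction on `τ`, `key j < τ` and `j < n τ` are equivalent. If `n` steps at `τ`, then `τ` is
-- the key of some `j₀`; the indices below `j₀` are already counted and `j₀` is not, so `j₀` is the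
-- present count.
sequence-at : ∀ {n d} (slow : Slow n) (key : ℕ → ℕ) → n 0 ≡ 0 →
              (∀ {i j} → i < j → j < d → key i < key j) →
              (∀ {j} → j < d → n (suc (key j)) ≡ suc (n (key j))) →
              (∀ {τ} → n (suc τ) ≡ suc (n τ) → ∃[ j ] j < d × key j ≡ τ) →
              ∀ {j} → j < d → At n (key j) j
sequence-at {n} {d} slow key n0 incr hit hit⁻ {j} j<d =
  at slow (≮⇒≥ λ q → <-irrefl refl (proj₂ (claim (key j) j j<d) q))
          (proj₁ (claim (suc (key j)) j j<d) ≤-refl)
  where
  open Slow slow
  weak : ∀ {i j} → key i ≤ key j → i < d → i ≤ j
  weak p i<d = ≮⇒≥ λ j<i → <⇒≱ (incr j<i i<d) p
  claim : ∀ τ j → j < d → (key j < τ → j < n τ) × (j < n τ → key j < τ)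
  claim zero    j _ = (λ ()) , λ q → contradiction (subst (j <_) n0 q) λ ()
  claim (suc τ) j j<d with step τ
  ... | inj₁ e =
      (λ p → subst (j <_) (sym e) (proj₁ (claim τ j j<d) (≤∧≢⇒< (s≤s⁻¹ p) λ { refl → 1+n≢n (trans (sym (hit j<d)) e) })))
    , (λ q → m<n⇒m<1+n (proj₂ (claim τ j j<d) (subst (j <_) e q)))
  ... | inj₂ e with hit⁻ e
  ...   | j₀ , j₀<d , key≡ =
      (λ p → subst (j <_) (sym e) (≤-<-trans (weak (≤-trans (s≤s⁻¹ p) (≤-reflexive (sym key≡))) j<d)
                                             (subst (_< suc (n τ)) (sym j₀≡) ≤-refl)))
    , (λ q → s≤s (≤-trans (key≤ (subst (j ≤_) (sym j₀≡) (s≤s⁻¹ (subst (j <_) e q)))) (≤-reflexive key≡)))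
    where
    least : ∀ j → j < j₀ → j < n τ
    least j p = proj₁ (claim τ j (<-trans p j₀<d)) (subst (key j <_) key≡ (incr p j₀<d))
    j₀≡ : j₀ ≡ n τ
    j₀≡ with <-cmp j₀ (n τ)
    ... | tri< p _ _ = contradiction (proj₂ (claim τ j₀ j₀<d) p) (<-irrefl key≡)
    ... | tri≈ _ p _ = p
    ... | tri> _ _ p = contradiction (least (n τ) p) (<-irrefl refl)
    key≤ : j ≤ j₀ → key j ≤ key j₀
    key≤ p with m≤n⇒m<n∨m≡n p
    ... | inj₁ q    = <⇒≤ (incr q j₀<d)
    ... | inj₂ refl = ≤-refl

increasing : ∀ {d} (key : ℕ → ℕ) → (∀ {j} → suc j < d → key j < key (suc j)) →
             ∀ {i j} → i < j → j < d → key i < key j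
increasing {d} key s i<j j<d = go (≤⇒≤′ i<j) j<d
  where
  go : ∀ {i j} → suc i ≤′ j → j < d → key i < key j
  go ≤′-refl     q = s q
  go (≤′-step p) q = <-trans (go p (<-trans ≤-refl q)) (s q)

-- Letters and keys

next : Letter → Letter
next (primed   i) = primed (suc i)
next (unprimed i) = unprimed (suc i)

ofRank : ℕ → Letter
ofRank 0             = primed 0
ofRank 1             = unprimed 0
ofRank (suc (suc r)) = next (ofRank r)

rank-next : ∀ a → rank (next a) ≡ 2 + rank a
rank-next (primed   i) = *-suc 2 i
rank-next (unprimed i) = cong suc (*-suc 2 i)

rank-ofRank : ∀ r → rank (ofRank r) ≡ r
rank-ofRank 0 = refl
rank-ofRank 1 = refl
rank-ofRank (suc (suc r)) = trans (rank-next (ofRank r)) (cong (2 +_) (rank-ofRank r))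

ofRank-rank : ∀ a → ofRank (rank a) ≡ a
ofRank-rank (primed   zero)    = refl
ofRank-rank (primed   (suc i)) = trans (cong ofRank (*-suc 2 i)) (cong next (ofRank-rank (primed i)))
ofRank-rank (unprimed zero)    = refl
ofRank-rank (unprimed (suc i)) = trans (cong (ofRank ∘ suc) (*-suc 2 i)) (cong next (ofRank-rank (unprimed i)))

rank-injective : ∀ {a b} → rank a ≡ rank b → a ≡ b
rank-injective {a} {b} e = trans (sym (ofRank-rank a)) (trans (cong ofRank e) (ofRank-rank b))

primed? : ∀ a → Dec (Primed a)
primed? (primed   _) = yes tt
primed? (unprimed _) = no λ ()

-- Keys order the dominoes (or cells) with the same letter from left to
-- right if it is unprimed and from bottom to top if it is primed.

module Keys (b : ℕ) where

  B : ℕ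
  B = suc b

  -- Moving right or down raises the subdiagonal `m`. So left to right is increasing `m`, and bottom
  -- to top is decreasing `m`, whence the reversal `b ∸ m`; both offsets are their own inverses for
  -- `m ≤ b`.
  offset : Letter → ℕ → ℕ
  offset (primed   _) m = b ∸ m
  offset (unprimed _) m = m

  key : Letter → ℕ → ℕ
  key a m = offset a m + rank a * B

  letter : ℕ → Letter
  letter τ = ofRank (τ / B)

  sub : ℕ → ℕ
  sub τ = offset (letter τ) (τ % B)

  offset< : ∀ a {m} → m < B → offset a m < B
  offset< (primed   _) {m} _ = s≤s (m∸n≤m b m)
  offset< (unprimed _) p = p

  offset-involutive : ∀ a {m} → m < B → offset a (offset a m) ≡ m
  offset-involutive (primed   _) p = m∸[m∸n]≡n (s≤s⁻¹ p)
  offset-involutive (unprimed _) _ = refl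

  sub< : ∀ τ → sub τ < B
  sub< τ = offset< (letter τ) (m%n<n τ B)

  letter-key : ∀ a {m} → m < B → letter (key a m) ≡ a
  letter-key a {m} p = trans (cong ofRank quotient) (ofRank-rank a)
    where
    quotient : key a m / B ≡ rank a
    quotient = trans (+-distrib-/-∣ʳ (offset a m) (divides-refl (rank a)))
      (cong₂ _+_ (m<n⇒m/n≡0 (offset< a p)) (m*n/n≡m (rank a) B))

  sub-key : ∀ a {m} → m < B → sub (key a m) ≡ m
  sub-key a {m} p = trans (cong₂ offset (letter-key a p)
    (trans ([m+kn]%n≡m%n (offset a m) (rank a) B) (m<n⇒m%n≡m (offset< a p))))
    (offset-involutive a p)

  key-letter-sub : ∀ τ → key (letter τ) (sub τ) ≡ τ
  key-letter-sub τ = trans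
    (cong₂ _+_ (offset-involutive (letter τ) (m%n<n τ B)) (cong (_* B) (rank-ofRank (τ / B))))
    (sym (m≡m%n+[m/n]*n τ B))

  key-injective : ∀ {σ τ} → letter σ ≡ letter τ → sub σ ≡ sub τ → σ ≡ τ
  key-injective {σ} {τ} p q = trans (sym (key-letter-sub σ)) (trans (cong₂ key p q) (key-letter-sub τ))

  key-< : ∀ {a c m m′} → m < B → rank a < rank c → key a m < key c m′
  key-< {a} {c} {m} {m′} p q = <-≤-trans (+-monoˡ-< (rank a * B) (offset< a p))
    (≤-trans (*-monoˡ-≤ B q) (m≤n+m (rank c * B) (offset c m′)))

  key-≤⁻ : ∀ {a c m m′} → m′ < B → key a m ≤ key c m′ → a ≤ᴸ c
  key-≤⁻ {a} {c} p q = ≮⇒≥ λ r → <⇒≱ (key-< {c} {a} p r) q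

  letter-mono : ∀ {σ τ} → σ ≤ τ → letter σ ≤ᴸ letter τ
  letter-mono {σ} {τ} p = key-≤⁻ {letter σ} {letter τ} (sub< τ)
    (subst₂ _≤_ (sym (key-letter-sub σ)) (sym (key-letter-sub τ)) p)

  key-≤-unprimed : ∀ {a m m′} → Unprimed a → m ≤ m′ → key a m ≤ key a m′
  key-≤-unprimed {primed   _} u _ = contradiction tt u
  key-≤-unprimed {unprimed _} _ p = +-monoˡ-≤ _ p

  key-≤-primed : ∀ {a m m′} → Primed a → m′ ≤ m → key a m ≤ key a m′
  key-≤-primed {primed   _} _ p = +-monoˡ-≤ _ (∸-monoʳ-≤ b p)

  sub-mono : ∀ {σ τ} → σ ≤ τ → letter σ ≡ letter τ → Unprimed (letter σ) → sub σ ≤ sub τ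
  sub-mono {σ} {τ} p e u = ≮⇒≥ λ q → case m≤n⇒m<n∨m≡n
      (subst₂ _≤_ (key-letter-sub τ) (trans (cong (λ a → key a (sub σ)) (sym e)) (key-letter-sub σ))
        (key-≤-unprimed (subst Unprimed e u) (<⇒≤ q))) of λ where
    (inj₁ r) → <⇒≱ r p
    (inj₂ refl) → <-irrefl refl q

  sub-antimono : ∀ {σ τ} → σ ≤ τ → letter σ ≡ letter τ → Primed (letter σ) → sub τ ≤ sub σ
  sub-antimono {σ} {τ} p e u = ≮⇒≥ λ q → case m≤n⇒m<n∨m≡n
      (subst₂ _≤_ (key-letter-sub τ) (trans (cong (λ a → key a (sub σ)) (sym e)) (key-letter-sub σ))
        (key-≤-primed (subst Primed e u) (<⇒≤ q))) of λ where
    (inj₁ r) → <⇒≱ r p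
    (inj₂ refl) → <-irrefl refl q

  key-≤-lex : ∀ {a c m m′} → m < B → a ≤ᴸ c → (a ≡ c → key a m ≤ key a m′) → key a m ≤ key c m′
  key-≤-lex {a} {c} {m} {m′} p q h with m≤n⇒m<n∨m≡n q
  ... | inj₁ r = <⇒≤ (key-< {a} {c} p r)
  ... | inj₂ r with rank-injective {a} {c} r
  ...   | refl = h refl

-- Codes

up⁺ : ∀ {x y} → x < y → Up (x , y)
up⁺ {x} {y} p = subst (0ℤ ℤ.<_) (sym (ℤ.⊖-≥ (<⇒≤ p))) (+<+ (m<n⇒0<n∸m p))

up⁻ : ∀ {x y} → Up (x , y) → x < y
up⁻ {x} {y} u with x <? y
... | yes p = p
... | no ¬p = contradiction (subst (0ℤ ℤ.<_) (ℤ.⊖-≤ (≮⇒≥ ¬p)) u) (nonpositive (x ∸ y))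
  where
  nonpositive : ∀ n → ¬ 0ℤ ℤ.< ℤ.- (ℤ.+ n)
  nonpositive zero    (+<+ ())
  nonpositive (suc n) ()

content-diagonal : ∀ x → content (x , x) ≡ 0ℤ
content-diagonal x = ℤ.n⊖n≡0 x

content≡0⁻ : ∀ {x y} → content (x , y) ≡ 0ℤ → x ≡ y
content≡0⁻ {x} {y} e with <-cmp x y
... | tri< p _ _ = contradiction (up⁺ p) (ℤ.<-irrefl (sym e))
... | tri≈ _ p _ = p
... | tri> _ _ p = contradiction
  (trans (cong ∣_∣ (sym (trans (sym (ℤ.⊖-< p)) e))) (ℤ.∣-i∣≡∣i∣ (ℤ.+ (x ∸ y))))
  (λ q → <-irrefl q (m<n⇒0<n∸m p))

subdiagonal : Bool → ℕ → ℕ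
subdiagonal false i = 2 * i
subdiagonal true  i = suc (2 * i)

isOdd : ℕ → Bool
isOdd zero    = false
isOdd (suc m) = not (isOdd m)

half : ℕ → ℕ
half = ⌊_/2⌋

isOdd-2+ : ∀ m → isOdd (2 + m) ≡ isOdd m
isOdd-2+ m with isOdd m
... | true  = refl
... | false = refl

subdiagonal-suc : ∀ ε i → subdiagonal ε (suc i) ≡ 2 + subdiagonal ε i
subdiagonal-suc false i = *-suc 2 i
subdiagonal-suc true  i = cong suc (*-suc 2 i)

subdiagonal-half : ∀ m → subdiagonal (isOdd m) (half m) ≡ m
subdiagonal-half 0 = refl
subdiagonal-half 1 = refl
subdiagonal-half (suc (suc m)) rewrite isOdd-2+ m =
  trans (subdiagonal-suc (isOdd m) (half m)) (cong (2 +_) (subdiagonal-half m))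

half-subdiagonal : ∀ ε i → half (subdiagonal ε i) ≡ i
half-subdiagonal false zero = refl
half-subdiagonal true  zero = refl
half-subdiagonal ε (suc i) rewrite subdiagonal-suc ε i = cong suc (half-subdiagonal ε i)

isOdd-subdiagonal : ∀ ε i → isOdd (subdiagonal ε i) ≡ ε
isOdd-subdiagonal false zero = refl
isOdd-subdiagonal true  zero = refl
isOdd-subdiagonal ε (suc i) rewrite subdiagonal-suc ε i =
  trans (isOdd-2+ (subdiagonal ε i)) (isOdd-subdiagonal ε i)

subdiagonal-mono⁻ : ∀ ε {i j} → subdiagonal ε i ≤ subdiagonal ε j → i ≤ j
subdiagonal-mono⁻ false p = *-cancelˡ-≤ 2 p
subdiagonal-mono⁻ true  p = *-cancelˡ-≤ 2 (s≤s⁻¹ p)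

-- D (2i) and D (2i + 1) are the numbers of cells of content -i in P false and
-- P true; the upper parts of these diagrams are determined by D 0 and D 1.

record Quotient (Λ : List ℕ) (P : Bool → List ℕ) : Set where
  field
    D       : ℕ → ℕ
    bound   : ℕ
    D-zero  : ∀ {m} → bound ≤ m → D m ≡ 0
    D-lower : ∀ m → D (2 + m) ≤ D m
    D-upper : ∀ m → D m ≤ suc (D (2 + m))
    part    : ∀ ε i y → (y + i , y) ∈ᵞ P ε ⇔ y < D (subdiagonal ε i)
    low     : ∀ i y → (y + i , y) ∈ᵞ Λ ⇔ y < D i + D (suc i)
    upEven  : ∀ k x → (x , x + 2 * k) ∈ᵞ Λ ⇔ x < (D 0 ∸ k) + (D 1 ∸ k)
    upOdd   : ∀ k x → (x , x + suc (2 * k)) ∈ᵞ Λ ⇔ x < (D 0 ∸ k) + (D 1 ∸ suc k)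

  module part ε i y = Equivalence (part ε i y)
  module low i y = Equivalence (low i y)

  D⇒bound : ∀ {m j} → j < D m → m < bound
  D⇒bound {m} p = ≰⇒> λ q → contradiction (subst (_ <_) (D-zero q) p) λ ()

record Enumerates (n : ℕ → ℕ) (d : ℕ) (g : ℕ → ℕ) : Set where
  field
    slow    : Slow n
    initial : n 0 ≡ 0
    bounded : ∀ τ → n τ ≤ d
    isAt    : ∀ {j} → j < d → At n (g j) j

  total : ∀ {R} → (∀ {j} → j < d → g j < R) → n R ≡ d
  total {R} h = ≤-antisym (bounded R) (≮⇒≥ λ p → <-irrefl refl (at-below slow (isAt p) (h p)))

enumerates : ∀ {n d} (slow : Slow n) (key : ℕ → ℕ) → n 0 ≡ 0 →
             (∀ {j} → suc j < d → key j < key (suc j)) →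
             (∀ {j} → j < d → n (suc (key j)) ≡ suc (n (key j))) →
             (∀ {τ} → n (suc τ) ≡ suc (n τ) → ∃[ j ] j < d × key j ≡ τ) →
             Enumerates n d key
enumerates {n} {d} slow key n0 incr hit hit⁻ = record
  { slow = slow ; initial = n0 ; bounded = bounded ; isAt = isAt }
  where
  isAt : ∀ {j} → j < d → At n (key j) j
  isAt = sequence-at slow key n0 (increasing key incr) hit hit⁻
  bounded : ∀ τ → n τ ≤ d
  bounded zero = subst (_≤ d) (sym n0) z≤n
  bounded (suc τ) with Slow.step slow τ
  ... | inj₁ e = subst (_≤ d) (sym e) (bounded τ)
  ... | inj₂ e with hit⁻ e
  ...   | j , j<d , refl = subst (_≤ d) (sym (proj₂ (isAt j<d))) j<d

module _ {n d g n′ d′ g′} (E : Enumerates n d g) (E′ : Enumerates n′ d′ g′) where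
  private
    module E  = Enumerates E
    module E′ = Enumerates E′

  -- If `n` has passed `j` before `τ`, then `g j < τ`, hence `g′ j < τ`, and `n′` has passed `j`
  -- too. Comparisons of keys along rows become inequalities of counters in this way; the variant
  -- with `suc` serves the columns.
  interlace-≤ : (∀ {j} → j < d → j < d′ × g′ j ≤ g j) → ∀ τ → n τ ≤ n′ τ
  interlace-≤ h τ with n τ in e
  ... | zero  = z≤n
  ... | suc j =
    let j<n = subst (j <_) (sym e) ≤-refl
        j<d = <-≤-trans j<n (E.bounded τ)
        j<d′ , q = h j<d
    in at-below E′.slow (E′.isAt j<d′) (≤-<-trans q (at-above E.slow (E.isAt j<d) j<n))

  interlace-≤suc : (∀ {j} → suc j < d → j < d′ × g′ j ≤ g (suc j)) → ∀ τ → n τ ≤ suc (n′ τ)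
  interlace-≤suc h τ with n τ in e
  ... | zero        = z≤n
  ... | suc zero    = s≤s z≤n
  ... | suc (suc j) =
    let j<n = subst (suc j <_) (sym e) ≤-refl
        j<d = <-≤-trans j<n (E.bounded τ)
        j<d′ , q = h j<d
    in s≤s (at-below E′.slow (E′.isAt j<d′) (≤-<-trans q (at-above E.slow (E.isAt j<d) j<n)))

tick : ∀ {P : Set} → Dec P → ℕ → ℕ
tick (yes _) n = suc n
tick (no  _) n = n

tick-yes : ∀ {P : Set} (d : Dec P) → P → ∀ n → tick d n ≡ suc n
tick-yes (yes _) _ _ = refl
tick-yes (no ¬p) p _ = contradiction p ¬p

tick-no : ∀ {P : Set} (d : Dec P) → ¬ P → ∀ n → tick d n ≡ n
tick-no (yes p) ¬p _ = contradiction p ¬p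
tick-no (no _)  _  _ = refl

tick-⇔ : ∀ {P Q : Set} (d : Dec P) (e : Dec Q) → P ⇔ Q → ∀ n → tick d n ≡ tick e n
tick-⇔ d e i n with d
... | yes p = sym (tick-yes e (Equivalence.to i p) n)
... | no ¬p = sym (tick-no e (¬p ∘ Equivalence.from i) n)

module Count (b : ℕ) {S : ℕ → Set} (S? : ∀ τ → Dec (S τ)) where
  open Keys b

  A : ℕ → ℕ → ℕ
  A m zero    = 0
  A m (suc τ) = tick (S? τ ×-dec (sub τ ≟ m)) (A m τ)

  A-hit : ∀ {m τ} → S τ → sub τ ≡ m → A m (suc τ) ≡ suc (A m τ)
  A-hit {m} {τ} s e = tick-yes (S? τ ×-dec (sub τ ≟ m)) (s , e) _

  A-miss : ∀ {m τ} → ¬ (S τ × sub τ ≡ m) → A m (suc τ) ≡ A m τ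
  A-miss {m} {τ} h = tick-no (S? τ ×-dec (sub τ ≟ m)) h _

  A-hit⁻ : ∀ {m τ} → A m (suc τ) ≡ suc (A m τ) → S τ × sub τ ≡ m
  A-hit⁻ {m} {τ} e with S? τ ×-dec (sub τ ≟ m)
  ... | yes p = p
  ... | no  _ = contradiction (sym e) 1+n≢n

  A-slow : ∀ m → Slow (A m)
  A-slow m .Slow.step τ with S? τ ×-dec (sub τ ≟ m)
  ... | yes _ = inj₂ refl
  ... | no  _ = inj₁ refl

  -- The number of cells of content -i with key less than τ.

  N : ℕ → ℕ → ℕ
  N i τ = A i τ + A (suc i) τ

  N-hit : ∀ {i τ} → S τ → sub τ ≡ i ⊎ sub τ ≡ suc i → N i (suc τ) ≡ suc (N i τ)
  N-hit {i} {τ} s (inj₁ e) = cong₂ _+_ (A-hit s e) (A-miss λ (_ , e′) → 1+n≢n (trans (sym e′) e))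
  N-hit {i} {τ} s (inj₂ e) = trans
    (cong₂ _+_ (A-miss λ (_ , e′) → 1+n≢n (trans (sym e) e′)) (A-hit s e)) (+-suc _ _)

  N-miss : ∀ {i τ} → ¬ (S τ × (sub τ ≡ i ⊎ sub τ ≡ suc i)) → N i (suc τ) ≡ N i τ
  N-miss h = cong₂ _+_ (A-miss λ (s , e) → h (s , inj₁ e)) (A-miss λ (s , e) → h (s , inj₂ e))

  N-cases : ∀ i τ → (S τ × (sub τ ≡ i ⊎ sub τ ≡ suc i)) ⊎ ¬ (S τ × (sub τ ≡ i ⊎ sub τ ≡ suc i))
  N-cases i τ with S? τ | sub τ ≟ i | sub τ ≟ suc i
  ... | no ¬s | _     | _     = inj₂ (¬s ∘ proj₁)
  ... | yes s | yes e | _     = inj₁ (s , inj₁ e)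
  ... | yes s | no _  | yes e = inj₁ (s , inj₂ e)
  ... | yes s | no ¬e | no ¬e′ = inj₂ λ { (_ , inj₁ e) → ¬e e ; (_ , inj₂ e) → ¬e′ e }

  N-slow : ∀ i → Slow (N i)
  N-slow i .Slow.step τ with N-cases i τ
  ... | inj₁ (s , e) = inj₂ (N-hit s e)
  ... | inj₂ h       = inj₁ (N-miss h)

  N-hit⁻ : ∀ {i τ} → N i (suc τ) ≡ suc (N i τ) → S τ × (sub τ ≡ i ⊎ sub τ ≡ suc i)
  N-hit⁻ {i} {τ} e with N-cases i τ
  ... | inj₁ p = p
  ... | inj₂ h = contradiction (trans (sym e) (N-miss h)) 1+n≢n

A-cong : ∀ b {S S′ : ℕ → Set} (S? : ∀ τ → Dec (S τ)) (S′? : ∀ τ → Dec (S′ τ)) →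
         (∀ τ → S τ ⇔ S′ τ) → ∀ m τ → Count.A b S? m τ ≡ Count.A b S′? m τ
A-cong b S? S′? h m zero    = refl
A-cong b S? S′? h m (suc τ) = trans
  (tick-⇔ (S? τ ×-dec (sub τ ≟ m)) (S′? τ ×-dec (sub τ ≟ m))
    (mk⇔ (λ (s , e) → Equivalence.to (h τ) s , e) (λ (s , e) → Equivalence.from (h τ) s , e)) _)
  (cong (tick (S′? τ ×-dec (sub τ ≟ m))) (A-cong b S? S′? h m τ))
  where open Keys b

module Codes {Λ P} (Q : Quotient Λ P) where
  open Quotient Q
  open Keys (suc bound) public

  D⇒<B : ∀ {m j} → j < D m → m < B
  D⇒<B p = <-trans (D⇒bound p) (s≤s (n≤1+n _))

  -- `total` and `bounded` together make `S` finite: a key from `R` on would push its counter beyond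
  -- `D m`. The subdiagonals 0 and 1 hold the lower dominoes cut by `D₀` and, on the other side, the
  -- main diagonals of the two Young tableaux; hence `onD₀`.
  record Code : Set₁ where
    field
      S  : ℕ → Set
      S? : ∀ τ → Dec (S τ)
    open Count (suc bound) S? public
    field
      lower    : ∀ m τ → A (2 + m) τ ≤ A m τ
      upper    : ∀ m τ → A m τ ≤ suc (A (2 + m) τ)
      R        : ℕ
      total    : ∀ m → A m R ≡ D m
      bounded  : ∀ m τ → A m τ ≤ D m
      onD₀     : ∀ {τ} → S τ → sub τ ≤ 1 → Unprimed (letter τ)

  codes : Setoid _ _
  codes = record
    { Carrier       = Code
    ; _≈_           = λ c c′ → ∀ τ → Code.S c τ ⇔ Code.S c′ τ
    ; isEquivalence = record
      { refl  = λ _ → mk⇔ id id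
      ; sym   = λ h τ → mk⇔ (Equivalence.from (h τ)) (Equivalence.to (h τ))
      ; trans = λ h h′ τ → mk⇔ (Equivalence.to (h′ τ) ∘ Equivalence.to (h τ))
                               (Equivalence.from (h τ) ∘ Equivalence.from (h′ τ))
      }
    }

-- Codes and pairs of Young tableaux

maximum : (ℕ → ℕ) → ℕ → ℕ
maximum f zero    = 0
maximum f (suc n) = f n ⊔ maximum f n

≤-maximum : ∀ f {n i} → i < n → f i ≤ maximum f n
≤-maximum f {suc n} p with m≤n⇒m<n∨m≡n (s≤s⁻¹ p)
... | inj₁ q    = ≤-trans (≤-maximum f q) (m≤n⊔m (f n) _)
... | inj₂ refl = m≤m⊔n (f n) _

module _ {Λ P} (Q : Quotient Λ P) where
  open Quotient Q
  open Codes Q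

  module FromPair (u : ∀ ε → WeightedFamily.Carrier (youngTableaux (P ε))) where

    fill : Bool → Cell → Letter
    fill ε = ShiftedYoungTableau.fill (proj₁ (u ε))

    module tableau ε = IsTableau (ShiftedYoungTableau.isTableau (proj₁ (u ε)))

    G : ℕ → ℕ → ℕ
    private
      a : ℕ → ℕ → Letter
      a m j = fill (isOdd m) (j + half m , j)

      a-2+ : ∀ m j → a (2 + m) j ≡ fill (isOdd m) (suc (j + half m) , j)
      a-2+ m j rewrite isOdd-2+ m | +-suc j (half m) = refl

    G m j = key (a m j) m

    lowCell : ∀ {m j} → j < D m → LowCell (P (isOdd m)) (j + half m , j)
    lowCell {m} {j} p = part.from (isOdd m) (half m) j (subst (λ n → j < D n) (sym (subdiagonal-half m)) p)
                      , λ u → <⇒≱ (up⁻ u) (m≤m+n j (half m))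

    lowCell-2+ : ∀ {m j} → j < D (2 + m) → LowCell (P (isOdd m)) (suc (j + half m) , j)
    lowCell-2+ {m} {j} p = subst₂ (λ ε x → LowCell (P ε) (x , j)) (isOdd-2+ m) (+-suc j (half m)) (lowCell p)

    -- The subdiagonal `2 + m` is the next diagonal of the same Young tableau, so neighbours in a
    -- row are compared. Equal letters in a row must be unprimed, and their keys grow with the
    -- subdiagonal. `G-up` is the dual for columns.
    G-right : ∀ {m j} → j < D (2 + m) → G m j ≤ G (2 + m) j
    G-right {m} {j} p rewrite a-2+ m j = key-≤-lex (D⇒<B p′) (tableau.rows (isOdd m) l l′ (n≤1+n _)) λ e →
        key-≤-unprimed (λ u → contradiction (cong proj₁ (tableau.primedOncePerRow (isOdd m) l l′ u e)) (1+n≢n ∘ sym))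
          (m≤n+m m 2)
      where
      p′ = <-≤-trans p (D-lower m)
      l  = lowCell p′
      l′ = lowCell-2+ p

    G-up : ∀ {m j} → suc j < D m → G (2 + m) j ≤ G m (suc j)
    G-up {m} {j} p rewrite a-2+ m j = key-≤-lex (D⇒<B p′) (tableau.columns (isOdd m) l l′ (n≤1+n _)) λ e →
        key-≤-primed (decidable-stable (primed? _) λ u →
          1+n≢n (sym (cong proj₂ (tableau.unprimedOncePerColumn (isOdd m) l l′ u e)))) (m≤n+m m 2)
      where
      p′ = s≤s⁻¹ (≤-trans p (D-upper m))
      l  = lowCell-2+ p′
      l′ = lowCell p

    sub-G : ∀ {m j} → j < D m → sub (G m j) ≡ m
    sub-G {m} {j} p = sub-key (a m j) (D⇒<B p)

    letter-G : ∀ {m j} → j < D m → letter (G m j) ≡ fill (isOdd m) (j + half m , j)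
    letter-G {m} {j} p = letter-key (a m j) (D⇒<B p)

    -- The cell to the right of the first and below the second has a key between the two. Equality
    -- would force all three keys to agree, but `sub` recovers the subdiagonal from a key, and that
    -- cell is on `2 + m`.
    G-suc : ∀ {m j} → suc j < D m → G m j < G m (suc j)
    G-suc {m} {j} p = ≤∧≢⇒< (≤-trans (G-right p′) (G-up p)) λ e →
        1+n≰n (≤-trans (n≤1+n _) (≤-reflexive (trans (sym (sub-G p′)) (trans (cong sub (G≡ e)) (sub-G (<⇒≤ p))))))
      where
      p′ = s≤s⁻¹ (≤-trans p (D-upper m))
      G≡ : G m j ≡ G m (suc j) → G (2 + m) j ≡ G m j
      G≡ e = ≤-antisym (≤-trans (G-up p) (≤-reflexive (sym e))) (G-right p′)

    S : ℕ → Set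
    S τ = ∃[ j ] j < D (sub τ) × G (sub τ) j ≡ τ

    S? : ∀ τ → Dec (S τ)
    S? τ = anyUpTo? (λ j → G (sub τ) j ≟ τ) (D (sub τ))

    open Count (suc bound) S?

    S-G : ∀ {m j} → j < D m → S (G m j)
    S-G {m} {j} p = j , subst (λ n → j < D n) (sym (sub-G p)) p , cong (λ n → G n j) (sub-G p)

    enumeration : ∀ m → Enumerates (A m) (D m) (G m)
    enumeration m = enumerates (A-slow m) (G m) refl G-suc (λ p → A-hit (S-G p) (sub-G p)) λ e → case A-hit⁻ e of λ where
      (s , refl) → s

    private
      time-bound : ℕ
      time-bound = suc (maximum (λ m → maximum (G m) (D m)) bound)

      G< : ∀ {m j} → j < D m → G m j < time-bound
      G< {m} p = s≤s (≤-trans (≤-maximum (G m) p) (≤-maximum (λ m → maximum (G m) (D m)) (D⇒bound p)))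

    code : Code
    code = record
      { S = S ; S? = S?
      ; lower = λ m → interlace-≤ (enumeration (2 + m)) (enumeration m) λ p →
          <-≤-trans p (D-lower m) , G-right p
      ; upper = λ m → interlace-≤suc (enumeration m) (enumeration (2 + m)) λ p →
          s≤s⁻¹ (≤-trans p (D-upper m)) , G-up p
      ; R = time-bound
      ; total = λ m → Enumerates.total (enumeration m) G<
      ; bounded = λ m → Enumerates.bounded (enumeration m)
      ; onD₀ = λ { {τ} (j , p , e) q → subst (λ σ → Unprimed (letter σ)) e (subst Unprimed (sym (letter-G p))
          (proj₂ (u (isOdd (sub τ))) _ (proj₁ (lowCell p)) (diagonal j (sub τ) q))) }
      }
      where
      diagonal : ∀ j m → m ≤ 1 → content (j + half m , j) ≡ 0ℤ
      diagonal j zero          _ rewrite +-identityʳ j = content-diagonal j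
      diagonal j (suc zero)    _ rewrite +-identityʳ j = content-diagonal j
      diagonal j (suc (suc m)) (s≤s ())

  module ToPair (c : Code) where
    open Code c

    time : ℕ → ℕ → ℕ
    time m j = search (A m) R j

    time-at : ∀ {m j} → j < D m → At (A m) (time m j) j
    time-at {m} p = proj₁ (search-at (A-slow m) R z≤n (subst (_ <_) (sym (total m)) p))

    S-time : ∀ {m j} → j < D m → S (time m j) × sub (time m j) ≡ m
    S-time {m} p with time-at p
    ... | e , e′ = A-hit⁻ (trans e′ (cong suc (sym e)))

    fill : Bool → Cell → Letter
    fill ε (x , y) = letter (time (subdiagonal ε (x ∸ y)) y)

    private
      low⇒ : ∀ {ε x y} → LowCell (P ε) (x , y) → y ≤ x × y < D (subdiagonal ε (x ∸ y))
      low⇒ {ε} {x} {y} (p , ¬up) = y≤x ,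
        part.to ε (x ∸ y) y (subst (λ z → (z , y) ∈ᵞ P ε) (sym (m+[n∸m]≡n y≤x)) p)
        where
        y≤x : y ≤ x
        y≤x = ≮⇒≥ λ q → ¬up (up⁺ q)

      lower* : ∀ ε i k τ → A (subdiagonal ε (k + i)) τ ≤ A (subdiagonal ε i) τ
      lower* ε i zero    τ = ≤-refl
      lower* ε i (suc k) τ rewrite subdiagonal-suc ε (k + i) = ≤-trans (lower _ τ) (lower* ε i k τ)

      upper* : ∀ ε i k τ → A (subdiagonal ε i) τ ≤ k + A (subdiagonal ε (k + i)) τ
      upper* ε i zero    τ = ≤-refl
      upper* ε i (suc k) τ rewrite subdiagonal-suc ε (k + i) =
        ≤-trans (upper* ε i k τ) (≤-trans (+-monoʳ-≤ k (upper _ τ)) (≤-reflexive (+-suc k _)))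

      T : Bool → ℕ → ℕ → ℕ
      T ε x y = time (subdiagonal ε (x ∸ y)) y

      -- When the counter of the farther diagonal passes `y`, that of the nearer diagonal is at
      -- least as large and has passed `y` already.
      T-row : ∀ {ε x x′ y} → LowCell (P ε) (x , y) → LowCell (P ε) (x′ , y) → x ≤ x′ → T ε x y ≤ T ε x′ y
      T-row {ε} {x} {x′} {y} l l′ p with low⇒ l | low⇒ l′
      ... | y≤x , q | _ , q′ = s≤s⁻¹ (at-above (A-slow _) (time-at q)
        (<-≤-trans (at-below (A-slow _) (time-at q′) ≤-refl)
          (subst (λ i → A (subdiagonal ε i) (suc (T ε x′ y)) ≤ A (subdiagonal ε (x ∸ y)) (suc (T ε x′ y)))
            difference (lower* ε (x ∸ y) (x′ ∸ x) (suc (T ε x′ y))))))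
        where
        difference : x′ ∸ x + (x ∸ y) ≡ x′ ∸ y
        difference = trans (sym (+-∸-assoc (x′ ∸ x) y≤x)) (cong (_∸ y) (m∸n+n≡m p))

      T-column : ∀ {ε x y y′} → LowCell (P ε) (x , y) → LowCell (P ε) (x , y′) → y ≤ y′ → T ε x y ≤ T ε x y′
      T-column {ε} {x} {y} {y′} l l′ p with low⇒ l | low⇒ l′
      ... | _ , q | y′≤x , q′ = s≤s⁻¹ (at-above (A-slow _) (time-at q)
        (+-cancelˡ-≤ (y′ ∸ y) _ _ (≤-trans (≤-reflexive (trans (+-suc (y′ ∸ y) y) (cong suc (m∸n+n≡m p))))
          (≤-trans (at-below (A-slow _) (time-at q′) ≤-refl)
          (subst (λ i → A (subdiagonal ε (x ∸ y′)) (suc (T ε x y′)) ≤ y′ ∸ y + A (subdiagonal ε i) (suc (T ε x y′)))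
            difference (upper* ε (x ∸ y′) (y′ ∸ y) (suc (T ε x y′))))))))
        where
        difference : y′ ∸ y + (x ∸ y′) ≡ x ∸ y
        difference = trans (+-comm (y′ ∸ y) _) (trans (sym (+-∸-assoc (x ∸ y′) p)) (cong (_∸ y) (m∸n+n≡m y′≤x)))

      sub-T : ∀ {ε x y} → LowCell (P ε) (x , y) → sub (T ε x y) ≡ subdiagonal ε (x ∸ y)
      sub-T l = proj₂ (S-time (proj₂ (low⇒ l)))

      -- Times do not decrease up the column, so with one unprimed letter the subdiagonals do not
      -- decrease either; but geometrically they fall with the height.
      column≤ : ∀ {ε x y y′} → LowCell (P ε) (x , y) → LowCell (P ε) (x , y′) → y ≤ y′ →
                Unprimed (letter (T ε x y)) → letter (T ε x y) ≡ letter (T ε x y′) → y′ ≤ y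
      column≤ {ε} {x} {y} {y′} l l′ p u e = ∸-cancelʳ-≤ (proj₁ (low⇒ l′)) (subdiagonal-mono⁻ ε
       (subst₂ _≤_ (sub-T l) (sub-T l′) (sub-mono (T-column l l′ p) e u)))

      row≤ : ∀ {ε x x′ y} → LowCell (P ε) (x , y) → LowCell (P ε) (x′ , y) → x ≤ x′ →
             Primed (letter (T ε x y)) → letter (T ε x y) ≡ letter (T ε x′ y) → x′ ≤ x
      row≤ {ε} {x} {x′} {y} l l′ p u e = ≤-trans (m≤n+m∸n x′ y)
        (≤-trans (+-monoʳ-≤ y (subdiagonal-mono⁻ ε
          (subst₂ _≤_ (sub-T l′) (sub-T l) (sub-antimono (T-row l l′ p) e u))))
        (≤-reflexive (m+[n∸m]≡n (proj₁ (low⇒ l)))))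

    tableau : ∀ ε → ShiftedYoungTableau (P ε)
    tableau ε = record { fill = fill ε ; isTableau = record
      { rows    = λ l l′ p → letter-mono (T-row l l′ p)
      ; columns = λ l l′ p → letter-mono (T-column l l′ p)
      ; unprimedOncePerColumn = λ {x} {y} {y′} l l′ u e → cong (x ,_) (case ≤-total y y′ of λ where
          (inj₁ p) → ≤-antisym p (column≤ l l′ p u e)
          (inj₂ p) → ≤-antisym (column≤ l′ l p (subst Unprimed e u) (sym e)) p)
      ; primedOncePerRow = λ {x} {x′} {y} l l′ u e → cong (_, y) (case ≤-total x x′ of λ where
          (inj₁ p) → ≤-antisym p (row≤ l l′ p u e)
          (inj₂ p) → ≤-antisym (row≤ l′ l p (subst Primed e u) (sym e)) p)
      } }

    noPrimed : ∀ ε → NoPrimedOnDiagonal (P ε) (fill ε)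
    noPrimed ε (x , y) p e with content≡0⁻ {x} {y} e
    ... | refl = onD₀ (proj₁ (S-time l)) (subst (_≤ 1) (sym (proj₂ (S-time l))) le)
      where
      l : x < D (subdiagonal ε (x ∸ x))
      l = proj₂ (low⇒ {ε} (p , λ u → <-irrefl refl (up⁻ {x} {x} u)))
      first : ∀ ε → subdiagonal ε 0 ≤ 1
      first true  = ≤-refl
      first false = z≤n
      le : subdiagonal ε (x ∸ x) ≤ 1
      le = subst (λ i → subdiagonal ε i ≤ 1) (sym (n∸n≡0 x)) (first ε)

    pair : ∀ ε → WeightedFamily.Carrier (youngTableaux (P ε))
    pair ε = tableau ε , noPrimed ε

  open WeightedFamily using (Carrier)

  choose : Carrier (youngTableaux (P false)) → Carrier (youngTableaux (P true)) → ∀ ε → Carrier (youngTableaux (P ε))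
  choose t u false = t
  choose t u true  = u

  _≈ᵖ_ : (u v : ∀ ε → Carrier (youngTableaux (P ε))) → Set
  u ≈ᵖ v = ∀ ε → WeightedFamily._≈_ (youngTableaux (P ε)) (u ε) (v ε)

  code-cong : ∀ {u v} → u ≈ᵖ v → ∀ τ → Code.S (FromPair.code u) τ → Code.S (FromPair.code v) τ
  code-cong {u} {v} h τ (j , p , e) = j , p ,
    trans (cong (λ a → key a (sub τ)) (sym (h _ _ (FromPair.lowCell u p)))) e

  pair-cong : ∀ {c c′} → (∀ τ → Code.S c τ ⇔ Code.S c′ τ) → ToPair.pair c ≈ᵖ ToPair.pair c′
  pair-cong {c} {c′} h ε (x , y) l = cong letter (at-unique (Code.A-slow c m)
      (ToPair.time-at c p)
      (subst₂ (λ n n′ → n ≡ y × n′ ≡ suc y) (sym (same τ)) (sym (same (suc τ))) (ToPair.time-at c′ p)))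
    where
    m = subdiagonal ε (x ∸ y)
    τ = ToPair.time c′ m y
    same : ∀ τ → Code.A c m τ ≡ Code.A c′ m τ
    same = A-cong (suc bound) (Code.S? c) (Code.S? c′) h m
    p : y < D m
    p = part.to ε (x ∸ y) y (subst (λ z → (z , y) ∈ᵞ P ε) (sym (m+[n∸m]≡n (≮⇒≥ λ q → proj₂ l (up⁺ q)))) (proj₁ l))

  pair-code : ∀ u → ToPair.pair (FromPair.code u) ≈ᵖ u
  pair-code u ε (x , y) (c∈ , ¬up) = trans
    (cong letter (at-unique (Count.A-slow (suc bound) (FromPair.S? u) m) (ToPair.time-at (FromPair.code u) p)
      (Enumerates.isAt (FromPair.enumeration u m) p)))
    (trans (FromPair.letter-G u p) (cong₂ (λ ε x → FromPair.fill u ε (x , y)) (isOdd-subdiagonal ε (x ∸ y))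
      (trans (cong (y +_) (half-subdiagonal ε (x ∸ y))) (m+[n∸m]≡n y≤x))))
    where
    y≤x = ≮⇒≥ λ q → ¬up (up⁺ q)
    m = subdiagonal ε (x ∸ y)
    p : y < D m
    p = part.to ε (x ∸ y) y (subst (λ z → (z , y) ∈ᵞ P ε) (sym (m+[n∸m]≡n y≤x)) c∈)

  code-pair : ∀ c τ → Code.S (FromPair.code (ToPair.pair c)) τ ⇔ Code.S c τ
  code-pair c τ = mk⇔
    (λ { (j , p , e) → subst (Code.S c) (trans (sym (G≡time p)) e) (proj₁ (ToPair.S-time c p)) })
    λ s → let e = Code.A-hit c {sub τ} {τ} s refl
              p = subst (_≤ D (sub τ)) e (Code.bounded c (sub τ) (suc τ))
          in _ , p , trans (G≡time p) (at-unique (Code.A-slow c (sub τ)) (ToPair.time-at c p) (refl , e))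
    where
    G≡time : ∀ {m j} → j < D m → FromPair.G (ToPair.pair c) m j ≡ ToPair.time c m j
    G≡time {m} {j} p = trans (cong₂ key (cong (λ m → letter (ToPair.time c m j)) sd) (sym (proj₂ (ToPair.S-time c p))))
                             (key-letter-sub (ToPair.time c m j))
      where
      sd : subdiagonal (isOdd m) (j + half m ∸ j) ≡ m
      sd = trans (cong (subdiagonal (isOdd m)) (m+n∸m≡n j (half m))) (subdiagonal-half m)

  pairs : Setoid _ _
  pairs = ×-setoid (WeightedFamily.objects (youngTableaux (P false))) (WeightedFamily.objects (youngTableaux (P true)))

  codes↔pairs : Inverse codes pairs
  codes↔pairs = record
    { to        = λ c → ToPair.pair c false , ToPair.pair c true
    ; from      = λ (t , u) → FromPair.code (choose t u)
    ; to-cong   = λ {c} {c′} h → pair-cong {c} {c′} h false , pair-cong {c} {c′} h true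
    ; from-cong = λ {(t , u)} {(t′ , u′)} h τ →
        mk⇔ (code-cong {choose t u} {choose t′ u′} (chosen {t} {u} {choose t′ u′} h) τ)
            (code-cong {choose t′ u′} {choose t u} (chosen {t′} {u′} {choose t u} (Setoid.sym pairs {t , u} {t′ , u′} h)) τ)
    ; inverse   =
        (λ { {t , u} {c} h →
          (λ x l → trans (pair-cong {c} {FromPair.code (choose t u)} h false x l) (pair-code (choose t u) false x l)) ,
          (λ x l → trans (pair-cong {c} {FromPair.code (choose t u)} h true x l) (pair-code (choose t u) true x l)) })
      , (λ { {c} {t , u} h τ → mk⇔
          (Equivalence.to (code-pair c τ) ∘ code-cong {choose t u} {ToPair.pair c} (chosen {t} {u} {ToPair.pair c} h) τ)
          (code-cong {ToPair.pair c} {choose t u} (λ ε x l → sym (chosen {t} {u} {ToPair.pair c} h ε x l)) τ ∘ Equivalence.from (code-pair c τ)) })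
    }
    where
    chosen : ∀ {t u} {v : ∀ ε → Carrier (youngTableaux (P ε))} →
             Setoid._≈_ pairs (t , u) (v false , v true) → choose t u ≈ᵖ v
    chosen h false = proj₁ h
    chosen h true  = proj₂ h

-- Lower dominoes

private
  even⊎even : ∀ k → Even k ⊎ Even (suc k)
  even⊎even zero    = inj₁ (2 ℕ.∣0)
  even⊎even (suc k) with even⊎even k
  ... | inj₁ p = inj₂ (ℕ.∣m∣n⇒∣m+n ℕ.∣-refl p)
  ... | inj₂ p = inj₁ p

content-above : ∀ {x y} → x ≤ y → ∣ content (x , y) ∣ ≡ y ∸ x
content-above p = cong ∣_∣ (ℤ.⊖-≥ p)

private
  one-odd : ∀ x → ¬ Even ∣ content (x , suc x) ∣
  one-odd x p with subst Even (trans (content-above (n≤1+n x)) (m+n∸n≡m 1 x)) p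
  ... | q = contradiction (ℕ.∣⇒≤ q) λ { (s≤s ()) }

-- A domino is upper exactly when both its cells have positive content: with contents 0 and 1 it is
-- on `D₀`, and a cell of content 1 alone does not have even index. This lemma and the next three
-- express that by the corner, for each orientation.
up′-horizontal⁻ : ∀ {x y} → Up′ (horizontal (x , y)) → suc x < y
up′-horizontal⁻ {x} {y} (here (even , u)) = ≤∧≢⇒< (up⁻ u) λ { refl → one-odd x even }
up′-horizontal⁻ {x} {y} (there (here (_ , u))) = up⁻ u

up′-vertical⁻ : ∀ {x y} → Up′ (vertical (x , y)) → x < y
up′-vertical⁻ (here (_ , u)) = up⁻ u
up′-vertical⁻ {x} (there (here (even , u))) = ≤∧≢⇒< (s≤s⁻¹ (up⁻ u)) λ { refl → one-odd x even }

up′-horizontal⁺ : ∀ {x y} → suc x < y → Up′ (horizontal (x , y))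
up′-horizontal⁺ {x} {y} p with even⊎even (y ∸ suc x)
... | inj₁ e = there (here (subst Even (sym (content-above (<⇒≤ p))) e , up⁺ p))
... | inj₂ e = here (subst Even (sym (trans (content-above (<⇒≤ (<⇒≤ p))) (+-∸-assoc 1 (<⇒≤ p)))) e , up⁺ (<⇒≤ p))

up′-vertical⁺ : ∀ {x y} → x < y → Up′ (vertical (x , y))
up′-vertical⁺ {x} {y} p with even⊎even (y ∸ x)
... | inj₁ e = here (subst Even (sym (content-above (<⇒≤ p))) e , up⁺ p)
... | inj₂ e = there (here (subst Even (sym (trans (content-above (m≤n⇒m≤1+n (<⇒≤ p))) (+-∸-assoc 1 (<⇒≤ p)))) e
                           , up⁺ (m<n⇒m<1+n p)))

up′-above : ∀ {d x y} → Up′ d → (x , y) ∈ᵈ d → x < y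
up′-above {horizontal _} u (here refl)         = <-trans ≤-refl (up′-horizontal⁻ u)
up′-above {horizontal _} u (there (here refl)) = up′-horizontal⁻ u
up′-above {vertical _}   u (here refl)         = up′-vertical⁻ u
up′-above {vertical _}   u (there (here refl)) = m<n⇒m<1+n (up′-vertical⁻ u)

data Covers : ℕ → ℕ → Domino → Set where
  left   : ∀ {x y} → Covers x       y       (horizontal (x , y))
  right  : ∀ {x y} → Covers (suc x) y       (horizontal (x , y))
  bottom : ∀ {x y} → Covers x       y       (vertical (x , y))
  top    : ∀ {x y} → Covers x       (suc y) (vertical (x , y))

view : ∀ {x y d} → (x , y) ∈ᵈ d → Covers x y d
view {d = horizontal _} (here refl)         = left
view {d = horizontal _} (there (here refl)) = right
view {d = vertical _}   (here refl)         = bottom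
view {d = vertical _}   (there (here refl)) = top

-- The subdiagonal of a lower domino (the subtraction truncates for some upper ones).

level : Domino → ℕ
level (horizontal (x , y)) = suc x ∸ y
level (vertical   (x , y)) = x ∸ y

cellOn : ∀ d → ¬ Up′ d → ∀ i → level d ≡ i ⊎ level d ≡ suc i → ∃[ j ] (j + i , j) ∈ᵈ d
cellOn (horizontal (x , y)) l i (inj₁ refl) = y , there (here (cong (_, y) (m+[n∸m]≡n (≮⇒≥ (l ∘ up′-horizontal⁺)))))
cellOn (horizontal (x , y)) l i (inj₂ e) = y , here (cong (_, y) (suc-injective
  (trans (sym (+-suc y i)) (trans (cong (y +_) (sym e)) (m+[n∸m]≡n (≮⇒≥ (l ∘ up′-horizontal⁺)))))))
cellOn (vertical (x , y)) l i (inj₁ refl) = y , here (cong (_, y) (m+[n∸m]≡n (≮⇒≥ (l ∘ up′-vertical⁺))))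
cellOn (vertical (x , y)) l i (inj₂ e) = suc y , there (here (cong (_, suc y)
  (trans (sym (+-suc y i)) (trans (cong (y +_) (sym e)) (m+[n∸m]≡n (≮⇒≥ (l ∘ up′-vertical⁺)))))))

cutBy0 : ∀ d → ¬ Up′ d → level d ≤ 1 → CutBy 0ℤ d
cutBy0 d l p with cellOn d l 0 (zero-or-one p)
  where
  zero-or-one : ∀ {m} → m ≤ 1 → m ≡ 0 ⊎ m ≡ 1
  zero-or-one {zero}  _ = inj₁ refl
  zero-or-one {suc zero} _ = inj₂ refl
  zero-or-one {suc (suc _)} (s≤s ())
... | j , p = Any.map (λ { refl → trans (cong (λ x → content (x , j)) (+-identityʳ j)) (content-diagonal j) }) p

level-bounds : ∀ {x y d} → y ≤ x → Covers x y d → x ∸ y ≤ level d × level d ≤ suc (x ∸ y)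
level-bounds p left   = ≤-trans (n≤1+n _) (≤-reflexive (sym (+-∸-assoc 1 p))) , ≤-reflexive (+-∸-assoc 1 p)
level-bounds p right  = ≤-refl , n≤1+n _
level-bounds p bottom = ≤-refl , n≤1+n _
level-bounds p (top {x} {y}) = ∸-monoʳ-≤ x (n≤1+n y) , ≤-reflexive (+-∸-assoc 1 p)

-- The other cell of the domino is one diagonal farther from `D₀`, to the right or below; for
-- `Inward` it is one diagonal nearer, to the left or above. The level decides between the two types
-- and leaves the orientation open.
data Outward : ℕ → ℕ → Domino → Set where
  left : ∀ {x y} → Outward x y       (horizontal (x , y))
  top  : ∀ {x y} → Outward x (suc y) (vertical (x , y))

data Inward : ℕ → ℕ → Domino → Set where
  right  : ∀ {x y} → Inward (suc x) y (horizontal (x , y))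
  bottom : ∀ {x y} → Inward x       y (vertical (x , y))

outward : ∀ {x y d} → level d ≡ suc (x ∸ y) → Covers x y d → Outward x y d
outward e left   = left
outward e top    = top
outward e right  = contradiction (sym e) 1+n≢n
outward e bottom = contradiction (sym e) 1+n≢n

inward : ∀ {x y d} → y ≤ x → level d ≡ x ∸ y → Covers x y d → Inward x y d
inward p e right  = right
inward p e bottom = bottom
inward p e left   = contradiction (trans (sym (+-∸-assoc 1 p)) e) 1+n≢n
inward p e top    = contradiction (trans (sym (+-∸-assoc 1 p)) e) 1+n≢n

-- Codes of shifted domino tableaux

module _ {Λ P} (Q : Quotient Λ P) where
  open Quotient Q
  open Codes Q

  diagonal<bound : ∀ {i j} → j < D i + D (suc i) → i < bound
  diagonal<bound {i} {j} p = ≰⇒> λ q → contradiction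
    (subst (j <_) (cong₂ _+_ (D-zero q) (D-zero (m≤n⇒m≤1+n q))) p) λ ()

  -- One cell down is the next diagonal, which by `D-upper` has at most one cell fewer.
  Λ-down : ∀ {x y} → suc y ≤ x → (x , suc y) ∈ᵞ Λ → (x , y) ∈ᵞ Λ
  Λ-down {x} {y} p c∈ = subst (λ x → (x , y) ∈ᵞ Λ) (trans (+-suc y i) (m+[n∸m]≡n p))
    (low.from (suc i) y (s≤s⁻¹ (≤-trans below (≤-trans (+-monoˡ-≤ _ (D-upper i)) (≤-reflexive (cong suc (+-comm (D (2 + i)) _)))))))
    where
    i = x ∸ suc y
    below : suc y < D i + D (suc i)
    below = low.to i (suc y) (subst (λ x → (x , suc y) ∈ᵞ Λ) (sym (m+[n∸m]≡n p)) c∈)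

  module Coded (T : ShiftedDominoTableau Λ) where
    open ShiftedDominoTableau T
    open IsTableau isTableau

    dominoKey : Domino → ℕ
    dominoKey d = key (label d) (level d)

    cellKey : ℕ → ℕ → ℕ
    cellKey x y = dominoKey (tile (x , y))

    lowCell : ∀ {x y} → (x , y) ∈ᵞ Λ → y ≤ x → (x , y) ∈ᵞ Λ × ¬ Up′ (tile (x , y))
    lowCell c∈ p = c∈ , λ u → <⇒≱ (up′-above u (covers c∈)) p

    module _ {c} (l : c ∈ᵞ Λ × ¬ Up′ (tile c)) where

      reach : ∀ i → level (tile c) ≡ i ⊎ level (tile c) ≡ suc i → ∃[ j ] (j + i , j) ∈ᵞ Λ × tile (j + i , j) ≡ tile c
      reach i e with cellOn (tile c) (proj₂ l) i e
      ... | j , c′∈ = j , inside (proj₁ l) c′∈ , consistent (proj₁ l) c′∈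

      level<B : level (tile c) < B
      level<B with reach _ (inj₁ refl)
      ... | j , c′∈ , _ = <-trans (diagonal<bound (low.to _ j c′∈)) (s≤s (n≤1+n _))

      sub-tile : sub (dominoKey (tile c)) ≡ level (tile c)
      sub-tile = sub-key (label (tile c)) level<B

      letter-tile : letter (dominoKey (tile c)) ≡ label (tile c)
      letter-tile = letter-key (label (tile c)) level<B

    key-right : ∀ {x y} → y ≤ x → (suc x , y) ∈ᵞ Λ → cellKey x y ≤ cellKey (suc x) y
    key-right {x} {y} p c∈ = key-≤-lex (level<B l) (rows l l′ (n≤1+n x)) λ e →
      case primed? (label (tile (x , y))) of λ where
        (yes u) → ≤-reflexive (cong (λ d → key (label (tile (x , y))) (level d)) (primedOncePerRow l l′ u e))
        (no ¬u) → key-≤-unprimed ¬u (≤-trans (proj₂ (level-bounds p (view (covers (proj₁ l)))))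
          (≤-trans (≤-reflexive (sym (+-∸-assoc 1 p))) (proj₁ (level-bounds p′ (view (covers c∈))))))
      where
      p′ = m≤n⇒m≤1+n p
      l  = lowCell (<⇒≤ c∈) p
      l′ = lowCell c∈ p′

    key-up : ∀ {x y} → suc y ≤ x → (x , suc y) ∈ᵞ Λ → cellKey x y ≤ cellKey x (suc y)
    key-up {x} {y} p c∈ = key-≤-lex (level<B l) (columns l l′ (n≤1+n y)) λ e →
      case primed? (label (tile (x , y))) of λ where
        (no ¬u) → ≤-reflexive (cong (λ d → key (label (tile (x , y))) (level d)) (unprimedOncePerColumn l l′ ¬u e))
        (yes u) → key-≤-primed u (≤-trans (proj₂ (level-bounds p (view (covers c∈))))
          (≤-trans (≤-reflexive (sym (+-∸-assoc 1 p))) (proj₁ (level-bounds (<⇒≤ p) (view (covers (proj₁ l)))))))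
      where
      l  = lowCell (Λ-down p c∈) (<⇒≤ p)
      l′ = lowCell c∈ p

    label-between : ∀ {x y x′ y′ x″ y″} → label (tile (x , y)) ≤ᴸ label (tile (x′ , y′)) →
                    label (tile (x′ , y′)) ≤ᴸ label (tile (x″ , y″)) →
                    label (tile (x , y)) ≡ label (tile (x″ , y″)) →
                    label (tile (x′ , y′)) ≡ label (tile (x″ , y″))
    label-between {x} {y} {x′} {y′} {x″} {y″} p q e =
      rank-injective {label (tile (x′ , y′))} {label (tile (x″ , y″))} (≤-antisym q (subst (_≤ _) (cong rank e) p))

    -- Equality would give `(x , y)`, `(suc x , y)` and `(suc x , suc y)` one letter and one level.
    -- By the once-per-row or once-per-column condition two of these cells form a domino, which
    -- fixes the level and makes the domino of the third cell point outward. Either this overlaps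
    -- the first domino, or it squeezes a further cell to the same letter, against the same
    -- condition.
    key-diagonal : ∀ {x y} → y ≤ x → (suc x , suc y) ∈ᵞ Λ → cellKey x y < cellKey (suc x) (suc y)
    key-diagonal {x} {y} p c∈ = ≤∧≢⇒< (≤-trans (key-right p c′∈) (key-up (s≤s p) c∈)) λ e →
        let e′ = ≤-antisym (key-right p c′∈) (≤-trans (key-up (s≤s p) c∈) (≤-reflexive (sym e)))
            e″ = trans (sym e′) e
            label≡  = trans (sym (letter-tile l)) (trans (cong letter e) (letter-tile l″))
            label≡′ = trans (sym (letter-tile l)) (trans (cong letter e′) (letter-tile l′))
            level≡  = trans (sym (sub-tile l)) (trans (cong sub e) (sub-tile l″))
            level≡′ = trans (sym (sub-tile l)) (trans (cong sub e′) (sub-tile l′))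
        in case primed? (label (tile (x , y))) of λ where
             (yes u) → primed-case u label≡ (primedOncePerRow l l′ u label≡′) level≡
             (no ¬u) → unprimed-case ¬u label≡
               (unprimedOncePerColumn l′ l″ (subst Unprimed label≡′ ¬u) (trans (sym label≡′) label≡)) level≡
      where
      c′∈ = Λ-down (s≤s p) c∈
      l  = lowCell (<⇒≤ c′∈) p
      l′ = lowCell c′∈ (m≤n⇒m≤1+n p)
      l″ = lowCell c∈ (s≤s p)

      is-vertical : ∀ {x y d} → Covers x y d → Covers x (suc y) d → d ≡ vertical (x , y)
      is-vertical bottom top = refl

      is-horizontal : ∀ {x y d} → Covers x y d → Covers (suc x) y d → d ≡ horizontal (x , y)
      is-horizontal left right = refl

      unprimed-case : Unprimed (label (tile (x , y))) → label (tile (x , y)) ≡ label (tile (suc x , suc y)) →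
                      tile (suc x , y) ≡ tile (suc x , suc y) →
                      level (tile (x , y)) ≡ level (tile (suc x , suc y)) → ⊥
      unprimed-case u label≡ tile≡ level≡
        with tile (suc x , suc y) in t″ | is-vertical (view (subst ((suc x , y) ∈ᵈ_) tile≡ (covers c′∈))) (view (covers c∈))
      ... | _ | refl with tile (x , y) in t | outward (trans level≡ (+-∸-assoc 1 p)) (view (covers (proj₁ l)))
      ...   | _ | left = case trans (trans (sym t″) (sym tile≡)) (trans (consistent (proj₁ l) (subst ((suc x , y) ∈ᵈ_) (sym t) (there (here refl)))) t) of λ ()
      ...   | _ | top {y = y′} = absurd
        where
        x≥ : y′ ≤ x
        x≥ = <⇒≤ p
        below : (x , y′) ∈ᵞ Λ
        below = inside (proj₁ l) (subst ((x , y′) ∈ᵈ_) (sym t) (here refl))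
        tile≡below : tile (x , y′) ≡ vertical (x , y′)
        tile≡below = trans (consistent (proj₁ l) (subst ((x , y′) ∈ᵈ_) (sym t) (here refl))) t
        -- The letters at `(x , y′)` and `(suc x , suc y)` agree, so the letter at this cell, which
        -- lies between them, is the same. That is a third cell for a vertical domino of two cells.
        beside : (suc x , y′) ∈ᵞ Λ
        beside = Λ-down (m≤n⇒m≤1+n p) c′∈
        lb = lowCell beside (m≤n⇒m≤1+n x≥)
        absurd : ⊥
        absurd with label-between (rows (lowCell below x≥) lb (n≤1+n x)) (columns lb l″ (≤-trans (n≤1+n _) (n≤1+n _)))
                      (trans (cong label tile≡below) (trans label≡ (cong label (sym t″))))
        ... | e with view {d = vertical (suc x , suc y′)} (subst ((suc x , y′) ∈ᵈ_)
                      (trans (unprimedOncePerColumn lb l″ (subst Unprimed (trans label≡ (trans (cong label (sym t″)) (sym e))) u) e) t″)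
                      (covers beside))
        ... | ()

      primed-case : Primed (label (tile (x , y))) → label (tile (x , y)) ≡ label (tile (suc x , suc y)) →
                    tile (x , y) ≡ tile (suc x , y) →
                    level (tile (x , y)) ≡ level (tile (suc x , suc y)) → ⊥
      primed-case u label≡ tile≡ level≡
        with tile (x , y) in t | is-horizontal (view (covers (proj₁ l))) (view (subst ((suc x , y) ∈ᵈ_) (sym tile≡) (covers c′∈)))
      ... | _ | refl with tile (suc x , suc y) in t″ | outward (trans (sym level≡) (+-∸-assoc 1 p)) (view (covers c∈))
      ...   | _ | top = case trans (trans (sym t) tile≡) (trans (consistent c∈ (subst ((suc x , y) ∈ᵈ_) (sym t″) (here refl))) t″) of λ ()
      ...   | _ | left = absurd
        where
        above : (suc (suc x) , suc y) ∈ᵞ Λ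
        above = inside c∈ (subst ((suc (suc x) , suc y) ∈ᵈ_) (sym t″) (there (here refl)))
        tile≡above : tile (suc (suc x) , suc y) ≡ horizontal (suc x , suc y)
        tile≡above = trans (consistent c∈ (subst ((suc (suc x) , suc y) ∈ᵈ_) (sym t″) (there (here refl)))) t″
        beside : (suc (suc x) , y) ∈ᵞ Λ
        beside = Λ-down (m≤n⇒m≤1+n (s≤s p)) above
        lb = lowCell beside (m≤n⇒m≤1+n (m≤n⇒m≤1+n p))
        label≡′ : label (tile (suc x , y)) ≡ label (tile (suc (suc x) , suc y))
        label≡′ = trans (cong label (trans (sym tile≡) t)) (trans label≡ (cong label (sym tile≡above)))
        absurd : ⊥
        absurd with label-between (rows l′ lb (n≤1+n (suc x))) (columns lb (lowCell above (m≤n⇒m≤1+n (s≤s p))) (n≤1+n y)) label≡′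
        ... | e with view {d = horizontal (x , y)} (subst ((suc (suc x) , y) ∈ᵈ_)
                      (sym (trans (sym t) (trans tile≡ (primedOncePerRow l′ lb (subst Primed (cong label (trans (sym t) tile≡)) u) (trans label≡′ (sym e))))))
                      (covers beside))
        ... | ()

-- The lower part of a tableau is determined by its code

isVertical? : ∀ d c → Dec (d ≡ vertical c)
isVertical? (horizontal _) c = no λ ()
isVertical? (vertical c′)  c = map′ (cong vertical) (λ { refl → refl }) (c′ ≟ᶜ c)

module _ {Λ P} (Q : Quotient Λ P) where
  open Quotient Q
  open Codes Q

  -- The properties of a tableau that fix its lower tiles. `vertical-left` says that the vertical
  -- dominoes with corner on `D₀` occupy an initial segment of the diagonal.
  record KeyedPaving : Set where
    field
      paving : Paving Λ
    open Paving paving public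
    field
      dominoKey    : Domino → ℕ
      key-level    : ∀ {x y} → (x , y) ∈ᵞ Λ → y ≤ x → sub (dominoKey (tile (x , y))) ≡ level (tile (x , y))
      key-diagonal : ∀ {x y} → y ≤ x → (suc x , suc y) ∈ᵞ Λ → dominoKey (tile (x , y)) < dominoKey (tile (suc x , suc y))
      vertical-left : ∀ {x} → (suc x , suc x) ∈ᵞ Λ → tile (suc x , suc x) ≡ vertical (suc x , suc x) →
                      tile (x , x) ≡ vertical (x , x)

    cellKey : ℕ → ℕ → ℕ
    cellKey x y = dominoKey (tile (x , y))

    along : ∀ {x y x′ y′ d} → (x , y) ∈ᵞ Λ → tile (x , y) ≡ d → (x′ , y′) ∈ᵈ d →
            (x′ , y′) ∈ᵞ Λ × tile (x′ , y′) ≡ d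
    along c∈ refl p = inside c∈ p , consistent c∈ p

  module Compare (T U : KeyedPaving)
                 (same : ∀ {x y} → (x , y) ∈ᵞ Λ → y ≤ x → KeyedPaving.cellKey T x y ≡ KeyedPaving.cellKey U x y) where
    private
      module T = KeyedPaving T
      module U = KeyedPaving U

    level-≡ : ∀ {x y} → (x , y) ∈ᵞ Λ → y ≤ x → level (T.tile (x , y)) ≡ level (U.tile (x , y))
    level-≡ c∈ p = trans (sym (T.key-level c∈ p)) (trans (cong sub (same c∈ p)) (U.key-level c∈ p))

    -- In both clashes, two cells of one diagonal of U have the same key.

    outward-clash : ∀ {x y} → suc y ≤ x → (x , suc y) ∈ᵞ Λ → T.tile (x , suc y) ≡ horizontal (x , suc y) →
                    U.tile (x , suc y) ≡ vertical (x , y) → ⊥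
    outward-clash {x} {y} p c∈ t u = <-irrefl below≡right (U.key-diagonal (<⇒≤ p) (proj₁ right∈))
      where
      right∈ = T.along c∈ t (there (here refl))
      below≡right : U.cellKey x y ≡ U.cellKey (suc x) (suc y)
      below≡right = begin
        U.cellKey x y             ≡⟨ cong U.dominoKey (trans (proj₂ (U.along c∈ u (here refl))) (sym u)) ⟩
        U.cellKey x (suc y)       ≡⟨ same c∈ p ⟨
        T.cellKey x (suc y)       ≡⟨ cong T.dominoKey (trans t (sym (proj₂ right∈))) ⟩
        T.cellKey (suc x) (suc y) ≡⟨ same (proj₁ right∈) (m≤n⇒m≤1+n p) ⟩
        U.cellKey (suc x) (suc y) ∎
        where open ≡-Reasoning

    inward-clash : ∀ {x y} → y ≤ x → (suc x , y) ∈ᵞ Λ → T.tile (suc x , y) ≡ horizontal (x , y) →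
                   U.tile (suc x , y) ≡ vertical (suc x , y) → ⊥
    inward-clash {x} {y} p c∈ t u = <-irrefl left≡above (U.key-diagonal p (proj₁ above∈))
      where
      left∈  = T.along c∈ t (here refl)
      above∈ = U.along c∈ u (there (here refl))
      left≡above : U.cellKey x y ≡ U.cellKey (suc x) (suc y)
      left≡above = begin
        U.cellKey x y             ≡⟨ same (proj₁ left∈) p ⟨
        T.cellKey x y             ≡⟨ cong T.dominoKey (trans (proj₂ left∈) (sym t)) ⟩
        T.cellKey (suc x) y       ≡⟨ same c∈ (m≤n⇒m≤1+n p) ⟩
        U.cellKey (suc x) y       ≡⟨ cong U.dominoKey (trans u (sym (proj₂ above∈))) ⟩
        U.cellKey (suc x) (suc y) ∎
        where open ≡-Reasoning

    -- `inward-clash` does not reach the diagonal, because the left neighbour is an upper cell.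
    -- Instead descend along `D₀`: by induction `U` too has a vertical domino at the previous
    -- diagonal cell, and its top blocks the horizontal domino ending at `(x , x)`.
    vertical⇒vertical : ∀ x → (x , x) ∈ᵞ Λ → T.tile (x , x) ≡ vertical (x , x) → U.tile (x , x) ≡ vertical (x , x)
    vertical⇒vertical x c∈ e = go refl (inward ≤-refl (trans (sym (level-≡ c∈ ≤-refl)) (cong level e)) (view (U.covers c∈)))
      where
      go : ∀ {d} → U.tile (x , x) ≡ d → Inward x x d → d ≡ vertical (x , x)
      go u bottom = refl
      go u (right {x = x′}) = case trans (sym (proj₂ (U.along p∈ previous (there (here refl)))))
                                         (proj₂ (U.along c∈ u (here refl))) of λ ()
        where
        p∈ : (x′ , x′) ∈ᵞ Λ
        p∈ = <⇒≤ (Λ-down Q ≤-refl c∈)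
        previous : U.tile (x′ , x′) ≡ vertical (x′ , x′)
        previous = vertical⇒vertical x′ p∈ (T.vertical-left c∈ e)

  module _ (T U : KeyedPaving)
           (same : ∀ {x y} → (x , y) ∈ᵞ Λ → y ≤ x → KeyedPaving.cellKey T x y ≡ KeyedPaving.cellKey U x y) where
    private
      module T = KeyedPaving T
      module U = KeyedPaving U
      module TU = Compare T U same
      module UT = Compare U T (λ c∈ p → sym (same c∈ p))

    tile-≡ : ∀ {x y} → (x , y) ∈ᵞ Λ → y ≤ x → T.tile (x , y) ≡ U.tile (x , y)
    tile-≡ {x} {y} c∈ p with level-bounds p (view (T.covers c∈))
    ... | q , r with m≤n⇒m<n∨m≡n q
    ...   | inj₁ q′ = go refl refl (outward (≤-antisym r q′) (view (T.covers c∈)))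
                                   (outward (trans (sym (TU.level-≡ c∈ p)) (≤-antisym r q′)) (view (U.covers c∈)))
      where
      go : ∀ {d e} → T.tile (x , y) ≡ d → U.tile (x , y) ≡ e → Outward x y d → Outward x y e → d ≡ e
      go t u left left = refl
      go t u top  top  = refl
      go t u left top  = ⊥-elim (TU.outward-clash p c∈ t u)
      go t u top  left = ⊥-elim (UT.outward-clash p c∈ u t)
    ...   | inj₂ e = go refl refl (inward p (sym e) (view (T.covers c∈)))
                                  (inward p (trans (sym (TU.level-≡ c∈ p)) (sym e)) (view (U.covers c∈)))
      where
      go : ∀ {d e} → T.tile (x , y) ≡ d → U.tile (x , y) ≡ e → Inward x y d → Inward x y e → d ≡ e
      go t u right  right  = refl
      go t u bottom bottom = refl
      go t u right  bottom = case m≤n⇒m<n∨m≡n p of λ where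
        (inj₁ p′)   → ⊥-elim (TU.inward-clash (s≤s⁻¹ p′) c∈ t u)
        (inj₂ refl) → trans (sym t) (UT.vertical⇒vertical x c∈ u)
      go t u bottom right  = case m≤n⇒m<n∨m≡n p of λ where
        (inj₁ p′)   → ⊥-elim (UT.inward-clash (s≤s⁻¹ p′) c∈ u t)
        (inj₂ refl) → trans (sym (TU.vertical⇒vertical x c∈ t)) u

  module FromTableau (T : ShiftedDominoTableau Λ) where
    open ShiftedDominoTableau T
    open Coded Q T

    S : ℕ → Set
    S τ = ∃[ c ] (c ∈ᵞ Λ × ¬ Up′ (tile c)) × dominoKey (tile c) ≡ τ

    S? : ∀ τ → Dec (S τ)
    S? τ = map′ found (λ (c , (c∈ , ¬up) , e) → lose (∈-cells⁺ Λ c∈) (¬up , e))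
      (Any.any? (λ c → ¬? (Up′? (tile c)) ×-dec (dominoKey (tile c) ≟ τ)) (cells Λ))
      where
      found : Any (λ c → ¬ Up′ (tile c) × dominoKey (tile c) ≡ τ) (cells Λ) → S τ
      found p with find p
      ... | c , c∈ , ¬up , e = c , (∈-cells⁻ Λ c∈ , ¬up) , e

    open Count (suc bound) S?

    d : ℕ → ℕ
    d i = D i + D (suc i)

    diagonalKey : ℕ → ℕ → ℕ
    diagonalKey i j = cellKey (j + i) j

    onDiagonal : ∀ {i j} → j < d i → (j + i , j) ∈ᵞ Λ × ¬ Up′ (tile (j + i , j))
    onDiagonal {i} {j} p = lowCell (low.from i j p) (m≤m+n j i)

    d-upper : ∀ {i j} → suc j < d i → j < d (suc i)
    d-upper {i} {j} p = s≤s⁻¹ (≤-trans p (≤-trans (+-monoˡ-≤ _ (D-upper i)) (≤-reflexive (cong suc (+-comm (D (2 + i)) _)))))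

    d-lower : ∀ {i j} → j < d (suc i) → j < d i
    d-lower {i} p = <-≤-trans p (≤-trans (+-monoʳ-≤ (D (suc i)) (D-lower i)) (≤-reflexive (+-comm (D (suc i)) (D i))))

    level-diagonal : ∀ {i j} → j < d i → level (tile (j + i , j)) ≡ i ⊎ level (tile (j + i , j)) ≡ suc i
    level-diagonal {i} {j} p with level-bounds (m≤m+n j i) (view (covers (proj₁ (onDiagonal p))))
    ... | q , r rewrite m+n∸m≡n j i with m≤n⇒m<n∨m≡n q
    ...   | inj₁ q′ = inj₂ (≤-antisym r q′)
    ...   | inj₂ e  = inj₁ (sym e)

    -- A lower domino of level `i` or `suc i` has a cell of content -i, so the steps of `N i` are
    -- the cells of that diagonal, and `key-diagonal` puts their keys in order.
    enumeration : ∀ i → Enumerates (N i) (d i) (diagonalKey i)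
    enumeration i = enumerates (N-slow i) (diagonalKey i) refl
      (λ {j} p → key-diagonal (m≤m+n j i) (proj₁ (onDiagonal p)))
      (λ p → let l = onDiagonal p in N-hit (_ , l , refl)
        (subst (λ m → m ≡ i ⊎ m ≡ suc i) (sym (sub-tile l)) (level-diagonal p)))
      λ e → case N-hit⁻ e of λ where
        ((c , l , refl) , e) → let j , c∈ , tile≡ = reach l i (subst (λ m → m ≡ i ⊎ m ≡ suc i) (sub-tile l) e)
          in j , low.to i j c∈ , cong dominoKey tile≡

    private
      time-bound : ℕ
      time-bound = suc (maximum (λ i → maximum (diagonalKey i) (d i)) bound)

      key< : ∀ {i j} → j < d i → diagonalKey i j < time-bound
      key< {i} p = s≤s (≤-trans (≤-maximum (diagonalKey i) p)
                                (≤-maximum (λ i → maximum (diagonalKey i) (d i)) (diagonal<bound Q p)))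

      total-N : ∀ {R} → time-bound ≤ R → ∀ i → N i R ≡ d i
      total-N le i = Enumerates.total (enumeration i) λ p → <-≤-trans (key< p) le

      total : ∀ {R} → time-bound ≤ R → ∀ m → A m R ≡ D m
      total {R} le m = go bound (m≤m+n bound m)
        where
        -- The shape gives only the sums of neighbouring counters. Beyond `bound` both summands
        -- vanish, and from there descending induction on `m` recovers each of them.
        go : ∀ k {m} → bound ≤ k + m → A m R ≡ D m
        go zero {m} p = trans
          (m+n≡0⇒m≡0 _ (trans (total-N le m) (cong₂ _+_ (D-zero p) (D-zero (m≤n⇒m≤1+n p))))) (sym (D-zero p))
        go (suc k) {m} p = +-cancelʳ-≡ (A (suc m) R) _ _ (trans (total-N le m)
          (cong (D m +_) (sym (go k (≤-trans p (≤-reflexive (sym (+-suc k m))))))))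

    code : ShiftedDominoTableau.NoPrimedOnD₀ T → Code
    code noPrimed = record
      { S = S ; S? = S?
      ; lower = λ m τ → +-cancelˡ-≤ (A (suc m) τ) _ _ (≤-trans
          (interlace-≤ (enumeration (suc m)) (enumeration m) (λ {j} p → d-lower p ,
            subst (λ x → cellKey (j + m) j ≤ cellKey x j) (sym (+-suc j m))
              (key-right (m≤m+n j m) (subst (λ x → (x , j) ∈ᵞ Λ) (+-suc j m) (proj₁ (onDiagonal p))))) τ)
          (≤-reflexive (+-comm (A m τ) _)))
      ; upper = λ m τ → +-cancelˡ-≤ (A (suc m) τ) _ _ (≤-trans (≤-reflexive (+-comm (A (suc m) τ) _)) (≤-trans
          (interlace-≤suc (enumeration m) (enumeration (suc m)) (λ {j} p → d-upper p ,
            subst (λ x → cellKey x j ≤ cellKey (suc j + m) (suc j)) (sym (+-suc j m))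
              (key-up (s≤s (m≤m+n j m)) (proj₁ (onDiagonal p)))) τ)
          (≤-reflexive (sym (+-suc _ _)))))
      ; R = time-bound
      ; total = total ≤-refl
      ; bounded = λ m τ → ≤-trans (Slow.mono (A-slow m) (m≤n⊔m time-bound τ))
                                  (≤-reflexive (total (m≤m⊔n time-bound τ) m))
      ; onD₀ = λ { (c , l , refl) p → subst Unprimed (sym (letter-tile l))
          (noPrimed (tile c) (c , proj₁ l , refl) (cutBy0 (tile c) (proj₂ l) (subst (_≤ 1) (sub-tile l) p))) }
      }

    -- The only use of admissibility.

    vertical-left : ∀ {x} → (suc x , suc x) ∈ᵞ Λ → tile (suc x , suc x) ≡ vertical (suc x , suc x) →
                    tile (x , x) ≡ vertical (x , x)
    vertical-left {x} c∈ e with isVertical? (tile (x , x)) (x , x)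
    ... | yes p = p
    ... | no ¬e = contradiction
      ((tile (x , suc x) , (_ , left∈ , refl) , _ , _ , covers left∈ , here refl) , all-up)
      (admissible (suc x , suc x) (_ , c∈ , e) (here (content-diagonal (suc x))))
      where
      left∈ : (x , suc x) ∈ᵞ Λ
      left∈ = <-trans ≤-refl c∈
      -- This cell has content 1, so its domino is upper unless the other cell has content 0. That
      -- cell would be `(x , x)`, excluded by assumption, or `(suc x , suc x)`, which already
      -- belongs to the vertical domino.
      corner-left : Up′ (tile (x , suc x))
      corner-left with tile (x , suc x) in t | view (covers left∈)
      ... | _ | left  = case trans (sym e) (trans (consistent left∈ (subst (_ ∈ᵈ_) (sym t) (there (here refl)))) t) of λ ()
      ... | _ | right = up′-horizontal⁺ ≤-refl
      ... | _ | bottom = up′-vertical⁺ ≤-refl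
      ... | _ | top   = contradiction (trans (consistent left∈ (subst (_ ∈ᵈ_) (sym t) (here refl))) t) ¬e
      all-up : ∀ d → d ∈ᵖ paving → LeftAdjacent d (vertical (suc x , suc x)) → Up′ d
      all-up d (c , c′∈ , refl) (_ , _ , p , here refl) =
        subst Up′ (consistent c′∈ p) corner-left
      all-up d (c , c′∈ , refl) (_ , _ , p , there (here refl)) with tile c | view p
      ... | _ | left   = up′-horizontal⁺ ≤-refl
      ... | _ | right  = up′-horizontal⁺ (s≤s (n≤1+n _))
      ... | _ | bottom = up′-vertical⁺ (n≤1+n _)
      ... | _ | top    = up′-vertical⁺ ≤-refl

    keyed : KeyedPaving
    keyed = record
      { paving        = paving
      ; dominoKey     = dominoKey
      ; key-level     = λ c∈ p → sub-tile (lowCell c∈ p)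
      ; key-diagonal  = key-diagonal
      ; vertical-left = vertical-left
      }

  module SameCode (T U : ShiftedDominoTableau Λ) (same : ∀ τ → FromTableau.S T τ ⇔ FromTableau.S U τ) where
    private
      module T = ShiftedDominoTableau T
      module U = ShiftedDominoTableau U
      module CT = Coded Q T
      module CU = Coded Q U
      module FT = FromTableau T
      module FU = FromTableau U

    N-≡ : ∀ i τ → Count.N (suc bound) FT.S? i τ ≡ Count.N (suc bound) FU.S? i τ
    N-≡ i τ = cong₂ _+_ (A-cong (suc bound) FT.S? FU.S? same i τ) (A-cong (suc bound) FT.S? FU.S? same (suc i) τ)

    cellKey-≡ : ∀ {x y} → (x , y) ∈ᵞ Λ → y ≤ x → CT.cellKey x y ≡ CU.cellKey x y
    cellKey-≡ {x} {y} c∈ p = subst (λ z → CT.cellKey z y ≡ CU.cellKey z y) x≡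
      (at-unique (Count.N-slow (suc bound) FT.S? i) (Enumerates.isAt (FT.enumeration i) y<)
        (subst₂ (λ n n′ → n ≡ y × n′ ≡ suc y) (sym (N-≡ i τ)) (sym (N-≡ i (suc τ)))
          (Enumerates.isAt (FU.enumeration i) y<)))
      where
      i = x ∸ y
      x≡ : y + i ≡ x
      x≡ = m+[n∸m]≡n p
      τ = FU.diagonalKey i y
      y< : y < D i + D (suc i)
      y< = low.to i y (subst (λ z → (z , y) ∈ᵞ Λ) (sym x≡) c∈)

    same-tile : ∀ {x y} → (x , y) ∈ᵞ Λ → y ≤ x → T.tile (x , y) ≡ U.tile (x , y)
    same-tile = tile-≡ FT.keyed FU.keyed cellKey-≡

    same-label : ∀ {x y} → (x , y) ∈ᵞ Λ → y ≤ x → T.label (T.tile (x , y)) ≡ U.label (U.tile (x , y))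
    same-label c∈ p = trans (sym (CT.letter-tile (CT.lowCell c∈ p)))
      (trans (cong letter (cellKey-≡ c∈ p)) (CU.letter-tile (CU.lowCell c∈ p)))

    -- Every lower domino has a cell on or below `D₀`, where the two tilings and their labels are
    -- known to agree.
    transfer : ∀ d → T.LowDomino d → U.LowDomino d × T.label d ≡ U.label d
    transfer d ((c , c∈ , refl) , ¬up) with CT.reach (c∈ , ¬up) (level d) (inj₁ refl)
    ... | j , c′∈ , e = ((_ , c′∈ , e′) , ¬up) ,
          trans (cong T.label (sym e)) (trans (same-label c′∈ y≤x) (cong U.label e′))
      where
      y≤x = m≤m+n j (level d)
      e′ : U.tile (j + level d , j) ≡ d
      e′ = trans (sym (same-tile c′∈ y≤x)) e

  same-code : ∀ T U → (∀ τ → FromTableau.S T τ ⇔ FromTableau.S U τ) → SameLowerPart T U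
  same-code T U same = record
    { lowDominoes = λ d → mk⇔ (proj₁ ∘ SameCode.transfer T U same d)
        (proj₁ ∘ SameCode.transfer U T (λ τ → mk⇔ (Equivalence.from (same τ)) (Equivalence.to (same τ))) d)
    ; labels = λ d → proj₂ ∘ SameCode.transfer T U same d
    }

  code-of-same : ∀ {T U} → SameLowerPart T U → ∀ τ → FromTableau.S T τ → FromTableau.S U τ
  code-of-same {T} {U} same τ (c , (c∈ , ¬up) , refl)
    with Equivalence.to (SameLowerPart.lowDominoes same _) ((c , c∈ , refl) , ¬up)
  ... | (c′ , c′∈ , e) , ¬up′ = c′ , (c′∈ , subst (¬_ ∘ Up′) (sym e) ¬up) ,
    trans (cong (λ d → key (ShiftedDominoTableau.label U d) (level d)) e)
          (cong (λ a → key a (level (ShiftedDominoTableau.tile T c)))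
            (sym (SameLowerPart.labels same _ ((c , c∈ , refl) , ¬up))))

-- Growing diagrams

-- At time τ the boundary of the diagram meets the line X - Y = i - E at the
-- point (X i τ + X (suc i) τ , Y i τ + Y (suc i) τ); the points (X m τ , Y m τ)
-- with m even, and those with m odd, bound the two diagrams of the quotient.

record Chain (Λ : List ℕ) : Set where
  field
    E R     : ℕ
    X Y     : ℕ → ℕ → ℕ
    turn    : ℕ → Bool
    path    : ∀ m τ → (X (2 + m) τ ≡ suc (X m τ) × Y (2 + m) τ ≡ Y m τ)
                    ⊎ (X (2 + m) τ ≡ X m τ × Y m τ ≡ suc (Y (2 + m) τ))
    step    : ∀ m τ → X m (suc τ) ≡ X m τ ⊎ (isOdd m ≡ turn τ × X m (suc τ) ≡ suc (X m τ))
    still   : ∀ τ → X 0 (suc τ) ≡ X 0 τ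
    line    : ∀ i τ → X i τ + X (suc i) τ + E ≡ Y i τ + Y (suc i) τ + i
    inside  : ∀ {x y} → (x , y) ∈ᵞ Λ → y ≤ x + E
    initial : ∀ {x y i} → x + E ≡ y + i → X i 0 + X (suc i) 0 ≤ x
    final   : ∀ {x y i} → x + E ≡ y + i → (x , y) ∈ᵞ Λ ⇔ x < X i R + X (suc i) R

module ChainPaving {Λ} (C : Chain Λ) where
  open Chain C

  x y : ℕ → ℕ → ℕ
  x i τ = X i τ + X (suc i) τ
  y i τ = Y i τ + Y (suc i) τ

  point : ℕ → ℕ → Cell
  point i τ = x i τ , y i τ

  Moves : ℕ → ℕ → Set
  Moves m τ = X m (suc τ) ≡ suc (X m τ)

  moves⇒turn : ∀ {m τ} → Moves m τ → isOdd m ≡ turn τ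
  moves⇒turn {m} {τ} p with step m τ
  ... | inj₁ e       = contradiction (trans (sym p) e) 1+n≢n
  ... | inj₂ (e , _) = e

  rests : ∀ {m τ} → ¬ isOdd m ≡ turn τ → X m (suc τ) ≡ X m τ
  rests {m} {τ} h with step m τ
  ... | inj₁ e       = e
  ... | inj₂ (e , _) = contradiction e h

  alternate : ∀ i {τ} → isOdd i ≡ turn τ → ¬ isOdd (suc i) ≡ turn τ
  alternate i p q = not-¬ refl (trans p (sym q))

  -- At each time `turn` lets only one parity of indices move. So at most one of `X i` and
  -- `X (suc i)` moves, namely the one picked here, and a line gains at most one cell at a time.
  pick : ℕ → ℕ → ℕ
  pick i τ with isOdd i Bool.≟ turn τ
  ... | yes _ = i
  ... | no  _ = suc i

  pick-moves : ∀ {m i τ} → Moves m τ → m ≡ i ⊎ m ≡ suc i → pick i τ ≡ m × x i (suc τ) ≡ suc (x i τ)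
  pick-moves {m} {i} {τ} p (inj₁ refl) with isOdd i Bool.≟ turn τ
  ... | yes q = refl , cong₂ _+_ p (rests (alternate i q))
  ... | no ¬q = contradiction (moves⇒turn p) ¬q
  pick-moves {m} {i} {τ} p (inj₂ refl) with isOdd i Bool.≟ turn τ
  ... | yes q = contradiction (moves⇒turn p) (alternate i q)
  ... | no ¬q = refl , trans (cong₂ _+_ (rests ¬q) p) (+-suc _ _)

  moves-pick : ∀ {i τ} → x i (suc τ) ≡ suc (x i τ) → Moves (pick i τ) τ × (pick i τ ≡ i ⊎ pick i τ ≡ suc i)
  moves-pick {i} {τ} p with isOdd i Bool.≟ turn τ
  ... | yes q = +-cancelʳ-≡ (X (suc i) τ) _ _ (trans (cong (X i (suc τ) +_) (sym (rests (alternate i q)))) p) , inj₁ refl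
  ... | no ¬q = +-cancelˡ-≡ (X i τ) _ _ (trans (cong (_+ X (suc i) (suc τ)) (sym (rests ¬q))) (trans p (sym (+-suc _ _)))) , inj₂ refl

  X-slow : ∀ m → Slow (X m)
  X-slow m .Slow.step τ with step m τ
  ... | inj₁ e       = inj₁ e
  ... | inj₂ (_ , e) = inj₂ e

  x-slow : ∀ i → Slow (x i)
  x-slow i .Slow.step τ with Slow.step (X-slow i) τ | Slow.step (X-slow (suc i)) τ
  ... | inj₁ p | inj₁ q = inj₁ (cong₂ _+_ p q)
  ... | inj₂ p | _      = inj₂ (proj₂ (pick-moves p (inj₁ refl)))
  ... | inj₁ _ | inj₂ q = inj₂ (proj₂ (pick-moves q (inj₂ refl)))

  x-suc : ∀ i τ → x i τ ≤ x (suc i) τ × x (suc i) τ ≤ suc (x i τ)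
  x-suc i τ with path i τ
  ... | inj₁ (e , _) = ≤-trans (n≤1+n _) (≤-reflexive (sym eq)) , ≤-reflexive eq
    where
    eq : x (suc i) τ ≡ suc (x i τ)
    eq = trans (cong (X (suc i) τ +_) e) (trans (+-suc _ _) (cong suc (+-comm (X (suc i) τ) _)))
  ... | inj₂ (e , _) = ≤-reflexive (sym eq) , ≤-trans (≤-reflexive eq) (n≤1+n _)
    where
    eq : x (suc i) τ ≡ x i τ
    eq = trans (cong (X (suc i) τ +_) e) (+-comm (X (suc i) τ) _)

  lineOf : Cell → ℕ
  lineOf (a , b) = a + E ∸ b

  time : Cell → ℕ
  time c = search (x (lineOf c)) R (proj₁ c)

  on-line : ∀ {a b i} → a + E ≡ b + i → lineOf (a , b) ≡ i
  on-line {b = b} {i} e = trans (cong (_∸ b) e) (m+n∸m≡n b i)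

  lineOf-line : ∀ {a b} → (a , b) ∈ᵞ Λ → a + E ≡ b + lineOf (a , b)
  lineOf-line c∈ = sym (m+[n∸m]≡n (inside c∈))

  time-at : ∀ {a b} → (a , b) ∈ᵞ Λ → At (x (lineOf (a , b))) (time (a , b)) a × time (a , b) < R
  time-at {a} {b} c∈ = search-at (x-slow _) R (initial e) (Equivalence.to (final e) c∈)
    where
    e : a + E ≡ b + lineOf (a , b)
    e = lineOf-line c∈

  point-time : ∀ {c} → c ∈ᵞ Λ → point (lineOf c) (time c) ≡ c
  point-time {a , b} c∈ = cong₂ _,_ x≡ (+-cancelʳ-≡ i _ _ (trans (sym (line i (time (a , b)))) (trans (cong (_+ E) x≡) (lineOf-line c∈))))
    where
    i = lineOf (a , b)
    x≡ = proj₁ (proj₁ (time-at c∈))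

  index-of : Cell → ℕ
  index-of c = pick (lineOf c) (time c)

  index-moves : ∀ {c} → c ∈ᵞ Λ → Moves (index-of c) (time c) × (index-of c ≡ lineOf c ⊎ index-of c ≡ suc (lineOf c))
  index-moves c∈ with time-at c∈
  ... | (e , e′) , _ = moves-pick (trans e′ (cong suc (sym e)))

  -- The domino added at time τ to the component bounded by (X m , Y m).

  domino : ℕ → ℕ → Domino
  -- A placeholder: a domino needs the lines of index `m - 1` and `m`, and by `still` the index 0
  -- never moves.
  domino zero    τ = horizontal (0 , 0)
  domino (suc m) τ with path m τ
  ... | inj₁ _ = horizontal (point m τ)
  ... | inj₂ _ = vertical (point (suc m) τ)

  -- The two sums share the summand of index `suc m`. So consecutive boundary points differ by one
  -- step, right or down, of the path of a single component, and are the two cells of a domino.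
  point-suc : ∀ m τ → (domino (suc m) τ ≡ horizontal (point m τ) × point (suc m) τ ≡ (suc (x m τ) , y m τ))
                    ⊎ (domino (suc m) τ ≡ vertical (point (suc m) τ) × point m τ ≡ (x (suc m) τ , suc (y (suc m) τ)))
  point-suc m τ with path m τ
  ... | inj₁ (e , e′) = inj₁ (refl , cong₂ _,_
    (trans (cong (X (suc m) τ +_) e) (trans (+-suc _ _) (cong suc (+-comm (X (suc m) τ) _))))
    (trans (cong (Y (suc m) τ +_) e′) (+-comm (Y (suc m) τ) _)))
  ... | inj₂ (e , e′) = inj₂ (refl , cong₂ _,_
    (trans (+-comm (X m τ) _) (cong (X (suc m) τ +_) (sym e)))
    (trans (cong (_+ Y (suc m) τ) e′) (cong suc (+-comm (Y (2 + m) τ) _))))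

  point∈domino : ∀ {m i τ} → suc m ≡ i ⊎ suc m ≡ suc i → point i τ ∈ᵈ domino (suc m) τ
  point∈domino {m} {τ = τ} e with point-suc m τ
  point∈domino (inj₁ refl) | inj₁ (d≡ , p) rewrite d≡ = there (here p)
  point∈domino (inj₂ refl) | inj₁ (d≡ , p) rewrite d≡ = here refl
  point∈domino (inj₁ refl) | inj₂ (d≡ , p) rewrite d≡ = here refl
  point∈domino (inj₂ refl) | inj₂ (d≡ , p) rewrite d≡ = there (here p)

  domino-point : ∀ {m τ c} → c ∈ᵈ domino (suc m) τ → ∃[ i ] (suc m ≡ i ⊎ suc m ≡ suc i) × c ≡ point i τ
  domino-point {m} {τ} c∈ with point-suc m τ
  ... | inj₁ (d≡ , p) rewrite d≡ = case c∈ of λ where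
    (here e)         → m , inj₂ refl , e
    (there (here e)) → suc m , inj₁ refl , trans e (sym p)
  ... | inj₂ (d≡ , p) rewrite d≡ = case c∈ of λ where
    (here e)         → suc m , inj₁ refl , e
    (there (here e)) → m , inj₂ refl , trans e (sym p)

  covers-point : ∀ {m i τ} → Moves m τ → m ≡ i ⊎ m ≡ suc i → point i τ ∈ᵈ domino m τ
  covers-point {zero}  {τ = τ} p = contradiction (trans (sym p) (still τ)) 1+n≢n
  covers-point {suc m} p = point∈domino

  covered-point : ∀ {m τ c} → Moves m τ → c ∈ᵈ domino m τ → ∃[ i ] (m ≡ i ⊎ m ≡ suc i) × c ≡ point i τ
  covered-point {zero}  {τ} p = contradiction (trans (sym p) (still τ)) 1+n≢n
  covered-point {suc m} p = domino-point

  tile : Cell → Domino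
  tile c = domino (index-of c) (time c)

  -- A move of `X m` adds one cell to line `m` and one to line `m - 1`. Both cells record the same
  -- time and index, which is why the tiling is consistent.
  located : ∀ {m i τ} → Moves m τ → m ≡ i ⊎ m ≡ suc i → τ < R →
            point i τ ∈ᵞ Λ × time (point i τ) ≡ τ × index-of (point i τ) ≡ m
  located {m} {i} {τ} moves e τ<R = c∈ , t , trans (cong₂ pick l t) (proj₁ (pick-moves moves e))
    where
    c∈ : point i τ ∈ᵞ Λ
    c∈ = Equivalence.from (final (line i τ))
      (≤-trans (≤-reflexive (sym (proj₂ (pick-moves moves e)))) (Slow.mono (x-slow i) τ<R))
    l : lineOf (point i τ) ≡ i
    l = on-line (line i τ)
    t : time (point i τ) ≡ τ
    t = at-unique (x-slow i) (subst (λ k → At (x k) (time (point i τ)) (x i τ)) l (proj₁ (time-at c∈)))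
                             (refl , proj₂ (pick-moves moves e))

  covers : ∀ {c} → c ∈ᵞ Λ → c ∈ᵈ tile c
  covers {c} c∈ with index-moves c∈
  ... | moves , e = subst (_∈ᵈ tile c) (point-time c∈) (covers-point moves e)

  along : ∀ {c c′} → c ∈ᵞ Λ → c′ ∈ᵈ tile c → c′ ∈ᵞ Λ × time c′ ≡ time c × index-of c′ ≡ index-of c
  along {c} c∈ p with index-moves c∈
  ... | moves , _ with covered-point moves p
  ...   | i , e , refl = located moves e (proj₂ (time-at c∈))

  paving : Paving Λ
  paving = record
    { tile       = tile
    ; covers     = covers
    ; inside     = λ c∈ p → proj₁ (along c∈ p)
    ; consistent = λ c∈ p → let _ , t , i = along c∈ p in cong₂ domino i t
    }

  time-right : ∀ {a b} → (suc a , b) ∈ᵞ Λ → time (a , b) ≤ time (suc a , b)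
  time-right {a} {b} c∈ = s≤s⁻¹ (at-above (x-slow i) (proj₁ (time-at l∈))
    (s≤s⁻¹ (≤-trans (≤-reflexive (sym (proj₂ beside))) (proj₂ (x-suc i (suc (time (suc a , b))))))))
    where
    l∈ : (a , b) ∈ᵞ Λ
    l∈ = <⇒≤ c∈
    i = lineOf (a , b)
    beside : At (x (suc i)) (time (suc a , b)) (suc a)
    beside = subst (λ k → At (x k) (time (suc a , b)) (suc a))
      (on-line (trans (cong suc (lineOf-line l∈)) (sym (+-suc b i)))) (proj₁ (time-at c∈))

  below∈ : ∀ {a b} → (a , suc b) ∈ᵞ Λ → (a , b) ∈ᵞ Λ
  below∈ {a} {b} c∈ = Equivalence.from (final (trans (lineOf-line c∈) (sym (+-suc b _))))
    (<-≤-trans (Equivalence.to (final (lineOf-line c∈)) c∈) (proj₁ (x-suc _ R)))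

  time-up : ∀ {a b} → (a , suc b) ∈ᵞ Λ → time (a , b) ≤ time (a , suc b)
  time-up {a} {b} c∈ = s≤s⁻¹ (at-above (x-slow (suc i)) below
    (<-≤-trans (≤-reflexive (sym (proj₂ (proj₁ (time-at c∈))))) (proj₁ (x-suc i (suc (time (a , suc b)))))))
    where
    i = lineOf (a , suc b)
    below : At (x (suc i)) (time (a , b)) a
    below = subst (λ k → At (x k) (time (a , b)) a) (on-line (trans (lineOf-line c∈) (sym (+-suc b i)))) (proj₁ (time-at (below∈ c∈)))

  time-row : ∀ {a a′ b} → (a′ , b) ∈ᵞ Λ → a ≤ a′ → time (a , b) ≤ time (a′ , b)
  time-row {a} {a′} {b} c∈ p = go (≤⇒≤′ p) c∈
    where
    go : ∀ {a′} → a ≤′ a′ → (a′ , b) ∈ᵞ Λ → time (a , b) ≤ time (a′ , b)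
    go ≤′-refl     _  = ≤-refl
    go (≤′-step q) c∈ = ≤-trans (go q (<⇒≤ c∈)) (time-right c∈)

  time-column : ∀ {a b b′} → (a , b′) ∈ᵞ Λ → b ≤ b′ → time (a , b) ≤ time (a , b′)
  time-column {a} {b} {b′} c∈ p = go (≤⇒≤′ p) c∈
    where
    go : ∀ {b′} → b ≤′ b′ → (a , b′) ∈ᵞ Λ → time (a , b) ≤ time (a , b′)
    go ≤′-refl     _  = ≤-refl
    go (≤′-step q) c∈ = ≤-trans (go q (below∈ c∈)) (time-up c∈)

  -- Line `E` is the main diagonal, and the added cells lie on the lines `m - 1` and `m`, where the
  -- content is positive.
  domino-up : ∀ {m τ} → Moves m τ → m < E → Up′ (domino m τ)
  domino-up {zero}  {τ} p _ = contradiction (trans (sym p) (still τ)) 1+n≢n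
  domino-up {suc m} {τ} p q with path m τ
  ... | inj₁ _ = up′-horizontal⁺ (+-cancelʳ-< m _ _ (begin-strict
      suc (x m τ) + m ≡⟨ +-suc (x m τ) m ⟨
      x m τ + suc m   <⟨ +-monoʳ-< (x m τ) q ⟩
      x m τ + E       ≡⟨ line m τ ⟩
      y m τ + m       ∎))
    where open ≤-Reasoning
  ... | inj₂ _ = up′-vertical⁺ (+-cancelʳ-< (suc m) _ _ (begin-strict
      x (suc m) τ + suc m <⟨ +-monoʳ-< (x (suc m) τ) q ⟩
      x (suc m) τ + E     ≡⟨ line (suc m) τ ⟩
      y (suc m) τ + suc m ∎))
    where open ≤-Reasoning

  domino-low : ∀ {m τ} → Moves m τ → E ≤ m → ¬ Up′ (domino m τ)
  domino-low {m} {τ} p q u = <⇒≱ (up′-above u (covers-point p (inj₁ refl)))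
    (+-cancelʳ-≤ E _ _ (≤-trans (+-monoʳ-≤ (y m τ) q) (≤-reflexive (sym (line m τ)))))

  level-domino : ∀ {m τ} → Moves (E + m) τ → level (domino (E + m) τ) ≡ m
  level-domino {m} {τ} moves with E + m in e
  ... | zero  = contradiction (trans (sym moves) (still τ)) 1+n≢n
  ... | suc k with path k τ
  ...   | inj₁ _ = trans (cong (_∸ y k τ) (+-cancelʳ-≡ E _ _ (begin
      suc (x k τ) + E     ≡⟨ cong suc (line k τ) ⟩
      suc (y k τ + k)     ≡⟨ +-suc (y k τ) k ⟨
      y k τ + suc k       ≡⟨ cong (y k τ +_) (trans (sym e) (+-comm E m)) ⟩
      y k τ + (m + E)     ≡⟨ +-assoc (y k τ) m E ⟨
      y k τ + m + E       ∎))) (m+n∸m≡n (y k τ) m)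
    where open ≡-Reasoning
  ...   | inj₂ _ = trans (cong (_∸ y (suc k) τ) (+-cancelʳ-≡ E _ _ (begin
      x (suc k) τ + E       ≡⟨ line (suc k) τ ⟩
      y (suc k) τ + suc k   ≡⟨ cong (y (suc k) τ +_) (trans (sym e) (+-comm E m)) ⟩
      y (suc k) τ + (m + E) ≡⟨ +-assoc (y (suc k) τ) m E ⟨
      y (suc k) τ + m + E   ∎))) (m+n∸m≡n (y (suc k) τ) m)
    where open ≡-Reasoning

-- The chain of diagrams grown from a code

half-sum : ∀ i → half i + half (suc i) ≡ i
half-sum = ⌊n/2⌋+⌈n/2⌉≡n

-- As `e` falls, the points `(n ∸ e , n ⊔ e)` run down the y-axis to height `n` and then to the
-- right: they are the boundary of `n` rows completed up to the main diagonal.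
∸-path : ∀ n e → (n ∸ e ≡ suc (n ∸ suc e) × n ⊔ e ≡ n ⊔ suc e) ⊎ (n ∸ e ≡ n ∸ suc e × n ⊔ suc e ≡ suc (n ⊔ e))
∸-path n e with ≤-<-connex n e
... | inj₁ p = inj₂ (trans (m≤n⇒m∸n≡0 p) (sym (m≤n⇒m∸n≡0 (m≤n⇒m≤1+n p))) ,
    trans (m≤n⇒m⊔n≡n (m≤n⇒m≤1+n p)) (cong suc (sym (m≤n⇒m⊔n≡n p))))
... | inj₂ p = inj₁ (+-∸-assoc 1 p , trans (m≥n⇒m⊔n≡m (<⇒≤ p)) (sym (m≥n⇒m⊔n≡m p)))

∸-step : ∀ n e → suc n ∸ e ≡ n ∸ e ⊎ suc n ∸ e ≡ suc (n ∸ e)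
∸-step n e with ≤-<-connex e n
... | inj₁ p = inj₂ (+-∸-assoc 1 p)
... | inj₂ p = inj₁ (trans (m≤n⇒m∸n≡0 p) (sym (m≤n⇒m∸n≡0 (<⇒≤ p))))

∸-+-⊔ : ∀ n e → n ∸ e + e ≡ n ⊔ e
∸-+-⊔ n e with ≤-total n e
... | inj₁ p = trans (cong (_+ e) (m≤n⇒m∸n≡0 p)) (sym (m≤n⇒m⊔n≡n p))
... | inj₂ p = trans (m∸n+n≡m p) (sym (m≥n⇒m⊔n≡m p))

data Offset (x y : ℕ) : Set where
  under : ∀ i → x ≡ y + i           → Offset x y
  evenOver  : ∀ k → y ≡ x + 2 * k       → Offset x y
  oddOver   : ∀ k → y ≡ x + suc (2 * k) → Offset x y

offset-of : ∀ x y → Offset x y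
offset-of x y with ≤-total y x
... | inj₁ p = under (x ∸ y) (sym (m+[n∸m]≡n p))
... | inj₂ p with isOdd (y ∸ x) | subdiagonal-half (y ∸ x)
...   | false | e = evenOver (half (y ∸ x)) (trans (sym (m+[n∸m]≡n p)) (cong (x +_) (sym e)))
...   | true  | e = oddOver  (half (y ∸ x)) (trans (sym (m+[n∸m]≡n p)) (cong (x +_) (sym e)))

module _ {Λ P} (Q : Quotient Λ P) where
  open Quotient Q
  open Codes Q

  -- The subdiagonals of content k > 0 are filled so that each row of a
  -- component is completed to the left of the main diagonal just before its
  -- cell on the main diagonal is added: they have A 0 τ ∸ k and A 1 τ ∸ k
  -- cells.

  module Extension (c : Code) where
    open Code c

    -- Passing from `e` to `suc e` puts two indices in front of the others, one for each component.
    -- Hence the recursion in steps of two: `X e (2 * e + m)` is `X 0 m`, and the index 0 stands for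
    -- content `e` of the first component.
    X Y : ℕ → ℕ → ℕ → ℕ
    X zero    m             τ = A m τ + half m
    X (suc e) zero          τ = A 0 τ ∸ suc e
    X (suc e) (suc zero)    τ = A 1 τ ∸ suc e
    X (suc e) (suc (suc m)) τ = X e m τ
    Y zero    m             τ = A m τ
    Y (suc e) zero          τ = A 0 τ ⊔ suc e
    Y (suc e) (suc zero)    τ = A 1 τ ⊔ suc e
    Y (suc e) (suc (suc m)) τ = Y e m τ

    first : ∀ e τ → X e 0 τ ≡ A 0 τ ∸ e × Y e 0 τ ≡ A 0 τ ⊔ e
    first zero    τ = +-identityʳ _ , sym (⊔-identityʳ _)
    first (suc e) τ = refl , refl

    second : ∀ e τ → X e 1 τ ≡ A 1 τ ∸ e × Y e 1 τ ≡ A 1 τ ⊔ e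
    second zero    τ = +-identityʳ _ , sym (⊔-identityʳ _)
    second (suc e) τ = refl , refl

    path : ∀ e m τ → (X e (2 + m) τ ≡ suc (X e m τ) × Y e (2 + m) τ ≡ Y e m τ)
                   ⊎ (X e (2 + m) τ ≡ X e m τ × Y e m τ ≡ suc (Y e (2 + m) τ))
    path zero m τ with m≤n⇒m<n∨m≡n (lower m τ)
    ... | inj₂ e = inj₁ (trans (cong (_+ suc (half m)) e) (+-suc _ _) , e)
    ... | inj₁ p = inj₂ (trans (+-suc _ _) (cong (_+ half m) (sym e)) , e)
      where e = ≤-antisym (upper m τ) p
    path (suc e) zero τ rewrite proj₁ (first e τ) | proj₂ (first e τ) = ∸-path (A 0 τ) e
    path (suc e) (suc zero) τ rewrite proj₁ (second e τ) | proj₂ (second e τ) = ∸-path (A 1 τ) e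
    path (suc e) (suc (suc m)) τ = path e m τ

    turn : ℕ → Bool
    turn τ = isOdd (sub τ)

    private
      ∸-steps : ∀ m e τ → A m (suc τ) ∸ e ≡ A m τ ∸ e ⊎ (isOdd m ≡ turn τ × A m (suc τ) ∸ e ≡ suc (A m τ ∸ e))
      ∸-steps m e τ with Slow.step (A-slow m) τ
      ... | inj₁ p rewrite p = inj₁ refl
      ... | inj₂ p with A-hit⁻ {m} {τ} p
      ...   | _ , refl rewrite p with ∸-step (A m τ) e
      ...     | inj₁ q = inj₁ q
      ...     | inj₂ q = inj₂ (refl , q)

    step : ∀ e m τ → X e m (suc τ) ≡ X e m τ ⊎ (isOdd m ≡ turn τ × X e m (suc τ) ≡ suc (X e m τ))
    step zero m τ with Slow.step (A-slow m) τ
    ... | inj₁ p = inj₁ (cong (_+ half m) p)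
    ... | inj₂ p = inj₂ (cong isOdd (sym (proj₂ (A-hit⁻ {m} {τ} p))) , cong (_+ half m) p)
    step (suc e) zero          τ = ∸-steps 0 (suc e) τ
    step (suc e) (suc zero)    τ = ∸-steps 1 (suc e) τ
    step (suc e) (suc (suc m)) τ rewrite isOdd-2+ m = step e m τ

    shifted : ∀ e m τ → X e m τ + e ≡ Y e m τ + half m
    shifted zero    m             τ = +-identityʳ _
    shifted (suc e) zero          τ = trans (∸-+-⊔ (A 0 τ) (suc e)) (sym (+-identityʳ _))
    shifted (suc e) (suc zero)    τ = trans (∸-+-⊔ (A 1 τ) (suc e)) (sym (+-identityʳ _))
    shifted (suc e) (suc (suc m)) τ = trans (+-suc _ e) (trans (cong suc (shifted e m τ)) (sym (+-suc _ (half m))))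

    line : ∀ e i τ → X e i τ + X e (suc i) τ + 2 * e ≡ Y e i τ + Y e (suc i) τ + i
    line e i τ = begin
      X e i τ + X e (suc i) τ + 2 * e                       ≡⟨ spread (X e i τ) _ e ⟩
      (X e i τ + e) + (X e (suc i) τ + e)                   ≡⟨ cong₂ _+_ (shifted e i τ) (shifted e (suc i) τ) ⟩
      (Y e i τ + half i) + (Y e (suc i) τ + half (suc i))   ≡⟨ collect (Y e i τ) (Y e (suc i) τ) (half i) (half (suc i)) ⟩
      Y e i τ + Y e (suc i) τ + (half i + half (suc i))     ≡⟨ cong (Y e i τ + Y e (suc i) τ +_) (half-sum i) ⟩
      Y e i τ + Y e (suc i) τ + i                           ∎
      where
      open ≡-Reasoning
      spread : ∀ a b e → a + b + 2 * e ≡ (a + e) + (b + e)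
      spread = solve-∀
      collect : ∀ a b c d → (a + c) + (b + d) ≡ a + b + (c + d)
      collect = solve-∀

    X-shift : ∀ {e} j k → e ≡ j + k → ∀ m τ → X e (2 * j + m) τ ≡ X k m τ
    X-shift zero    k refl m τ = refl
    X-shift (suc j) k refl m τ rewrite +-suc j (j + 0) = X-shift j k refl m τ

    boundary : ℕ → ℕ → ℕ → ℕ
    boundary e i τ = X e i τ + X e (suc i) τ

    boundary-below : ∀ e i τ → boundary e (2 * e + i) τ ≡ N i τ + i
    boundary-below e i τ = begin
      X e (2 * e + i) τ + X e (suc (2 * e + i)) τ             ≡⟨ cong (λ n → X e (2 * e + i) τ + X e n τ) (+-suc (2 * e) i) ⟨
      X e (2 * e + i) τ + X e (2 * e + suc i) τ               ≡⟨ cong₂ _+_ (X-shift e 0 (sym (+-identityʳ e)) i τ) (X-shift e 0 (sym (+-identityʳ e)) (suc i) τ) ⟩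
      (A i τ + half i) + (A (suc i) τ + half (suc i))         ≡⟨ collect (A i τ) (A (suc i) τ) (half i) (half (suc i)) ⟩
      N i τ + (half i + half (suc i))                         ≡⟨ cong (N i τ +_) (half-sum i) ⟩
      N i τ + i                                               ∎
      where
      open ≡-Reasoning
      collect : ∀ a b c d → (a + c) + (b + d) ≡ a + b + (c + d)
      collect = solve-∀

    boundary-even : ∀ {e} j k → e ≡ j + k → ∀ τ → boundary e (2 * j) τ ≡ (A 0 τ ∸ k) + (A 1 τ ∸ k)
    boundary-even {e} j k p τ = begin
      X e (2 * j) τ + X e (suc (2 * j)) τ ≡⟨ cong₂ (λ m n → X e m τ + X e n τ) (sym (+-identityʳ (2 * j))) (+-comm 1 (2 * j)) ⟩
      X e (2 * j + 0) τ + X e (2 * j + 1) τ ≡⟨ cong₂ _+_ (X-shift j k p 0 τ) (X-shift j k p 1 τ) ⟩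
      X k 0 τ + X k 1 τ                     ≡⟨ cong₂ _+_ (proj₁ (first k τ)) (proj₁ (second k τ)) ⟩
      (A 0 τ ∸ k) + (A 1 τ ∸ k)             ∎
      where open ≡-Reasoning

    boundary-odd : ∀ {e} j k → e ≡ j + suc k → ∀ τ → boundary e (suc (2 * j)) τ ≡ (A 0 τ ∸ k) + (A 1 τ ∸ suc k)
    boundary-odd {e} j k p τ = begin
      X e (suc (2 * j)) τ + X e (2 + 2 * j) τ ≡⟨ cong₂ (λ m n → X e m τ + X e n τ) (+-comm 1 (2 * j)) (+-comm 2 (2 * j)) ⟩
      X e (2 * j + 1) τ + X e (2 * j + 2) τ   ≡⟨ cong₂ _+_ (X-shift j (suc k) p 1 τ) (X-shift j (suc k) p 2 τ) ⟩
      (A 1 τ ∸ suc k) + X k 0 τ               ≡⟨ cong ((A 1 τ ∸ suc k) +_) (proj₁ (first k τ)) ⟩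
      (A 1 τ ∸ suc k) + (A 0 τ ∸ k)           ≡⟨ +-comm (A 1 τ ∸ suc k) _ ⟩
      (A 0 τ ∸ k) + (A 1 τ ∸ suc k)           ∎
      where open ≡-Reasoning

    data Position (e x y i : ℕ) : Set where
      under : ∀ i′ → x ≡ y + i′ → i ≡ 2 * e + i′ → Position e x y i
      evenOver  : ∀ j k → e ≡ j + k → y ≡ x + 2 * k → i ≡ 2 * j → Position e x y i
      oddOver   : ∀ j k → e ≡ j + suc k → y ≡ x + suc (2 * k) → i ≡ suc (2 * j) → Position e x y i

    position : ∀ e {x y i} → x + 2 * e ≡ y + i → Position e x y i
    position e {x} {y} {i} l with offset-of x y
    ... | under i′ refl = under i′ refl (+-cancelˡ-≡ y _ _ (trans (sym l) (rearrange y i′ e)))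
      where
      rearrange : ∀ y i e → y + i + 2 * e ≡ y + (2 * e + i)
      rearrange = solve-∀
    ... | evenOver k refl = evenOver (e ∸ k) k (sym (m∸n+n≡m k≤e)) refl
        (+-cancelˡ-≡ (2 * k) _ _ (trans (sym l′) (trans (cong (2 *_) (sym (m∸n+n≡m k≤e))) (rearrange (e ∸ k) k))))
      where
      l′ : 2 * e ≡ 2 * k + i
      l′ = +-cancelˡ-≡ x _ _ (trans l (+-assoc x (2 * k) i))
      k≤e : k ≤ e
      k≤e = *-cancelˡ-≤ 2 (≤-trans (m≤m+n (2 * k) i) (≤-reflexive (sym l′)))
      rearrange : ∀ j k → 2 * (j + k) ≡ 2 * k + 2 * j
      rearrange = solve-∀
    ... | oddOver k refl = oddOver (e ∸ suc k) k (sym (m∸n+n≡m k<e)) refl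
        (+-cancelˡ-≡ (suc (2 * k)) _ _ (trans (sym l′) (trans (cong (2 *_) (sym (m∸n+n≡m k<e))) (rearrange (e ∸ suc k) k))))
      where
      l′ : 2 * e ≡ suc (2 * k) + i
      l′ = +-cancelˡ-≡ x _ _ (trans l (+-assoc x (suc (2 * k)) i))
      k<e : k < e
      k<e = *-cancelˡ-< 2 k e (≤-trans (s≤s (m≤m+n (2 * k) i)) (≤-reflexive (sym l′)))
      rearrange : ∀ j k → 2 * (j + suc k) ≡ suc (2 * k) + suc (2 * j)
      rearrange = solve-∀

    size : ℕ
    size = D 0 + D 1

    private
      positive⇒<size : ∀ k k′ {x} → k ≤ k′ → x < (D 0 ∸ k) + (D 1 ∸ k′) → k < size
      positive⇒<size k k′ {x} p q = ≰⇒> λ r → contradiction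
        (subst (x <_) (cong₂ _+_ (m≤n⇒m∸n≡0 (≤-trans (m≤m+n (D 0) _) r))
                                 (m≤n⇒m∸n≡0 (≤-trans (m≤n+m (D 1) (D 0)) (≤-trans r p)))) q) λ ()

      final : ∀ {x y i} → x + 2 * size ≡ y + i → (x , y) ∈ᵞ Λ ⇔ x < boundary size i R
      final {x} {y} {i} l with position size {x} {y} {i} l
      ... | under i′ refl refl rewrite boundary-below size i′ R | total i′ | total (suc i′) =
        mk⇔ (+-monoˡ-< i′ ∘ low.to i′ y) (low.from i′ y ∘ +-cancelʳ-< i′ _ _)
      ... | evenOver j k e refl refl rewrite boundary-even j k e R | total 0 | total 1 = upEven k _
      ... | oddOver j k e refl refl rewrite boundary-odd j k e R | total 0 | total 1 = upOdd k _

      initial : ∀ {x y i} → x + 2 * size ≡ y + i → boundary size i 0 ≤ x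
      initial {x} {y} {i} l with position size {x} {y} {i} l
      ... | under i′ refl refl rewrite boundary-below size i′ 0 = m≤n+m i′ y
      ... | evenOver j k e refl refl rewrite boundary-even j k e 0 | 0∸n≡0 k = z≤n
      ... | oddOver j k e refl refl rewrite boundary-odd j k e 0 | 0∸n≡0 k = z≤n

      inside : ∀ {x y} → (x , y) ∈ᵞ Λ → y ≤ x + 2 * size
      inside {x} {y} c∈ with offset-of x y
      ... | under i refl = ≤-trans (m≤m+n y i) (m≤m+n (y + i) _)
      ... | evenOver k refl = +-monoʳ-≤ x (*-monoʳ-≤ 2 (<⇒≤ (positive⇒<size k k ≤-refl (Equivalence.to (upEven k x) c∈))))
      ... | oddOver k refl = +-monoʳ-≤ x (*-monoʳ-< 2 (positive⇒<size k (suc k) (n≤1+n k) (Equivalence.to (upOdd k x) c∈)))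

    chain : Chain Λ
    chain = record
      { E       = 2 * size
      ; R       = R
      ; X       = X size
      ; Y       = Y size
      ; turn    = turn
      ; path    = path size
      ; step    = step size
      ; still   = λ τ → trans (empty (suc τ)) (sym (empty τ))
      ; line    = line size
      ; inside  = inside
      ; initial = initial
      ; final   = final
      }
      where
      empty : ∀ τ → X size 0 τ ≡ 0
      empty τ = trans (proj₁ (first size τ)) (m≤n⇒m∸n≡0 (≤-trans (bounded 0 τ) (m≤m+n (D 0) _)))

-- The shifted domino tableau of a code

module _ {Λ P} (Q : Quotient Λ P) where
  open Quotient Q
  open Codes Q

  module ToTableau (c : Code) where
    open Code c
    private module Ext = Extension Q c
    open Ext using (size; first; second; path; X-shift)
    open ChainPaving Ext.chain

    private
      E : ℕ
      E = 2 * size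

      X : ℕ → ℕ → ℕ
      X = Ext.X size

    moves-low : ∀ {m τ} → Moves (E + m) τ → S τ × sub τ ≡ m
    moves-low {m} {τ} p = A-hit⁻ (+-cancelʳ-≡ (half m) _ _
      (trans (sym (shift (suc τ))) (trans p (cong suc (shift τ)))))
      where
      shift : ∀ τ → X (E + m) τ ≡ A m τ + half m
      shift = X-shift size 0 (sym (+-identityʳ size)) m

    low-moves : ∀ {τ} → S τ → Moves (E + sub τ) τ × τ < R
    low-moves {τ} s = trans (shift (suc τ)) (trans (cong (_+ half m) hit) (cong suc (sym (shift τ)))) ,
      ≰⇒> λ R≤τ → <⇒≱ (≤-trans (≤-reflexive (sym hit)) (bounded m (suc τ)))
        (≤-trans (≤-reflexive (sym (total m))) (Slow.mono (A-slow m) R≤τ))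
      where
      m = sub τ
      hit = A-hit {m} s refl
      shift : ∀ τ → X (E + m) τ ≡ A m τ + half m
      shift = X-shift size 0 (sym (+-identityʳ size)) m

    Low : Cell → Set
    Low c = c ∈ᵞ Λ × ¬ Up′ (tile c)

    index-low : ∀ {c} → Low c → S (time c) × index-of c ≡ E + sub (time c)
    index-low {c} (c∈ , ¬up) with index-moves c∈
    ... | moves , _ with E ≤? index-of c
    ...   | no ¬p = contradiction (domino-up moves (≰⇒> ¬p)) ¬up
    ...   | yes p with moves-low (subst (λ m → Moves m (time c)) (sym (m+[n∸m]≡n p)) moves)
    ...     | s , e = s , trans (sym (m+[n∸m]≡n p)) (cong (E +_) (sym e))

    isLow : ∀ {a b} → (a , b) ∈ᵞ Λ → b ≤ a → Low (a , b)
    isLow c∈ p = c∈ , λ u → <⇒≱ (up′-above u (covers c∈)) p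

    label : Domino → Letter
    label d = letter (time (corner d))

    corner∈ : ∀ d → corner d ∈ᵈ d
    corner∈ (horizontal _) = here refl
    corner∈ (vertical _)   = here refl

    label-tile : ∀ {c} → c ∈ᵞ Λ → label (tile c) ≡ letter (time c)
    label-tile {c} c∈ = cong letter (proj₁ (proj₂ (along c∈ (corner∈ (tile c)))))

    tile-of-time : ∀ {c c′} → Low c → Low c′ → time c ≡ time c′ → tile c ≡ tile c′
    tile-of-time l l′ e = cong₂ domino
      (trans (proj₂ (index-low l)) (trans (cong (λ τ → E + sub τ) e) (sym (proj₂ (index-low l′))))) e

    sub-bounds : ∀ {c} → Low c → lineOf c ≤ E + sub (time c) × E + sub (time c) ≤ suc (lineOf c)
    sub-bounds {c} l with proj₂ (index-moves (proj₁ l))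
    ... | inj₁ e = ≤-reflexive eq , ≤-trans (≤-reflexive (sym eq)) (n≤1+n _)
      where eq = trans (sym e) (proj₂ (index-low l))
    ... | inj₂ e = ≤-trans (n≤1+n _) (≤-reflexive eq) , ≤-reflexive (sym eq)
      where eq = trans (sym e) (proj₂ (index-low l))

    private
      letters : ∀ {c c′} → c ∈ᵞ Λ → c′ ∈ᵞ Λ → label (tile c) ≡ label (tile c′) → letter (time c) ≡ letter (time c′)
      letters c∈ c′∈ e = trans (sym (label-tile c∈)) (trans e (label-tile c′∈))

      -- Times do not decrease up the column, so with one unprimed letter `sub` does not decrease.
      -- But the line index strictly falls, and `sub-bounds` then leaves `sub` no room to rise.
      -- Equal letter and equal `sub` mean equal time, hence one domino. `row` is the dual.
      column : ∀ {a b b′} → Low (a , b) → Low (a , b′) → b < b′ → Unprimed (label (tile (a , b))) →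
               label (tile (a , b)) ≡ label (tile (a , b′)) → tile (a , b) ≡ tile (a , b′)
      column {a} {b} {b′} l l′ p u e = tile-of-time l l′ (key-injective e′ (≤-antisym
          (sub-mono (time-column (proj₁ l′) (<⇒≤ p)) e′ (subst Unprimed (label-tile (proj₁ l)) u))
          (+-cancelˡ-≤ E _ _ (≤-trans (proj₂ (sub-bounds l′)) (≤-trans line< (proj₁ (sub-bounds l)))))))
        where
        e′ = letters (proj₁ l) (proj₁ l′) e
        line< : suc (lineOf (a , b′)) ≤ lineOf (a , b)
        line< = ∸-monoʳ-< p (Chain.inside Ext.chain (proj₁ l′))

      row : ∀ {a a′ b} → Low (a , b) → Low (a′ , b) → a < a′ → Primed (label (tile (a , b))) →
            label (tile (a , b)) ≡ label (tile (a′ , b)) → tile (a , b) ≡ tile (a′ , b)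
      row {a} {a′} {b} l l′ p u e = tile-of-time l l′ (key-injective e′ (≤-antisym
          (+-cancelˡ-≤ E _ _ (≤-trans (proj₂ (sub-bounds l)) (≤-trans line< (proj₁ (sub-bounds l′)))))
          (sub-antimono (time-row (proj₁ l′) (<⇒≤ p)) e′ (subst Primed (label-tile (proj₁ l)) u))))
        where
        e′ = letters (proj₁ l) (proj₁ l′) e
        line< : suc (lineOf (a , b)) ≤ lineOf (a′ , b)
        line< = ∸-monoˡ-< (+-monoˡ-< E p) (Chain.inside Ext.chain (proj₁ l))

    isTableau : IsTableau Low tile label
    isTableau = record
      { rows    = λ l l′ p → subst₂ _≤ᴸ_ (sym (label-tile (proj₁ l))) (sym (label-tile (proj₁ l′)))
                    (letter-mono (time-row (proj₁ l′) p))
      ; columns = λ l l′ p → subst₂ _≤ᴸ_ (sym (label-tile (proj₁ l))) (sym (label-tile (proj₁ l′)))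
                    (letter-mono (time-column (proj₁ l′) p))
      ; unprimedOncePerColumn = λ {a} {b} {b′} l l′ u e → case <-cmp b b′ of λ where
          (tri< p _ _)    → column l l′ p u e
          (tri≈ _ refl _) → refl
          (tri> _ _ p)    → sym (column l′ l p (subst Unprimed e u) (sym e))
      ; primedOncePerRow = λ {a} {a′} {b} l l′ u e → case <-cmp a a′ of λ where
          (tri< p _ _)    → row l l′ p u e
          (tri≈ _ refl _) → refl
          (tri> _ _ p)    → sym (row l′ l p (subst Primed e u) (sym e))
      }

    level-tile : ∀ {c} → Low c → level (tile c) ≡ sub (time c)
    level-tile {c} l with index-low l | index-moves (proj₁ l)
    ... | _ , e | moves , _ = trans (cong (λ m → level (domino m (time c))) e)
                                    (level-domino (subst (λ m → Moves m (time c)) e moves))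

    dominoKey-tile : ∀ {c} → Low c → key (label (tile c)) (level (tile c)) ≡ time c
    dominoKey-tile {c} l = trans (cong₂ key (label-tile (proj₁ l)) (level-tile l)) (key-letter-sub (time c))

    private
      -- A domino of index `E`, that is of level 0, is vertical when `X` takes the same value at the
      -- indices `E - 1` and `E + 1`. These values are `A 1 τ ∸ 1` and `A 1 τ`, so it is vertical
      -- exactly when `A 1 τ` is 0.
      beside : ∀ {m τ} → suc m ≡ E → X (2 + m) τ ≡ A 1 τ × X m τ ≡ A 1 τ ∸ 1
      beside {m} {τ} e = trans (cong (λ n → X n τ) (trans (cong suc e) (+-comm 1 E)))
                           (trans (X-shift size 0 (sym (+-identityʳ size)) 1 τ) (+-identityʳ (A 1 τ)))
                       , before size refl
        where
        before : ∀ s → size ≡ s → X m τ ≡ A 1 τ ∸ 1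
        before zero    p = contradiction (trans e (cong (2 *_) p)) λ ()
        before (suc s) p = trans (cong (λ n → X n τ) (suc-injective (trans e (trans (cong (2 *_) p) (double s)))))
                                 (X-shift s 1 (trans p (+-comm 1 s)) 1 τ)
          where
          double : ∀ s → 2 * suc s ≡ suc (2 * s + 1)
          double = solve-∀

    vertical⇒no-A1 : ∀ {m τ} → m ≡ E → Moves m τ → ∀ {c} → domino m τ ≡ vertical c → A 1 τ ≡ 0
    vertical⇒no-A1 {zero}  {τ} e moves v = contradiction (trans (sym moves) (Chain.still Ext.chain τ)) 1+n≢n
    vertical⇒no-A1 {suc m} {τ} e moves v with path size m τ
    ... | inj₁ _ = case v of λ ()
    ... | inj₂ (x≡ , _) with A 1 τ | beside {m} {τ} e
    ...   | zero  | _ = refl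
    ...   | suc n | p , q = contradiction (trans (sym p) (trans x≡ q)) 1+n≢n

    no-A1⇒vertical : ∀ {m τ} → m ≡ E → Moves m τ → A 1 τ ≡ 0 → domino m τ ≡ vertical (point m τ)
    no-A1⇒vertical {zero}  {τ} e moves z = contradiction (trans (sym moves) (Chain.still Ext.chain τ)) 1+n≢n
    no-A1⇒vertical {suc m} {τ} e moves z with path size m τ
    ... | inj₂ _ = refl
    ... | inj₁ (x≡ , _) = contradiction (trans (sym x≡) (trans (proj₁ (beside {m} {τ} e)) z)) λ ()

    line-diagonal : ∀ a → lineOf (a , a) ≡ E
    line-diagonal a = m+n∸m≡n a E

    -- `A 1` is still 0 when the later diagonal cell is added, hence also just after the earlier
    -- one. So the domino of the earlier cell does not have level 1; it has level 0 and is vertical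
    -- for the same reason.
    vertical-left : ∀ {a} → (suc a , suc a) ∈ᵞ Λ → tile (suc a , suc a) ≡ vertical (suc a , suc a) →
                    tile (a , a) ≡ vertical (a , a)
    vertical-left {a} c∈ v = trans (no-A1⇒vertical index≡′ moves′ no-A1′)
        (cong vertical (trans (cong (λ i → point i τ′) (trans index≡′ (sym (line-diagonal a)))) (point-time c∈′)))
      where
      τ  = time (suc a , suc a)
      τ′ = time (a , a)
      c∈′ : (a , a) ∈ᵞ Λ
      c∈′ = <⇒≤ (below∈ c∈)
      l  = isLow c∈ ≤-refl
      l′ = isLow c∈′ ≤-refl
      sub≡0 : sub τ ≡ 0
      sub≡0 = trans (sym (level-tile l)) (trans (cong level v) (n∸n≡0 a))
      index≡ : index-of (suc a , suc a) ≡ E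
      index≡ = trans (proj₂ (index-low l)) (trans (cong (E +_) sub≡0) (+-identityʳ E))
      no-A1 : A 1 τ ≡ 0
      no-A1 = vertical⇒no-A1 index≡ (proj₁ (index-moves c∈)) v
      τ′<τ : τ′ < τ
      τ′<τ = at-above (x-slow E) (subst (λ i → At (x i) τ′ a) (line-diagonal a) (proj₁ (time-at c∈′)))
        (≤-reflexive (sym (proj₁ (subst (λ i → At (x i) τ (suc a)) (line-diagonal (suc a)) (proj₁ (time-at c∈))))))
      no-A1-next : A 1 (suc τ′) ≡ 0
      no-A1-next = n≤0⇒n≡0 (≤-trans (Slow.mono (A-slow 1) τ′<τ) (≤-reflexive no-A1))
      no-A1′ : A 1 τ′ ≡ 0
      no-A1′ = n≤0⇒n≡0 (≤-trans (Slow.suc-mono (A-slow 1) τ′) (≤-reflexive no-A1-next))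
      sub≢1 : ¬ sub τ′ ≡ 1
      sub≢1 e = contradiction (trans (sym no-A1-next) (A-hit {1} (proj₁ (index-low l′)) e)) λ ()
      sub≡0′ : sub τ′ ≡ 0
      sub≡0′ = n<1⇒n≡0 (≤∧≢⇒< (+-cancelˡ-≤ E _ _ (≤-trans (proj₂ (sub-bounds l′))
        (≤-reflexive (trans (cong suc (line-diagonal a)) (+-comm 1 E))))) sub≢1)
      index≡′ : index-of (a , a) ≡ E
      index≡′ = trans (proj₂ (index-low l′)) (trans (cong (E +_) sub≡0′) (+-identityʳ E))
      moves′ = proj₁ (index-moves c∈′)

    -- A vertical domino with corner on `D₀` either touches the left border or has the lower domino
    -- provided by `vertical-left` on its left.
    no-left : ∀ a → (a , a) ∈ᵞ Λ → tile (a , a) ≡ vertical (a , a) →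
              ∃[ d ] d ∈ᵖ paving × LeftAdjacent d (vertical (a , a)) →
              ¬ (∀ d → d ∈ᵖ paving → LeftAdjacent d (vertical (a , a)) → Up′ d)
    no-left zero    _  _ (_ , _ , _ , _ , _ , here ())
    no-left zero    _  _ (_ , _ , _ , _ , _ , there (here ()))
    no-left (suc a) c∈ v _ all-up = <-irrefl refl (up′-vertical⁻ (all-up (vertical (a , a))
        ((a , a) , l∈ , vertical-left c∈ v) (a , suc a , there (here refl) , here refl)))
      where
      l∈ : (a , a) ∈ᵞ Λ
      l∈ = <⇒≤ (below∈ c∈)

    admissible : IsAdmissible paving
    admissible (a , b) (c′ , c′∈ , e) cut (exists , all-up) = check cut
      where
      module P = Paving paving
      c∈ : (a , b) ∈ᵞ Λ
      c∈ = P.inside c′∈ (subst ((a , b) ∈ᵈ_) (sym e) (here refl))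
      v : tile (a , b) ≡ vertical (a , b)
      v = trans (P.consistent c′∈ (subst ((a , b) ∈ᵈ_) (sym e) (here refl))) e
      check : CutBy 0ℤ (vertical (a , b)) → ⊥
      check (here z) with content≡0⁻ {a} {b} z
      ... | refl = no-left a c∈ v exists all-up
      -- Now the top cell is the one on `D₀`; the left neighbour of the corner is then `(b , b)`,
      -- whose domino cannot be upper.
      check (there (here z)) with content≡0⁻ {a} {suc b} z
      ... | refl = <-irrefl refl (up′-above (all-up _ (_ , l∈ , refl) (b , b , P.covers l∈ , here refl)) (P.covers l∈))
        where
        l∈ : (b , b) ∈ᵞ Λ
        l∈ = <⇒≤ c∈

    tableau : ShiftedDominoTableau Λ
    tableau = record { paving = paving ; admissible = admissible ; label = label ; isTableau = isTableau }

    noPrimed : ShiftedDominoTableau.NoPrimedOnD₀ tableau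
    noPrimed d (c′ , c′∈ , refl) cut with find cut
    ... | (a , b) , p , e with content≡0⁻ {a} {b} e
    ...   | refl with along c′∈ p
    ...     | c∈ , t , _ = subst Unprimed
      (trans (cong letter t) (sym (label-tile c′∈)))
      (onD₀ (proj₁ (index-low l)) (+-cancelˡ-≤ E _ _ (≤-trans (proj₂ (sub-bounds l))
        (≤-reflexive (trans (cong suc (line-diagonal a)) (+-comm 1 E))))))
      where
      l : Low (a , a)
      l = isLow c∈ ≤-refl

    code-tableau : ∀ τ → FromTableau.S Q tableau τ ⇔ S τ
    code-tableau τ = mk⇔ to from
      where
      to : FromTableau.S Q tableau τ → S τ
      to (c , l , e) = subst S (trans (sym (dominoKey-tile {c} l)) e) (proj₁ (index-low {c} l))
      from : S τ → FromTableau.S Q tableau τ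
      from s = cell , l , trans (dominoKey-tile {cell} l) (proj₁ (proj₂ place))
        where
        moves : Moves (E + sub τ) τ
        moves = proj₁ (low-moves s)
        cell : Cell
        cell = point (E + sub τ) τ
        place : cell ∈ᵞ Λ × time cell ≡ τ × index-of cell ≡ E + sub τ
        place = located moves (inj₁ refl) (proj₂ (low-moves s))
        l : Low cell
        l = proj₁ place , subst (¬_ ∘ Up′) (cong₂ domino (sym (proj₂ (proj₂ place))) (sym (proj₁ (proj₂ place))))
                               (domino-low moves (m≤m+n E (sub τ)))

-- Weights

-- Dominoes and cells are counted through their keys. Weights can then be compared as sizes of sets
-- of numbers, without matching the lists of dominoes and cells.
record HasSize (P : ℕ → Set) (n : ℕ) : Set where
  field
    elements : List ℕ
    unique   : Unique elements
    ∈⇔       : ∀ τ → τ ∈ elements ⇔ P τ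
    size≡    : length elements ≡ n

size-unique : ∀ {P P′ n n′} → HasSize P n → HasSize P′ n′ → (∀ τ → P τ ⇔ P′ τ) → n ≡ n′
size-unique s s′ h = trans (sym (size≡ s)) (trans (↭-length (∼bag⇒↭ (unique∧set⇒bag (unique s) (unique s′) same))) (size≡ s′))
  where
  open HasSize
  same : ∀ {τ} → τ ∈ elements s ⇔ τ ∈ elements s′
  same {τ} = mk⇔ (Equivalence.from (∈⇔ s′ τ) ∘ Equivalence.to (h τ) ∘ Equivalence.to (∈⇔ s τ))
                 (Equivalence.from (∈⇔ s τ) ∘ Equivalence.from (h τ) ∘ Equivalence.to (∈⇔ s′ τ))

size-⊎ : ∀ {P P′ n n′} → HasSize P n → HasSize P′ n′ → (∀ {τ} → P τ → P′ τ → ⊥) → HasSize (λ τ → P τ ⊎ P′ τ) (n + n′)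
size-⊎ s s′ disjoint = record
  { elements = elements s ++ elements s′
  ; unique   = Unique.++⁺ (unique s) (unique s′)
      (λ (p , p′) → disjoint (Equivalence.to (∈⇔ s _) p) (Equivalence.to (∈⇔ s′ _) p′))
  ; ∈⇔       = λ τ → mk⇔
      (λ p → case ∈-++⁻ (elements s) p of λ where
        (inj₁ q) → inj₁ (Equivalence.to (∈⇔ s τ) q)
        (inj₂ q) → inj₂ (Equivalence.to (∈⇔ s′ τ) q))
      (λ where
        (inj₁ q) → ∈-++⁺ˡ (Equivalence.from (∈⇔ s τ) q)
        (inj₂ q) → ∈-++⁺ʳ (elements s) (Equivalence.from (∈⇔ s′ τ) q))
  ; size≡    = trans (length-++ (elements s)) (cong₂ _+_ (size≡ s) (size≡ s′))
  }
  where open HasSize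

unique-map-∈ : ∀ {A : Set} (k : A → ℕ) {xs} → Unique xs →
               (∀ {x y} → x ∈ xs → y ∈ xs → k x ≡ k y → x ≡ y) → Unique (map k xs)
unique-map-∈ k []       inj = []
unique-map-∈ k (p ∷ ps) inj =
  All.map⁺ (All.tabulate λ y∈ e → All.lookup p y∈ (inj (here refl) (there y∈) e)) ∷
  unique-map-∈ k ps (λ x∈ y∈ → inj (there x∈) (there y∈))

image-size : ∀ {A : Set} {C : A → Set} (C? : ∀ a → Dec (C a)) (k : A → ℕ) {xs} → Unique xs →
             (∀ {x y} → x ∈ xs → C x → y ∈ xs → C y → k x ≡ k y → x ≡ y) →
             HasSize (λ τ → ∃[ x ] x ∈ xs × C x × k x ≡ τ) (length (filter C? xs))
image-size C? k {xs} u inj = record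
  { elements = map k (filter C? xs)
  ; unique   = unique-map-∈ k (Unique.filter⁺ C? u) λ x∈ y∈ →
      inj (proj₁ (∈-filter⁻ C? x∈)) (proj₂ (∈-filter⁻ C? {xs = xs} x∈))
          (proj₁ (∈-filter⁻ C? y∈)) (proj₂ (∈-filter⁻ C? {xs = xs} y∈))
  ; ∈⇔       = λ τ → mk⇔
      (λ p → let x , x∈ , e = ∈-map⁻ k p in x , proj₁ (∈-filter⁻ C? x∈) , proj₂ (∈-filter⁻ C? {xs = xs} x∈) , sym e)
      (λ { (x , x∈ , c , refl) → ∈-map⁺ k (∈-filter⁺ C? x∈ c) })
  ; size≡    = length-map k (filter C? xs)
  }

cells-unique : ∀ Λ → Unique (cells Λ)
cells-unique Λ = Unique.concat⁺
  (All.map⁺ (All.tabulate λ {y} _ → Unique.map⁺ (cong proj₁) (Unique.upTo⁺ (rowLength Λ y))))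
  (AllPairs.map⁺ (AllPairs.map (λ { y≢y′ (p , p′) → y≢y′ (same-row p p′) }) (Unique.upTo⁺ (length Λ))))
  where
  same-row : ∀ {c y y′} → c ∈ map (_, y) (upTo (rowLength Λ y)) → c ∈ map (_, y′) (upTo (rowLength Λ y′)) → y ≡ y′
  same-row {y = y} {y′} p p′ with ∈-map⁻ (_, y) p | ∈-map⁻ (_, y′) p′
  ... | _ , _ , refl | _ , _ , refl = refl

module _ {Λ P} (Q : Quotient Λ P) where
  open Quotient Q
  open Codes Q

  tableaux : Setoid _ _
  tableaux = WeightedFamily.objects (dominoTableaux Λ)

  private
    _⟫_ : ∀ {A B C : Set} → A ⇔ B → B ⇔ C → A ⇔ C
    f ⟫ g = mk⇔ (Equivalence.to g ∘ Equivalence.to f) (Equivalence.from f ∘ Equivalence.from g)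

    inv : ∀ {A B : Set} → A ⇔ B → B ⇔ A
    inv f = mk⇔ (Equivalence.from f) (Equivalence.to f)

    sameLowerPart-sym : ∀ {T U : ShiftedDominoTableau Λ} → SameLowerPart T U → SameLowerPart U T
    sameLowerPart-sym h = record
      { lowDominoes = λ d → inv (SameLowerPart.lowDominoes h d)
      ; labels      = λ d l → sym (SameLowerPart.labels h d (Equivalence.from (SameLowerPart.lowDominoes h d) l))
      }

    same⇒code : ∀ (T U : ShiftedDominoTableau Λ) → SameLowerPart T U → ∀ τ → FromTableau.S Q T τ ⇔ FromTableau.S Q U τ
    same⇒code T U h τ = mk⇔ (code-of-same Q {T} {U} h τ) (code-of-same Q {U} {T} (sameLowerPart-sym h) τ)

  tableaux↔codes : Inverse tableaux codes
  tableaux↔codes = record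
    { to        = λ (T , noPrimed) → FromTableau.code Q T noPrimed
    ; from      = λ c → ToTableau.tableau Q c , ToTableau.noPrimed Q c
    ; to-cong   = λ {T} {U} → same⇒code (proj₁ T) (proj₁ U)
    ; from-cong = λ {c} {c′} h → same-code Q (ToTableau.tableau Q c) (ToTableau.tableau Q c′) λ τ →
        ToTableau.code-tableau Q c τ ⟫ (h τ ⟫ inv (ToTableau.code-tableau Q c′ τ))
    ; inverse   =
        (λ {c} {T} h τ → same⇒code (proj₁ T) (ToTableau.tableau Q c) h τ ⟫ ToTableau.code-tableau Q c τ)
      , (λ {T} {c} h → same-code Q (ToTableau.tableau Q c) (proj₁ T) λ τ → ToTableau.code-tableau Q c τ ⟫ h τ)
    }

  module _ (T : ShiftedDominoTableau Λ) where
    open ShiftedDominoTableau T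
    open Coded Q T
    open FromTableau Q T using (S; enumeration; d)

    private
      -- Equal keys give equal levels, so both dominoes have a cell on one common diagonal; there
      -- the counter `N` at the key is the position of the cell.
      low-tile : ∀ {c c′} → (c ∈ᵞ Λ × ¬ Up′ (tile c)) → (c′ ∈ᵞ Λ × ¬ Up′ (tile c′)) →
                 dominoKey (tile c) ≡ dominoKey (tile c′) → tile c ≡ tile c′
      low-tile {c} {c′} l l′ e
        with reach l (level (tile c)) (inj₁ refl)
           | reach l′ (level (tile c)) (inj₁ (sym (trans (sym (sub-tile l)) (trans (cong sub e) (sub-tile l′)))))
      ... | j , j∈ , t | j′ , j′∈ , t′ = trans (sym t) (trans (cong (λ j → tile (j + i , j)) j≡j′) t′)
        where
        i = level (tile c)
        key≡ : cellKey (j + i) j ≡ cellKey (j′ + i) j′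
        key≡ = trans (cong dominoKey t) (trans e (cong dominoKey (sym t′)))
        isAt : ∀ {j} → (j + i , j) ∈ᵞ Λ → Count.N (suc bound) (FromTableau.S? Q T) i (cellKey (j + i) j) ≡ j
        isAt {j} p = proj₁ (Enumerates.isAt (enumeration i) (low.to i j p))
        j≡j′ : j ≡ j′
        j≡j′ = trans (sym (isAt j∈)) (trans (cong (Count.N (suc bound) (FromTableau.S? Q T) i) key≡) (isAt j′∈))

      corner∈ : ∀ d → corner d ∈ᵈ d
      corner∈ (horizontal _) = here refl
      corner∈ (vertical _)   = here refl

    tableau-weight : ∀ i → HasSize (λ τ → S τ × index (letter τ) ≡ i) (weight i)
    tableau-weight i = record
      { elements = elements image ; unique = unique image ; size≡ = size≡ image
      ; ∈⇔ = λ τ → ∈⇔ image τ ⟫ mk⇔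
          (λ { (c , c∈ , (_ , ¬up , e) , refl) → let l = ∈-cells⁻ Λ c∈ , ¬up in (c , l , refl) , trans (cong index (letter-tile l)) e })
          (λ { ((c , l , refl) , e) → let t = consistent (proj₁ l) (corner∈ (tile c)) in
            corner (tile c) , ∈-cells⁺ Λ (inside (proj₁ l) (corner∈ (tile c)))
            , (cong corner t , subst (¬_ ∘ Up′) (sym t) (proj₂ l)
              , trans (cong (index ∘ label) t) (trans (cong index (sym (letter-tile l))) e))
            , cong dominoKey t })
      }
      where
      open HasSize
      image = image-size (λ c → (corner (tile c) ≟ᶜ c) ×-dec ¬? (Up′? (tile c)) ×-dec (index (label (tile c)) ≟ i))
        (dominoKey ∘ tile) (cells-unique Λ)
        λ { x∈ (e , ¬up , _) y∈ (e′ , ¬up′ , _) k≡ → trans (sym e)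
          (trans (cong corner (low-tile (∈-cells⁻ Λ x∈ , ¬up) (∈-cells⁻ Λ y∈ , ¬up′) k≡)) e′) }

  module _ (u : ∀ ε → WeightedFamily.Carrier (youngTableaux (P ε))) where
    open FromPair Q u

    filling-weight : ∀ ε i → HasSize (λ τ → (S τ × isOdd (sub τ) ≡ ε) × index (letter τ) ≡ i) (fillWeight (P ε) (fill ε) i)
    filling-weight ε i = record
      { elements = elements image ; unique = unique image ; size≡ = size≡ image
      ; ∈⇔ = λ τ → ∈⇔ image τ ⟫ mk⇔ to from
      }
      where
      open HasSize
      m : Cell → ℕ
      m (x , y) = subdiagonal ε (x ∸ y)
      cellKey : Cell → ℕ
      cellKey c = key (fill ε c) (m c)
      cell-G : ∀ {c} → c ∈ lowCells (P ε) → proj₂ c < D (m c) × cellKey c ≡ G (m c) (proj₂ c) × c ≡ (proj₂ c + half (m c) , proj₂ c)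
      cell-G {x , y} c∈ with ∈-lowCells⁻ (P ε) c∈
      ... | p , ¬up = part.to ε (x ∸ y) y (subst (λ z → (z , y) ∈ᵞ P ε) (sym (m+[n∸m]≡n y≤x)) p)
                    , cong (λ a → key a (m (x , y))) (cong₂ fill (sym (isOdd-subdiagonal ε (x ∸ y))) c≡) , c≡
        where
        y≤x = ≮⇒≥ λ q → ¬up (up⁺ q)
        c≡ : (x , y) ≡ (y + half (m (x , y)) , y)
        c≡ = cong (_, y) (sym (trans (cong (y +_) (half-subdiagonal ε (x ∸ y))) (m+[n∸m]≡n y≤x)))
      injective : ∀ {c c′} → c ∈ lowCells (P ε) → c′ ∈ lowCells (P ε) → cellKey c ≡ cellKey c′ → c ≡ c′
      injective {c} {c′} c∈ c′∈ e with cell-G c∈ | cell-G c′∈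
      ... | p , g , c≡ | p′ , g′ , c′≡ = trans c≡ (trans (cong₂ (λ m y → (y + half m , y)) m≡ y≡) (sym c′≡))
        where
        G≡ : G (m c) (proj₂ c) ≡ G (m c′) (proj₂ c′)
        G≡ = trans (sym g) (trans e g′)
        m≡ : m c ≡ m c′
        m≡ = trans (sym (sub-G p)) (trans (cong sub G≡) (sub-G p′))
        isAt : ∀ {m j} → j < D m → Count.A (suc bound) S? m (G m j) ≡ j
        isAt {m} q = proj₁ (Enumerates.isAt (enumeration m) q)
        y≡ : proj₂ c ≡ proj₂ c′
        y≡ = trans (sym (isAt p)) (trans (cong₂ (Count.A (suc bound) S?) m≡ G≡) (isAt p′))
      image : HasSize (λ τ → ∃[ c ] c ∈ lowCells (P ε) × index (fill ε c) ≡ i × cellKey c ≡ τ) (fillWeight (P ε) (fill ε) i)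
      image = image-size (λ c → index (fill ε c) ≟ i) cellKey (Unique.filter⁺ _ (cells-unique (P ε)))
        λ c∈ _ c′∈ _ → injective c∈ c′∈
      to : ∀ {τ} → ∃[ c ] c ∈ lowCells (P ε) × index (fill ε c) ≡ i × cellKey c ≡ τ →
           (S τ × isOdd (sub τ) ≡ ε) × index (letter τ) ≡ i
      to (c , c∈ , e , refl) with cell-G c∈
      ... | p , g , _ = (subst S (sym g) (S-G p) , trans (cong isOdd (sub-key (fill ε c) (D⇒<B p))) (isOdd-subdiagonal ε _))
                      , trans (cong index (letter-key (fill ε c) (D⇒<B p))) e
      from : ∀ {τ} → (S τ × isOdd (sub τ) ≡ ε) × index (letter τ) ≡ i →
             ∃[ c ] c ∈ lowCells (P ε) × index (fill ε c) ≡ i × cellKey c ≡ τ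
      from {τ} (((j , p , e) , refl) , e′) = c , ∈-lowCells⁺ (P ε) (lowCell p)
        , trans (cong index (sym (letter-G p))) (trans (cong (index ∘ letter) e) e′)
        , trans (cong (key (fill ε c)) (trans (cong (subdiagonal ε) (m+n∸m≡n j (half (sub τ)))) (subdiagonal-half (sub τ)))) e
        where
        c : Cell
        c = (j + half (sub τ) , j)

  weight-sum : ∀ T u → (∀ τ → FromTableau.S Q T τ ⇔ FromPair.S Q u τ) → ∀ i →
               ShiftedDominoTableau.weight T i ≡
               fillWeight (P false) (FromPair.fill Q u false) i + fillWeight (P true) (FromPair.fill Q u true) i
  weight-sum T u h i = size-unique (tableau-weight T i)
    (size-⊎ (filling-weight u false i) (filling-weight u true i) λ (( _ , e) , _) ((_ , e′) , _) → case trans (sym e) e′ of λ ())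
    λ τ → mk⇔ (λ (s , e) → split (Equivalence.to (h τ) s) e) λ where
      (inj₁ ((s , _) , e)) → Equivalence.from (h τ) s , e
      (inj₂ ((s , _) , e)) → Equivalence.from (h τ) s , e
    where
    split : ∀ {τ} → FromPair.S Q u τ → index (letter τ) ≡ i →
            ((FromPair.S Q u τ × isOdd (sub τ) ≡ false) × index (letter τ) ≡ i)
            ⊎ ((FromPair.S Q u τ × isOdd (sub τ) ≡ true) × index (letter τ) ≡ i)
    split {τ} s e with isOdd (sub τ)
    ... | false = inj₁ ((s , refl) , e)
    ... | true  = inj₂ ((s , refl) , e)

  tableaux↔pairs : Inverse tableaux (pairs Q)
  tableaux↔pairs = Composition.inverse tableaux↔codes (codes↔pairs Q)

  tableaux↔pairs-weight : ∀ T i → let t , u = Inverse.to tableaux↔pairs T in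
    WeightedFamily.weight (dominoTableaux Λ) T i ≡
    WeightedFamily.weight (youngTableaux (P false)) t i + WeightedFamily.weight (youngTableaux (P true)) u i
  tableaux↔pairs-weight (T , noPrimed) = weight-sum T (ToPair.pair Q c) λ τ → inv (code-pair Q c τ)
    where c = FromTableau.code Q T noPrimed

-- The numbers λᵢ + ℓ - i

Decreasing : List ℕ → Set
Decreasing = AllPairs _>_

atLeast : ℕ → List ℕ → ℕ
atLeast p []       = 0
atLeast p (h ∷ hs) = tick (p ≤? h) (atLeast p hs)

atLeast-none : ∀ {p hs} → All (_< p) hs → atLeast p hs ≡ 0
atLeast-none []       = refl
atLeast-none {p} {h ∷ hs} (q ∷ qs) = trans (tick-no (p ≤? h) (<⇒≱ q) _) (atLeast-none qs)

atLeast-≤length : ∀ p hs → atLeast p hs ≤ length hs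
atLeast-≤length p []       = z≤n
atLeast-≤length p (h ∷ hs) with p ≤? h
... | yes _ = s≤s (atLeast-≤length p hs)
... | no  _ = m≤n⇒m≤1+n (atLeast-≤length p hs)

atLeast-suc-≤ : ∀ p hs → atLeast (suc p) hs ≤ atLeast p hs
atLeast-suc-≤ p []       = z≤n
atLeast-suc-≤ p (h ∷ hs) with suc p ≤? h | p ≤? h
... | yes _ | yes _ = s≤s (atLeast-suc-≤ p hs)
... | yes q | no ¬q = contradiction (<⇒≤ q) ¬q
... | no  _ | yes _ = m≤n⇒m≤1+n (atLeast-suc-≤ p hs)
... | no  _ | no  _ = atLeast-suc-≤ p hs

atLeast-≤suc : ∀ p {hs} → Decreasing hs → atLeast p hs ≤ suc (atLeast (suc p) hs)
atLeast-≤suc p []       = z≤n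
atLeast-≤suc p {h ∷ hs} (d ∷ ds) with suc p ≤? h | p ≤? h
... | yes _ | yes _ = s≤s (atLeast-≤suc p ds)
... | yes q | no ¬q = contradiction (<⇒≤ q) ¬q
... | no  _ | no  _ = atLeast-≤suc p ds
... | no ¬q | yes _ = s≤s (≤-trans (≤-reflexive (atLeast-none (All.map (λ r → <-≤-trans r (s≤s⁻¹ (≰⇒> ¬q))) d))) z≤n)

length≤ : ∀ {hs n} → Decreasing hs → All (_< n) hs → length hs ≤ n
length≤ []       []      = z≤n
length≤ (d ∷ ds) (q ∷ _) = ≤-trans (s≤s (length≤ ds d)) q

-- A decreasing list has at most `p` entries below `p`.
length≤atLeast : ∀ p {hs} → Decreasing hs → length hs ≤ atLeast p hs + p
length≤atLeast p []       = z≤n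
length≤atLeast p {h ∷ hs} (d ∷ ds) with p ≤? h
... | yes _ = s≤s (length≤atLeast p ds)
... | no ¬q = ≤-trans (length≤ {h ∷ hs} (d ∷ ds) (≰⇒> ¬q ∷ All.map (λ r → <-trans r (≰⇒> ¬q)) d))
                      (m≤n+m p (atLeast p hs))

atLeast-beyond : ∀ {p} hs → sum hs < p → atLeast p hs ≡ 0
atLeast-beyond hs q = atLeast-none (below hs q)
  where
  below : ∀ hs {p} → sum hs < p → All (_< p) hs
  below []       _ = []
  below (h ∷ hs) q = ≤-<-trans (m≤m+n h _) q ∷ below hs (≤-<-trans (m≤n+m _ h) q)

-- The cell belongs to the diagram iff the entry of row `y`, its length plus the number of later
-- rows, is at least `p`. The entries decrease, so this says that more than `y` of them are. Since
-- `p` depends on the content alone, `atLeast p` describes the boundary on one diagonal.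
rowLength-tupleL : ∀ Q → Decreasing (tupleL Q) → ∀ {x y p} → p + y ≡ x + length Q →
                   (x , y) ∈ᵞ Q ⇔ y < atLeast p (tupleL Q)
rowLength-tupleL []      _ _ = mk⇔ (λ ()) (λ ())
rowLength-tupleL (q ∷ Q) (d ∷ ds) {x} {zero} {p} e with p ≤? q + length Q
... | yes r = mk⇔ (λ _ → z<s) λ _ → +-cancelʳ-≤ (length Q) _ _ (≤-trans (≤-reflexive
  (trans (sym (+-suc x (length Q))) (trans (sym e) (+-identityʳ p)))) r)
... | no ¬r = mk⇔ (λ s → contradiction (≤-trans (≤-reflexive (trans (sym (+-identityʳ p)) (trans e (+-suc x (length Q)))))
    (+-monoˡ-≤ (length Q) s)) ¬r)
  λ s → contradiction (subst (0 <_) (atLeast-none (All.map (λ t → <-trans t (≰⇒> ¬r)) d)) s) λ ()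
rowLength-tupleL (q ∷ Q) (d ∷ ds) {x} {suc y} {p} e with p ≤? q + length Q | rowLength-tupleL Q ds {x} {y} {p}
    (suc-injective (trans (sym (+-suc p y)) (trans e (+-suc x (length Q)))))
... | yes _ | i = mk⇔ (s≤s ∘ Equivalence.to i) (Equivalence.from i ∘ s≤s⁻¹)
... | no ¬r | i = mk⇔ (λ s → contradiction (subst (y <_) none (Equivalence.to i s)) λ ())
                      (λ s → contradiction (subst (suc y <_) none s) λ ())
  where
  none : atLeast p (tupleL Q) ≡ 0
  none = atLeast-none (All.map (λ t → <-trans t (≰⇒> ¬r)) d)

rowLength-antitone : ∀ Q → Decreasing (tupleL Q) → ∀ y → rowLength Q (suc y) ≤ rowLength Q y
rowLength-antitone []          _ _ = z≤n
rowLength-antitone (q ∷ [])    _ _ = z≤n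
rowLength-antitone (q ∷ r ∷ Q) ((d ∷ _) ∷ ds) zero =
  +-cancelʳ-≤ (length Q) _ _ (s≤s⁻¹ (≤-trans d (≤-reflexive (+-suc q (length Q)))))
rowLength-antitone (q ∷ r ∷ Q) (_ ∷ ds) (suc y) = rowLength-antitone (r ∷ Q) ds y

rowLength<length : ∀ Q y {x} → x < rowLength Q y → y < length Q
rowLength<length (_ ∷ _) zero    _ = z<s
rowLength<length (_ ∷ Q) (suc y) p = s<s (rowLength<length Q y p)

rowLength-zeros : ∀ Q → Decreasing (tupleL (0 ∷ Q)) → ∀ y → rowLength Q y ≡ 0
rowLength-zeros []      _ _ = refl
rowLength-zeros (q ∷ Q) ((d ∷ _) ∷ ds) y with n≤0⇒n≡0 (+-cancelʳ-≤ (length Q) q 0 (s≤s⁻¹ d))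
... | refl with y
...   | zero   = refl
...   | suc y′ = rowLength-zeros Q ds y′

rowLength-nonzero : ∀ Q → Decreasing (tupleL Q) → ∀ y → rowLength (filter (0 <?_) Q) y ≡ rowLength Q y
rowLength-nonzero []      _ _ = refl
rowLength-nonzero (zero ∷ Q) (d ∷ ds) y = trans (rowLength-nonzero Q ds y) (trans (zeros y) (sym (whole y)))
  where
  zeros = rowLength-zeros Q (d ∷ ds)
  whole : ∀ y → rowLength (zero ∷ Q) y ≡ 0
  whole zero    = refl
  whole (suc y) = zeros y
rowLength-nonzero (suc q ∷ Q) (d ∷ ds) zero    = refl
rowLength-nonzero (suc q ∷ Q) (d ∷ ds) (suc y) = rowLength-nonzero Q ds y

tupleL-decreasing : ∀ Λ → Linked _≥_ Λ → Decreasing (tupleL Λ)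
tupleL-decreasing []      _ = []
tupleL-decreasing (p ∷ Λ) l = below p Λ l ∷ tupleL-decreasing Λ (tail l)
  where
  tail : ∀ {p Λ} → Linked _≥_ (p ∷ Λ) → Linked _≥_ Λ
  tail [-]     = []
  tail (_ ∷ l) = l
  below : ∀ p Λ → Linked _≥_ (p ∷ Λ) → All (_< p + length Λ) (tupleL Λ)
  below p []      _       = []
  below p (q ∷ Λ) (r ∷ l) = here< ∷ All.map (λ s → <-trans s here<) (below q Λ l)
    where
    here< : q + length Λ < p + suc (length Λ)
    here< = ≤-trans (s≤s (+-monoˡ-≤ (length Λ) r)) (≤-reflexive (sym (+-suc p (length Λ))))

length-tupleL : ∀ Λ → length (tupleL Λ) ≡ length Λ
length-tupleL []      = refl
length-tupleL (_ ∷ Λ) = cong suc (length-tupleL Λ)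

last≤rowLength : ∀ P {k} → (∀ y → rowLength P (suc y) ≤ rowLength P y) → Maybe.All (k ≤_) (last P) →
                 ∀ {y} → y < length P → k ≤ rowLength P y
last≤rowLength (p ∷ [])    _ (Maybe.just q) {zero}  _ = q
last≤rowLength (p ∷ [])    _ _ {suc y} (s≤s ())
last≤rowLength (p ∷ r ∷ P) a q {zero}  _ = ≤-trans (last≤rowLength (r ∷ P) (a ∘ suc) q z<s) (a 0)
last≤rowLength (p ∷ r ∷ P) a q {suc y} s = last≤rowLength (r ∷ P) (a ∘ suc) q (s≤s⁻¹ s)

≡-by-< : ∀ {m n} → (∀ y → y < m ⇔ y < n) → m ≡ n
≡-by-< {m} {n} h = ≤-antisym (≮⇒≥ λ p → <-irrefl refl (Equivalence.to (h n) p))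
                             (≮⇒≥ λ p → <-irrefl refl (Equivalence.from (h m) p))

-- `H` consists of the beta-numbers of `P` padded with zero parts: dropping the zeros in the
-- 2-quotient shortens `P` but not `H`, so lengths are measured on `H`.
record HasBeta (P H : List ℕ) : Set where
  field
    decreasing : Decreasing H
    cell       : ∀ {x y p} → p + y ≡ x + length H → (x , y) ∈ᵞ P ⇔ y < atLeast p H
    antitone   : ∀ y → rowLength P (suc y) ≤ rowLength P y

  module cell {x y p} e = Equivalence (cell {x} {y} {p} e)

  -- Above the diagonal, the shifted diagram is the triangle with length P rows.

  module _ (shifted : LastPartAtLeastLength P) where

    upper-cell : ∀ {x y} → x ≤ y → (x , y) ∈ᵞ P ⇔ y < length P
    upper-cell {x} {y} x≤y = mk⇔ (rowLength<length P y)
      λ y<n → ≤-<-trans x≤y (<-≤-trans y<n (last≤rowLength P antitone shifted y<n))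

    -- The diagonal of content `k` starts at height `k`, and at least `k` entries are always
    -- counted. From there on the cells reach up to height `length P`, which is also the number of
    -- cells on the main diagonal.
    atLeast-upper : ∀ {p k} → p + k ≡ length H → atLeast p H ≡ atLeast (length H) H ⊔ k
    atLeast-upper {p} {k} e = trans (≡-by-< λ y → mk⇔ (to y) (from y)) (cong (_⊔ k) (sym diagonal))
      where
      n = length P
      diagonal : atLeast (length H) H ≡ n
      diagonal = ≡-by-< λ y → mk⇔
        (Equivalence.to (upper-cell {y} ≤-refl) ∘ cell.from (+-comm (length H) y))
        (cell.to (+-comm (length H) y) ∘ Equivalence.from (upper-cell {y} ≤-refl))
      onRow : ∀ {y} → k ≤ y → p + y ≡ (y ∸ k) + length H
      onRow {y} q = trans (cong (p +_) (sym (m∸n+n≡m q)))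
        (trans (rearrange p (y ∸ k) k) (cong (y ∸ k +_) e))
        where
        rearrange : ∀ p z k → p + (z + k) ≡ z + (p + k)
        rearrange = solve-∀
      to : ∀ y → y < atLeast p H → y < n ⊔ k
      to y r with k ≤? y
      ... | yes q = <-≤-trans (Equivalence.to (upper-cell (m∸n≤m y k)) (cell.from (onRow q) r)) (m≤m⊔n n k)
      ... | no ¬q = <-≤-trans (≰⇒> ¬q) (m≤n⊔m n k)
      from : ∀ y → y < n ⊔ k → y < atLeast p H
      from y r with k ≤? y
      ... | yes q = cell.to (onRow q) (Equivalence.from (upper-cell (m∸n≤m y k)) ([ id , (λ s → contradiction q (<⇒≱ s)) ]′ (split r)))
        where
        split : y < n ⊔ k → y < n ⊎ y < k
        split r with ≤-total n k
        ... | inj₁ s = inj₂ (subst (y <_) (m≤n⇒m⊔n≡n s) r)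
        ... | inj₂ s = inj₁ (subst (y <_) (m≥n⇒m⊔n≡m s) r)
      ... | no ¬q = <-≤-trans (≰⇒> ¬q) (+-cancelʳ-≤ p _ _ (≤-trans (≤-reflexive (trans (+-comm k p) e)) (length≤atLeast p decreasing)))

even-half : ∀ {l} → Even l → l ≡ subdiagonal false (half l)
even-half {l} p with isOdd l | subdiagonal-half l
... | false | e = sym e
... | true  | e = contradiction (∣⇒≤ (∣m+n∣m⇒∣n (subst Even (trans (sym e) (+-comm 1 _)) p) (m∣m*n (half l)))) λ { (s≤s ()) }

odd-half : ∀ {l} → Odd l → l ≡ subdiagonal true (half l)
odd-half {l} p with isOdd l | subdiagonal-half l
... | true  | e = sym e
... | false | e = contradiction (subst Even e (m∣m*n (half l))) p

subdiagonal-mono : ∀ δ {i j} → i ≤ j → subdiagonal δ i ≤ subdiagonal δ j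
subdiagonal-mono false p = *-monoʳ-≤ 2 p
subdiagonal-mono true  p = s≤s (*-monoʳ-≤ 2 p)

subdiagonal-∸ : ∀ δ i j → (subdiagonal δ i ∸ subdiagonal δ j) / 2 ≡ i ∸ j
subdiagonal-∸ false i j = trans (cong (_/ 2) (trans (sym (*-distribˡ-∸ 2 i j)) (*-comm 2 (i ∸ j)))) (m*n/n≡m (i ∸ j) 2)
subdiagonal-∸ true  i j = subdiagonal-∸ false i j

entryM : ℕ → List ℕ → ℕ
entryM a L = if Dec.does (even? a) then 2 * length (filter even? L) else suc (2 * length (filter odd? L))

module Component {C : ℕ → Set} (C? : ∀ n → Dec (C n)) (δ : Bool) (halved : ∀ {l} → C l → l ≡ subdiagonal δ (half l))
                 (entry : ∀ a L → C a → entryM a L ≡ subdiagonal δ (length (filter C? L))) where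

  betas : List ℕ → List ℕ
  betas L = map half (filter C? L)

  rows : List ℕ → List ℕ
  rows L = map (λ (l , m) → (l ∸ m) / 2) (filter (λ (l , _) → C? l) (zip L (tupleM L)))

  half-< : ∀ {l a} → C l → C a → l < a → half l < half a
  half-< cl ca p = ≰⇒> λ q → <⇒≱ p (≤-trans (≤-reflexive (halved ca))
    (≤-trans (subdiagonal-mono δ q) (≤-reflexive (sym (halved cl)))))

  betas-< : ∀ {a} → C a → ∀ {L} → All (_< a) L → All (_< half a) (betas L)
  betas-< ca []       = []
  betas-< ca {l ∷ L} (p ∷ ps) with C? l
  ... | yes cl = half-< cl ca p ∷ betas-< ca ps
  ... | no  _  = betas-< ca ps

  betas-decreasing : ∀ {L} → Decreasing L → Decreasing (betas L)
  betas-decreasing []       = []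
  betas-decreasing {a ∷ L} (d ∷ ds) with C? a
  ... | yes c = betas-< c d ∷ betas-decreasing ds
  ... | no  _ = betas-decreasing ds

  -- The entry of M is determined by the number `n` of entries of the same parity to the right, so
  -- the part is `half a ∸ n`. In the component `n` is also the number of later rows; adding it back
  -- leaves `half a`.
  tupleL-rows : ∀ {L} → Decreasing L → tupleL (rows L) ≡ betas L
  tupleL-rows {[]}    _ = refl
  tupleL-rows {a ∷ L} (d ∷ ds) with C? a
  ... | no  _ = tupleL-rows ds
  ... | yes c = cong₂ _∷_ (begin
      (a ∸ entryM a L) / 2 + length (rows L) ≡⟨ cong₂ _+_ (cong₂ (λ a m → (a ∸ m) / 2) (halved c) (entry a L c)) lengths ⟩
      (subdiagonal δ (half a) ∸ subdiagonal δ n) / 2 + n ≡⟨ cong (_+ n) (subdiagonal-∸ δ (half a) n) ⟩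
      half a ∸ n + n ≡⟨ m∸n+n≡m n≤ ⟩
      half a ∎) (tupleL-rows ds)
    where
    open ≡-Reasoning
    n = length (filter C? L)
    lengths : length (rows L) ≡ n
    lengths = trans (sym (length-tupleL (rows L))) (trans (cong length (tupleL-rows ds)) (length-map half (filter C? L)))
    n≤ : n ≤ half a
    n≤ = subst (_≤ half a) (length-map half (filter C? L)) (length≤ (betas-decreasing ds) (betas-< c d))

  hasBeta : ∀ {Λ} → Decreasing (tupleL Λ) → HasBeta (quotientParts C? Λ) (betas (tupleL Λ))
  hasBeta {Λ} ds = record
    { decreasing = betas-decreasing ds
    ; cell       = λ {x} {y} {p} e → subst₂ (λ r h → x < r ⇔ y < atLeast p h) (sym (nonzero y)) t
        (rowLength-tupleL (rows L) rows-decreasing (trans e (cong (x +_) (trans (sym (cong length t)) (length-tupleL (rows L))))))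
    ; antitone   = λ y → subst₂ _≤_ (sym (nonzero (suc y))) (sym (nonzero y)) (rowLength-antitone (rows L) rows-decreasing y)
    }
    where
    L = tupleL Λ
    t = tupleL-rows ds
    rows-decreasing : Decreasing (tupleL (rows L))
    rows-decreasing = subst Decreasing (sym t) (betas-decreasing ds)
    nonzero : ∀ y → rowLength (filter (0 <?_) (rows L)) y ≡ rowLength (rows L) y
    nonzero = rowLength-nonzero (rows L) rows-decreasing

private
  even-entry : ∀ a L → Even a → entryM a L ≡ subdiagonal false (length (filter even? L))
  even-entry a L p = cong (if_then 2 * length (filter even? L) else suc (2 * length (filter odd? L))) (dec-true (even? a) p)

  odd-entry : ∀ a L → Odd a → entryM a L ≡ subdiagonal true (length (filter odd? L))
  odd-entry a L p = cong (if_then 2 * length (filter even? L) else suc (2 * length (filter odd? L))) (dec-false (even? a) p)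

module Evens = Component even? false even-half even-entry
module Odds  = Component odd? true odd-half odd-entry

-- Additivity of boundaries

tick-+ˡ : ∀ {P : Set} (d : Dec P) m n → tick d m + n ≡ tick d (m + n)
tick-+ˡ (yes _) m n = refl
tick-+ˡ (no  _) m n = refl

tick-+ʳ : ∀ {P : Set} (d : Dec P) m n → m + tick d n ≡ tick d (m + n)
tick-+ʳ (yes _) m n = +-suc m n
tick-+ʳ (no  _) m n = refl

2*≤ : ∀ δ p {l} → l ≡ subdiagonal δ (half l) → 2 * p ≤ l ⇔ p ≤ half l
2*≤ false p e = mk⇔ (λ q → *-cancelˡ-≤ 2 (subst (2 * p ≤_) e q)) (λ q → subst (2 * p ≤_) (sym e) (*-monoʳ-≤ 2 q))
2*≤ true  p e = mk⇔ (λ q → s≤s⁻¹ (*-cancelˡ-< 2 p _ (≤-trans (s≤s (subst (2 * p ≤_) e q)) (≤-reflexive (sym (*-suc 2 _))))))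
                    (λ q → subst (2 * p ≤_) (sym e) (m≤n⇒m≤1+n (*-monoʳ-≤ 2 q)))

2*< : ∀ p {l} → l ≡ subdiagonal false (half l) → 2 * p < l ⇔ p < half l
2*< p e = mk⇔ (λ q → *-cancelˡ-< 2 p _ (subst (2 * p <_) e q)) (λ q → subst (2 * p <_) (sym e) (*-monoʳ-< 2 q))

2*<′ : ∀ p {l} → l ≡ subdiagonal true (half l) → 2 * p < l ⇔ p ≤ half l
2*<′ p e = mk⇔ (λ q → *-cancelˡ-≤ 2 (s≤s⁻¹ (subst (2 * p <_) e q))) (λ q → subst (2 * p <_) (sym e) (s≤s (*-monoʳ-≤ 2 q)))

evens-even : ∀ {a} L → Even a → Evens.betas (a ∷ L) ≡ half a ∷ Evens.betas L
evens-even L p = cong (map half) (filter-accept even? p)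

odds-even : ∀ {a} L → Even a → Odds.betas (a ∷ L) ≡ Odds.betas L
odds-even L p = cong (map half) (filter-reject odd? λ ¬p → ¬p p)

evens-odd : ∀ {a} L → Odd a → Evens.betas (a ∷ L) ≡ Evens.betas L
evens-odd L p = cong (map half) (filter-reject even? p)

odds-odd : ∀ {a} L → Odd a → Odds.betas (a ∷ L) ≡ half a ∷ Odds.betas L
odds-odd L p = cong (map half) (filter-accept odd? p)

-- For both parities of `l`, `2 * p ≤ l` means `p ≤ half l`. With `suc (2 * p)` instead, in
-- `atLeast-odd`, an odd `l` still needs `p ≤ half l`, while an even one needs `suc p ≤ half l`.
atLeast-even : ∀ p L → atLeast (2 * p) L ≡ atLeast p (Evens.betas L) + atLeast p (Odds.betas L)
atLeast-even p []      = refl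
atLeast-even p (a ∷ L) = by (even? a)
  where
  by : Dec (Even a) → atLeast (2 * p) (a ∷ L) ≡ atLeast p (Evens.betas (a ∷ L)) + atLeast p (Odds.betas (a ∷ L))
  by (yes q) rewrite evens-even L q | odds-even L q =
    trans (tick-⇔ (2 * p ≤? a) (p ≤? half a) (2*≤ false p (even-half q)) _)
      (trans (cong (tick (p ≤? half a)) (atLeast-even p L)) (sym (tick-+ˡ (p ≤? half a) _ _)))
  by (no ¬q) rewrite evens-odd L ¬q | odds-odd L ¬q =
    trans (tick-⇔ (2 * p ≤? a) (p ≤? half a) (2*≤ true p (odd-half ¬q)) _)
      (trans (cong (tick (p ≤? half a)) (atLeast-even p L)) (sym (tick-+ʳ (p ≤? half a) (atLeast p (Evens.betas L)) _)))

atLeast-odd : ∀ p L → atLeast (suc (2 * p)) L ≡ atLeast (suc p) (Evens.betas L) + atLeast p (Odds.betas L)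
atLeast-odd p []      = refl
atLeast-odd p (a ∷ L) = by (even? a)
  where
  by : Dec (Even a) → atLeast (suc (2 * p)) (a ∷ L) ≡ atLeast (suc p) (Evens.betas (a ∷ L)) + atLeast p (Odds.betas (a ∷ L))
  by (yes q) rewrite evens-even L q | odds-even L q =
    trans (tick-⇔ (suc (2 * p) ≤? a) (suc p ≤? half a) (2*< p (even-half q)) _)
      (trans (cong (tick (suc p ≤? half a)) (atLeast-odd p L)) (sym (tick-+ˡ (suc p ≤? half a) _ _)))
  by (no ¬q) rewrite evens-odd L ¬q | odds-odd L ¬q =
    trans (tick-⇔ (suc (2 * p) ≤? a) (p ≤? half a) (2*<′ p (odd-half ¬q)) _)
      (trans (cong (tick (p ≤? half a)) (atLeast-odd p L)) (sym (tick-+ʳ (p ≤? half a) (atLeast (suc p) (Evens.betas L)) _)))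

-- Pavable diagrams are balanced

colour : Cell → Bool
colour (x , y) = isOdd (x + y)

ofColour : Bool → List Cell → ℕ
ofColour δ []       = 0
ofColour δ (c ∷ cs) = tick (colour c Bool.≟ δ) (ofColour δ cs)

ofColour-++ : ∀ δ cs ds → ofColour δ (cs ++ ds) ≡ ofColour δ cs + ofColour δ ds
ofColour-++ δ []       ds = refl
ofColour-++ δ (c ∷ cs) ds = trans (cong (tick (colour c Bool.≟ δ)) (ofColour-++ δ cs ds))
                                  (sym (tick-+ˡ (colour c Bool.≟ δ) (ofColour δ cs) _))

ofColour-↭ : ∀ δ {cs ds} → cs ↭ ds → ofColour δ cs ≡ ofColour δ ds
ofColour-↭ δ ↭.refl         = refl
ofColour-↭ δ (↭.prep c p)   = cong (tick (colour c Bool.≟ δ)) (ofColour-↭ δ p)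
ofColour-↭ δ (↭.swap c d p) = trans (tick-comm (colour c Bool.≟ δ) (colour d Bool.≟ δ) _)
  (cong (λ n → tick (colour d Bool.≟ δ) (tick (colour c Bool.≟ δ) n)) (ofColour-↭ δ p))
  where
  tick-comm : ∀ {P Q : Set} (d : Dec P) (e : Dec Q) n → tick d (tick e n) ≡ tick e (tick d n)
  tick-comm (yes _) (yes _) n = refl
  tick-comm (yes _) (no  _) n = refl
  tick-comm (no  _) (yes _) n = refl
  tick-comm (no  _) (no  _) n = refl
ofColour-↭ δ (↭.trans p q)  = trans (ofColour-↭ δ p) (ofColour-↭ δ q)

ofColour-set : ∀ δ {cs ds} → Unique cs → Unique ds → (∀ {c} → c ∈ cs ⇔ c ∈ ds) → ofColour δ cs ≡ ofColour δ ds
ofColour-set δ u v h = ofColour-↭ δ (∼bag⇒↭ (unique∧set⇒bag u v h))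

domino-unique : ∀ d → Unique (dominoCells d)
domino-unique (horizontal _) = ((λ e → 1+n≢n (sym (cong proj₁ e))) ∷ []) ∷ [] ∷ []
domino-unique (vertical _)   = ((λ e → 1+n≢n (sym (cong proj₂ e))) ∷ []) ∷ [] ∷ []

domino-colours : ∀ d δ → ofColour δ (dominoCells d) ≡ 1
domino-colours d δ = by d
  where
  alternating : ∀ γ δ → tick (γ Bool.≟ δ) (tick (not γ Bool.≟ δ) 0) ≡ 1
  alternating true  true  = refl
  alternating true  false = refl
  alternating false true  = refl
  alternating false false = refl
  by : ∀ d → ofColour δ (dominoCells d) ≡ 1
  by (horizontal (x , y)) = alternating (isOdd (x + y)) δ
  by (vertical (x , y)) rewrite +-suc x y = alternating (isOdd (x + y)) δ

Balanced : List Cell → Set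
Balanced cs = ofColour false cs ≡ ofColour true cs

step-balanced : ∀ {Λ κ} → Λ ⟶ κ → Balanced (cells κ) → Balanced (cells Λ)
step-balanced {Λ} {κ} s h = trans (removed false) (trans (cong suc h) (sym (removed true)))
  where
  open _⟶_ s
  same : ∀ {c} → c ∈ cells Λ ⇔ c ∈ dominoCells domino ++ cells κ
  same {c} = mk⇔
    (λ p → case Any? c of λ where
      (yes q) → ∈-++⁺ˡ q
      (no ¬q) → ∈-++⁺ʳ (dominoCells domino) (∈-cells⁺ κ (Equivalence.from (remaining c) (∈-cells⁻ Λ p , ¬q))))
    (λ p → case ∈-++⁻ (dominoCells domino) p of λ where
      (inj₁ q) → ∈-cells⁺ Λ (inside q)
      (inj₂ q) → ∈-cells⁺ Λ (proj₁ (Equivalence.to (remaining c) (∈-cells⁻ κ q))))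
    where
    Any? : ∀ c → Dec (c ∈ dominoCells domino)
    Any? c = c ∈? dominoCells domino
  removed : ∀ δ → ofColour δ (cells Λ) ≡ suc (ofColour δ (cells κ))
  removed δ = trans
    (ofColour-set δ (cells-unique Λ) (Unique.++⁺ (domino-unique domino) (cells-unique κ)
      λ (p , q) → proj₂ (Equivalence.to (remaining _) (∈-cells⁻ κ q)) p) same)
    (trans (ofColour-++ δ (dominoCells domino) (cells κ)) (cong (_+ ofColour δ (cells κ)) (domino-colours domino δ)))

star-balanced : ∀ {Λ} → Star _⟶_ Λ [] → Balanced (cells Λ)
star-balanced Star.ε        = refl
star-balanced (s ◅ ss) = step-balanced s (star-balanced ss)

above : Cell → Cell
above (x , y) = x , suc y

-- The same cells as in `cells`, arranged by recursion on the partition so that colours can be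
-- counted row by row.
cellsByRow : List ℕ → List Cell
cellsByRow []      = []
cellsByRow (p ∷ Λ) = map (_, 0) (downFrom p) ++ map above (cellsByRow Λ)

∈-cellsByRow : ∀ Λ {c} → c ∈ cellsByRow Λ ⇔ c ∈ᵞ Λ
∈-cellsByRow []      = mk⇔ (λ ()) (λ ())
∈-cellsByRow (p ∷ Λ) {x , y} = mk⇔ (to y) (from y)
  where
  to : ∀ y → (x , y) ∈ cellsByRow (p ∷ Λ) → (x , y) ∈ᵞ p ∷ Λ
  to y m with ∈-++⁻ (map (_, 0) (downFrom p)) m
  ... | inj₁ q with ∈-map⁻ (_, 0) q
  ...   | _ , r , refl = ∈-downFrom⁻ r
  to y m | inj₂ q with ∈-map⁻ above q
  ...   | _ , r , refl = Equivalence.to (∈-cellsByRow Λ) r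
  from : ∀ y → (x , y) ∈ᵞ p ∷ Λ → (x , y) ∈ cellsByRow (p ∷ Λ)
  from zero    q = ∈-++⁺ˡ (∈-map⁺ (_, 0) (∈-downFrom⁺ q))
  from (suc y) q = ∈-++⁺ʳ (map (_, 0) (downFrom p)) (∈-map⁺ above (Equivalence.from (∈-cellsByRow Λ) q))

cellsByRow-unique : ∀ Λ → Unique (cellsByRow Λ)
cellsByRow-unique []      = []
cellsByRow-unique (p ∷ Λ) = Unique.++⁺ (Unique.map⁺ (cong proj₁) (Unique.downFrom⁺ p))
  (Unique.map⁺ (λ { refl → refl }) (cellsByRow-unique Λ)) λ (q , r) → disjoint q r
  where
  disjoint : ∀ {c} → c ∈ map (_, 0) (downFrom p) → c ∈ map above (cellsByRow Λ) → ⊥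
  disjoint q r with ∈-map⁻ (_, 0) q | ∈-map⁻ above r
  ... | _ , _ , refl | _ , _ , ()

ofColour-above : ∀ δ cs → ofColour δ (map above cs) ≡ ofColour (not δ) cs
ofColour-above δ []             = refl
ofColour-above δ ((x , y) ∷ cs) rewrite +-suc x y | ofColour-above δ cs = opposite (isOdd (x + y)) δ
  where
  opposite : ∀ γ δ {n} → tick (not γ Bool.≟ δ) n ≡ tick (γ Bool.≟ not δ) n
  opposite true  true  = refl
  opposite true  false = refl
  opposite false true  = refl
  opposite false false = refl

rowCells : ℕ → List Cell
rowCells p = map (_, 0) (downFrom p)

ofColour-row : ∀ p → ofColour false (rowCells p) ≡ (if isOdd p then 1 else 0) + ofColour true (rowCells p)
ofColour-row zero    = refl
ofColour-row (suc p) rewrite +-identityʳ p = by (isOdd p) (ofColour-row p)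
  where
  by : ∀ γ {m n} → m ≡ (if γ then 1 else 0) + n →
       tick (γ Bool.≟ false) m ≡ (if not γ then 1 else 0) + tick (γ Bool.≟ true) n
  by true  e = e
  by false e = cong suc e

isOdd-+ : ∀ m n → isOdd (m + n) ≡ (if isOdd m then not (isOdd n) else isOdd n)
isOdd-+ zero    n = refl
isOdd-+ (suc m) n rewrite isOdd-+ m n with isOdd m | isOdd n
... | true  | true  = refl
... | true  | false = refl
... | false | _     = refl

isOdd-even : ∀ {l} → isOdd l ≡ false → Even l
isOdd-even {l} e = subst Even (trans (cong (λ δ → subdiagonal δ (half l)) (sym e)) (subdiagonal-half l)) (m∣m*n (half l))

isOdd-odd : ∀ {l} → isOdd l ≡ true → Odd l
isOdd-odd {l} e p = case trans (sym e) (trans (cong isOdd (even-half p)) (isOdd-subdiagonal false (half l))) of λ ()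

-- How the numbers e and o of even and odd beta-numbers determine the difference
-- of the numbers E and O of cells of the two colours, with subtractions cleared.

Discrepancy : Bool → ℕ → ℕ → ℕ → ℕ → Set
Discrepancy false E O e o = 2 * E + o ≡ 2 * O + e
Discrepancy true  E O e o = 2 * E + e ≡ 2 * O + suc o

-- A new bottom row raises the other rows by one, which exchanges the two colours of their cells,
-- and keeps their beta-numbers. The row itself has one cell more of colour `false` iff `p` is odd,
-- and the parity of `p + length Λ` decides which of the two counts of beta-numbers grows.
discrepancy : ∀ Λ → Discrepancy (isOdd (length Λ)) (ofColour false (cellsByRow Λ)) (ofColour true (cellsByRow Λ))
                                (length (Evens.betas (tupleL Λ))) (length (Odds.betas (tupleL Λ)))
discrepancy []      = refl
discrepancy (p ∷ Λ) = subst₂ (λ E O → Discrepancy (not (isOdd (length Λ))) E O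
      (length (Evens.betas (tupleL (p ∷ Λ)))) (length (Odds.betas (tupleL (p ∷ Λ)))))
    (sym (trans (colours false) (cong (_+ O′) (ofColour-row p)))) (sym (colours true))
    (by (isOdd (length Λ)) (isOdd p) (isOdd-+ p (length Λ)) (discrepancy Λ))
  where
  E′ = ofColour false (cellsByRow Λ)
  O′ = ofColour true (cellsByRow Λ)
  L  = tupleL Λ
  e′ = length (Evens.betas L)
  o′ = length (Odds.betas L)
  l  = p + length Λ
  r  = ofColour true (rowCells p)
  colours : ∀ δ → ofColour δ (cellsByRow (p ∷ Λ)) ≡ ofColour δ (rowCells p) + ofColour (not δ) (cellsByRow Λ)
  colours δ = trans (ofColour-++ δ (rowCells p) _) (cong (ofColour δ (rowCells p) +_) (ofColour-above δ (cellsByRow Λ)))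
  by : ∀ n-odd p-odd → isOdd l ≡ (if p-odd then not n-odd else n-odd) → Discrepancy n-odd E′ O′ e′ o′ →
       Discrepancy (not n-odd) ((if p-odd then 1 else 0) + r + O′) (r + E′)
                   (length (Evens.betas (l ∷ L))) (length (Odds.betas (l ∷ L)))
  by false false q h rewrite evens-even L (isOdd-even {l} q) | odds-even L (isOdd-even {l} q) =
    trans (lhs r O′ e′) (trans (cong (suc (2 * r) +_) (sym h)) (rhs r E′ o′))
    where
    lhs : ∀ r O e → 2 * (r + O) + suc e ≡ suc (2 * r) + (2 * O + e)
    lhs = solve-∀
    rhs : ∀ r E o → suc (2 * r) + (2 * E + o) ≡ 2 * (r + E) + suc o
    rhs = solve-∀
  by false true q h rewrite evens-odd L (isOdd-odd {l} q) | odds-odd L (isOdd-odd {l} q) =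
    trans (lhs r O′ e′) (trans (cong (2 + 2 * r +_) (sym h)) (rhs r E′ o′))
    where
    lhs : ∀ r O e → 2 * (suc r + O) + e ≡ 2 + 2 * r + (2 * O + e)
    lhs = solve-∀
    rhs : ∀ r E o → 2 + 2 * r + (2 * E + o) ≡ 2 * (r + E) + suc (suc o)
    rhs = solve-∀
  by true false q h rewrite evens-odd L (isOdd-odd {l} q) | odds-odd L (isOdd-odd {l} q) =
    trans (lhs r O′ o′) (trans (cong (2 * r +_) (sym h)) (rhs r E′ e′))
    where
    lhs : ∀ r O o → 2 * (r + O) + suc o ≡ 2 * r + (2 * O + suc o)
    lhs = solve-∀
    rhs : ∀ r E e → 2 * r + (2 * E + e) ≡ 2 * (r + E) + e
    rhs = solve-∀
  by true true q h rewrite evens-even L (isOdd-even {l} q) | odds-even L (isOdd-even {l} q) =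
    trans (lhs r O′ o′) (trans (cong (suc (2 * r) +_) (sym h)) (rhs r E′ e′))
    where
    lhs : ∀ r O o → 2 * (suc r + O) + o ≡ suc (2 * r) + (2 * O + suc o)
    lhs = solve-∀
    rhs : ∀ r E e → suc (2 * r) + (2 * E + e) ≡ 2 * (r + E) + suc e
    rhs = solve-∀

BetasBalanced : Bool → ℕ → ℕ → Set
BetasBalanced false e o = o ≡ e
BetasBalanced true  e o = e ≡ suc o

betas-balanced : ∀ {Λ} → IsPavable Λ →
                 BetasBalanced (isOdd (length Λ)) (length (Evens.betas (tupleL Λ))) (length (Odds.betas (tupleL Λ)))
betas-balanced {Λ} (star , _) = cancel (isOdd (length Λ))
  (subst (λ O → Discrepancy (isOdd (length Λ)) E O (length (Evens.betas L)) (length (Odds.betas L))) (sym (trans (colour≡ false) (trans (star-balanced star) (sym (colour≡ true))))) (discrepancy Λ))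
  where
  L = tupleL Λ
  E = ofColour false (cellsByRow Λ)
  colour≡ : ∀ δ → ofColour δ (cellsByRow Λ) ≡ ofColour δ (cells Λ)
  colour≡ δ = ofColour-set δ (cellsByRow-unique Λ) (cells-unique Λ)
    (mk⇔ (∈-cells⁺ Λ ∘ Equivalence.to (∈-cellsByRow Λ)) (Equivalence.from (∈-cellsByRow Λ) ∘ ∈-cells⁻ Λ))
  cancel : ∀ δ {e o} → Discrepancy δ E E e o → BetasBalanced δ e o
  cancel false h = +-cancelˡ-≡ (2 * E) _ _ h
  cancel true  h = +-cancelˡ-≡ (2 * E) _ _ h

-- Shapes

-- The boundary of `L` on the diagonals of content -i, 2k and 2k + 1, as a sum of the boundaries of
-- the two lists. The first alternatives name the results of the subtractions such as ℓ - 2k; the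
-- second ones are the contents greater than ℓ, where there are no cells.
record Split (ℓ : ℕ) (L : List ℕ) (H : Bool → List ℕ) : Set where
  e : Bool → ℕ
  e δ = length (H δ)
  D : ℕ → ℕ
  D m = atLeast (half m + e (isOdd m)) (H (isOdd m))
  field
    low    : ∀ i → atLeast (i + ℓ) L ≡ D i + D (suc i)
    upEven : ∀ k → (∃[ p ] p + 2 * k ≡ ℓ × ∃[ p₀ ] ∃[ p₁ ] p₀ + k ≡ e false × p₁ + k ≡ e true ×
                      atLeast p L ≡ atLeast p₀ (H false) + atLeast p₁ (H true))
                 ⊎ (ℓ < 2 * k × e false ≤ k × e true ≤ k)
    upOdd  : ∀ k → (∃[ p ] p + suc (2 * k) ≡ ℓ × ∃[ p₀ ] ∃[ p₁ ] p₀ + k ≡ e false × p₁ + suc k ≡ e true ×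
                      atLeast p L ≡ atLeast p₀ (H false) + atLeast p₁ (H true))
                 ⊎ (ℓ < suc (2 * k) × e false ≤ k × e true ≤ suc k)

module _ {Λ L} (P H : Bool → List ℕ) (beta : ∀ δ → HasBeta (P δ) (H δ)) (shifted : ∀ δ → LastPartAtLeastLength (P δ))
         (whole : ∀ {x y p} → p + y ≡ x + length Λ → (x , y) ∈ᵞ Λ ⇔ y < atLeast p L)
         (split : Split (length Λ) L H) where
  private
    open module S = Split split hiding (low; upEven; upOdd)
    module beta δ = HasBeta (beta δ)

    D-2+ : ∀ m → D (2 + m) ≡ atLeast (suc (half m + e (isOdd m))) (H (isOdd m))
    D-2+ m rewrite isOdd-2+ m = refl

    upper : ∀ δ {p k} → p + k ≡ e δ → atLeast p (H δ) ≡ (atLeast (e δ) (H δ) ∸ k) + k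
    upper δ {p} {k} q = trans (beta.atLeast-upper δ (shifted δ) q) (sym (∸-+-⊔ (atLeast (e δ) (H δ)) k))

    empty : ∀ δ {k} → e δ ≤ k → atLeast (e δ) (H δ) ∸ k ≡ 0
    empty δ q = m≤n⇒m∸n≡0 (≤-trans (atLeast-≤length (e δ) (H δ)) q)

    -- Half of any `m` from here on exceeds the sum, hence every entry, of either list.
    bound : ℕ
    bound = 2 * suc (sum (H false) + sum (H true))

    sum≤ : ∀ δ → sum (H δ) ≤ sum (H false) + sum (H true)
    sum≤ false = m≤m+n _ _
    sum≤ true  = m≤n+m _ (sum (H false))

    -- A component contributes `(D ∸ k) + k` to the boundary at content `k`. The two contents add up
    -- to `c`, which is also the excess of the height over `x`, and cancels.
    above-D₀ : ∀ {x c k k′} p {p₀ p₁} → k + k′ ≡ c → p + c ≡ length Λ → p₀ + k ≡ e false → p₁ + k′ ≡ e true →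
               atLeast p L ≡ atLeast p₀ (H false) + atLeast p₁ (H true) →
               (x , x + c) ∈ᵞ Λ ⇔ x < (D 0 ∸ k) + (D 1 ∸ k′)
    above-D₀ {x} {c} {k} {k′} p k+k′ q q₀ q₁ h = mk⇔
      (λ r → +-cancelʳ-< c _ _ (subst (x + c <_) total (Equivalence.to w r)))
      (λ r → Equivalence.from w (subst (x + c <_) (sym total) (+-monoˡ-< c r)))
      where
      w : (x , x + c) ∈ᵞ Λ ⇔ x + c < atLeast p L
      w = whole (trans (rearrange p x c) (cong (x +_) q))
        where
        rearrange : ∀ p x c → p + (x + c) ≡ x + (p + c)
        rearrange = solve-∀
      total : atLeast p L ≡ (D 0 ∸ k) + (D 1 ∸ k′) + c
      total = trans h (trans (cong₂ _+_ (upper false q₀) (upper true q₁))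
        (trans (rearrange (D 0 ∸ k) (D 1 ∸ k′) k k′) (cong ((D 0 ∸ k) + (D 1 ∸ k′) +_) k+k′)))
        where
        rearrange : ∀ a b k k′ → (a + k) + (b + k′) ≡ a + b + (k + k′)
        rearrange = solve-∀

    beyond : ∀ {x c k k′} → length Λ < c → e false ≤ k → e true ≤ k′ → (x , x + c) ∈ᵞ Λ ⇔ x < (D 0 ∸ k) + (D 1 ∸ k′)
    beyond {x} {c} q q₀ q₁ = mk⇔
      (λ r → contradiction (<-trans (rowLength<length Λ _ r) (<-≤-trans q (m≤n+m c x))) (<-irrefl refl))
      (λ r → contradiction (subst (x <_) (cong₂ _+_ (empty false q₀) (empty true q₁)) r) λ ())

  quotient : Quotient Λ P
  quotient = record
    { D       = D
    ; bound   = bound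
    ; D-zero  = λ {m} q → atLeast-beyond (H (isOdd m)) (≤-trans (s≤s (sum≤ (isOdd m))) (≤-trans
        (≤-trans (≤-reflexive (sym (half-subdiagonal false (suc (sum (H false) + sum (H true)))))) (⌊n/2⌋-mono q))
        (m≤m+n (half m) _)))
    ; D-lower = λ m → subst (_≤ D m) (sym (D-2+ m)) (atLeast-suc-≤ (half m + e (isOdd m)) (H (isOdd m)))
    ; D-upper = λ m → subst (λ n → D m ≤ suc n) (sym (D-2+ m))
        (atLeast-≤suc (half m + e (isOdd m)) (HasBeta.decreasing (beta (isOdd m))))
    ; part    = λ δ i y → subst₂ (λ j γ → (y + i , y) ∈ᵞ P δ ⇔ y < atLeast (j + e γ) (H γ))
        (sym (half-subdiagonal δ i)) (sym (isOdd-subdiagonal δ i))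
        (HasBeta.cell (beta δ) (rearrange i (e δ) y))
    ; low     = λ i y → subst (λ n → (y + i , y) ∈ᵞ Λ ⇔ y < n) (S.low i) (whole (rearrange i (length Λ) y))
    ; upEven  = λ k x → case S.upEven k of λ where
        (inj₁ (p , q , p₀ , p₁ , q₀ , q₁ , h)) → above-D₀ p (cong (k +_) (sym (+-identityʳ k))) q q₀ q₁ h
        (inj₂ (q , q₀ , q₁)) → beyond q q₀ q₁
    ; upOdd   = λ k x → case S.upOdd k of λ where
        (inj₁ (p , q , p₀ , p₁ , q₀ , q₁ , h)) → above-D₀ p (trans (+-suc k k) (cong (suc ∘ (k +_)) (sym (+-identityʳ k)))) q q₀ q₁ h
        (inj₂ (q , q₀ , q₁)) → beyond q q₀ q₁
    }
    where
    rearrange : ∀ i e y → i + e + y ≡ y + i + e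
    rearrange = solve-∀

choice : ∀ {A : Set} → A → A → Bool → A
choice x y false = x
choice x y true  = y

module _ {ℓ : ℕ} {L : List ℕ} (Hₑ Hₒ : List ℕ)
         (evenly : ∀ p → atLeast (2 * p) L ≡ atLeast p Hₑ + atLeast p Hₒ)
         (oddly  : ∀ p → atLeast (suc (2 * p)) L ≡ atLeast (suc p) Hₑ + atLeast p Hₒ) where

  private
    parityOf : ∀ i → ∃[ δ ] ∃[ j ] i ≡ subdiagonal δ j
    parityOf i = isOdd i , half i , sym (subdiagonal-half i)

  even-split : ∀ e → length Hₑ ≡ e → length Hₒ ≡ e → ℓ ≡ 2 * e → Split ℓ L (choice Hₑ Hₒ)
  even-split e refl e′ refl = record
    { low    = low
    ; upEven = upEven
    ; upOdd  = upOdd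
    }
    where
    H = choice Hₑ Hₒ
    D : ℕ → ℕ
    D m = atLeast (half m + length (H (isOdd m))) (H (isOdd m))
    component : ∀ δ j → D (subdiagonal δ j) ≡ atLeast (j + e) (H δ)
    component δ j rewrite half-subdiagonal δ j | isOdd-subdiagonal δ j = cong (λ n → atLeast (j + n) (H δ)) (same δ)
      where
      same : ∀ δ → length (H δ) ≡ e
      same false = refl
      same true  = e′
    low : ∀ i → atLeast (i + 2 * e) L ≡ D i + D (suc i)
    low i with parityOf i
    ... | false , j , refl = trans (cong (λ p → atLeast p L) (sym (*-distribˡ-+ 2 j e)))
      (trans (evenly (j + e)) (sym (cong₂ _+_ (component false j) (component true j))))
    ... | true  , j , refl = trans (cong (λ p → atLeast (suc p) L) (sym (*-distribˡ-+ 2 j e)))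
      (trans (oddly (j + e)) (trans (+-comm (atLeast (suc (j + e)) Hₑ) _) (sym (cong₂ _+_ (component true j)
        (trans (cong D (sym (subdiagonal-suc false j))) (component false (suc j)))))))
    upEven : ∀ k → _
    upEven k with k ≤? e
    ... | yes q = inj₁ (2 * (e ∸ k) , trans (sym (*-distribˡ-+ 2 (e ∸ k) k)) (cong (2 *_) (m∸n+n≡m q))
                       , e ∸ k , e ∸ k , m∸n+n≡m q , trans (m∸n+n≡m q) (sym e′) , evenly (e ∸ k))
    ... | no ¬q = inj₂ (*-monoʳ-< 2 (≰⇒> ¬q) , <⇒≤ (≰⇒> ¬q) , ≤-trans (≤-reflexive e′) (<⇒≤ (≰⇒> ¬q)))
    upOdd : ∀ k → _
    upOdd k with suc k ≤? e
    ... | yes q = inj₁ (suc (2 * (e ∸ suc k)) , trans (rearrange (e ∸ suc k) k) (cong (2 *_) (m∸n+n≡m q))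
                       , suc (e ∸ suc k) , e ∸ suc k , trans (sym (+-suc _ k)) (m∸n+n≡m q) , trans (m∸n+n≡m q) (sym e′)
                       , oddly (e ∸ suc k))
      where
      rearrange : ∀ j k → suc (2 * j) + suc (2 * k) ≡ 2 * (j + suc k)
      rearrange = solve-∀
    ... | no ¬q = inj₂ (s≤s (*-monoʳ-≤ 2 e≤k) , e≤k , ≤-trans (≤-reflexive e′) (m≤n⇒m≤1+n e≤k))
      where e≤k = s≤s⁻¹ (≰⇒> ¬q)

  -- An entry from ℓ = 2e + 1 on has half at least `e` if it is odd and at least `suc e` if it is
  -- even, and these are the lengths of the two lists. So the main diagonal of the odd entries is
  -- subdiagonal 0, that of the even ones subdiagonal 1.
  odd-split : ∀ e → length Hₑ ≡ suc e → length Hₒ ≡ e → ℓ ≡ suc (2 * e) → Split ℓ L (choice Hₒ Hₑ)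
  odd-split e e′ refl refl = record
    { low    = low
    ; upEven = upEven
    ; upOdd  = upOdd
    }
    where
    H = choice Hₒ Hₑ
    D : ℕ → ℕ
    D m = atLeast (half m + length (H (isOdd m))) (H (isOdd m))
    component₀ : ∀ j → D (subdiagonal false j) ≡ atLeast (j + e) Hₒ
    component₀ j rewrite half-subdiagonal false j | isOdd-subdiagonal false j = refl
    component₁ : ∀ j → D (subdiagonal true j) ≡ atLeast (suc (j + e)) Hₑ
    component₁ j rewrite half-subdiagonal true j | isOdd-subdiagonal true j =
      cong (λ n → atLeast n Hₑ) (trans (cong (j +_) e′) (+-suc j e))
    low : ∀ i → atLeast (i + suc (2 * e)) L ≡ D i + D (suc i)
    low i with parityOf i
    ... | false , j , refl = trans (cong (λ p → atLeast p L) (rearrange j e))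
      (trans (oddly (j + e)) (trans (+-comm (atLeast (suc (j + e)) Hₑ) _) (sym (cong₂ _+_ (component₀ j) (component₁ j)))))
      where
      rearrange : ∀ j e → 2 * j + suc (2 * e) ≡ suc (2 * (j + e))
      rearrange = solve-∀
    ... | true  , j , refl = trans (cong (λ p → atLeast p L) (rearrange j e))
      (trans (evenly (suc (j + e))) (sym (cong₂ _+_ (component₁ j)
        (trans (cong D (sym (subdiagonal-suc false j))) (component₀ (suc j))))))
      where
      rearrange : ∀ j e → suc (2 * j) + suc (2 * e) ≡ 2 * suc (j + e)
      rearrange = solve-∀
    upEven : ∀ k → _
    upEven k with k ≤? e
    ... | yes q = inj₁ (suc (2 * (e ∸ k)) , cong suc (trans (sym (*-distribˡ-+ 2 (e ∸ k) k)) (cong (2 *_) (m∸n+n≡m q)))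
                       , e ∸ k , suc (e ∸ k) , m∸n+n≡m q , trans (cong suc (m∸n+n≡m q)) (sym e′)
                       , trans (oddly (e ∸ k)) (+-comm (atLeast (suc (e ∸ k)) Hₑ) _))
    ... | no ¬q = inj₂ (≤-trans (≤-reflexive (sym (*-suc 2 e))) (*-monoʳ-≤ 2 (≰⇒> ¬q)) , <⇒≤ (≰⇒> ¬q) , ≤-trans (≤-reflexive e′) (≰⇒> ¬q))
    upOdd : ∀ k → _
    upOdd k with k ≤? e
    ... | yes q = inj₁ (2 * (e ∸ k) , trans (+-suc _ _) (cong suc (trans (sym (*-distribˡ-+ 2 (e ∸ k) k)) (cong (2 *_) (m∸n+n≡m q))))
                       , e ∸ k , e ∸ k , m∸n+n≡m q , trans (+-suc _ k) (trans (cong suc (m∸n+n≡m q)) (sym e′))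
                       , trans (evenly (e ∸ k)) (+-comm (atLeast (e ∸ k) Hₑ) _))
    ... | no ¬q = inj₂ (s≤s (*-monoʳ-< 2 (≰⇒> ¬q)) , <⇒≤ (≰⇒> ¬q) , ≤-trans (≤-reflexive e′) (m≤n⇒m≤1+n (≰⇒> ¬q)))

betas-length : ∀ L → length (Evens.betas L) + length (Odds.betas L) ≡ length L
betas-length []      = refl
betas-length (a ∷ L) = by (even? a)
  where
  by : Dec (Even a) → length (Evens.betas (a ∷ L)) + length (Odds.betas (a ∷ L)) ≡ suc (length L)
  by (yes q) rewrite evens-even L q | odds-even L q = cong suc (betas-length L)
  by (no ¬q) rewrite evens-odd L ¬q | odds-odd L ¬q = trans (+-suc _ _) (cong suc (betas-length L))

-- The parity of the number of parts decides which of μ and ν has the dominoes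
-- meeting the contents 0 and 1 on its main diagonal.

components : Bool → List ℕ → Bool → List ℕ
components false Λ = choice (quotientParts even? Λ) (quotientParts odd? Λ)
components true  Λ = choice (quotientParts odd? Λ) (quotientParts even? Λ)

shiftedPavable-quotient : ∀ {Λ} → IsShiftedPavable Λ → Quotient Λ (components (isOdd (length Λ)) Λ)
shiftedPavable-quotient {Λ} sp = by (isOdd (length Λ)) (betas-balanced isPavable)
  where
  open IsShiftedPavable sp
  L = tupleL Λ
  Hₑ = Evens.betas L
  Hₒ = Odds.betas L
  decreasing : Decreasing L
  decreasing = tupleL-decreasing Λ (proj₁ isPartition)
  lengths : length Hₑ + length Hₒ ≡ length Λ
  lengths = trans (betas-length L) (length-tupleL Λ)
  by : ∀ δ → BetasBalanced δ (length Hₑ) (length Hₒ) → Quotient Λ (components δ Λ)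
  by false e = quotient {L = L} (components false Λ) (choice Hₑ Hₒ)
    (λ { false → Evens.hasBeta {Λ} decreasing ; true → Odds.hasBeta {Λ} decreasing })
    (λ { false → shiftedˡ ; true → shiftedʳ })
    (rowLength-tupleL Λ decreasing)
    (even-split {L = L} Hₑ Hₒ (λ p → atLeast-even p L) (λ p → atLeast-odd p L) (length Hₑ) refl e
      (trans (sym lengths) (cong (length Hₑ +_) (trans e (sym (+-identityʳ _))))))
  by true e = quotient {L = L} (components true Λ) (choice Hₒ Hₑ)
    (λ { false → Odds.hasBeta {Λ} decreasing ; true → Evens.hasBeta {Λ} decreasing })
    (λ { false → shiftedʳ ; true → shiftedˡ })
    (rowLength-tupleL Λ decreasing)
    (odd-split {L = L} Hₑ Hₒ (λ p → atLeast-even p L) (λ p → atLeast-odd p L) (length Hₒ) e refl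
      (trans (sym lengths) (trans (cong (_+ length Hₒ) e) (cong (λ n → suc (length Hₒ + n)) (sym (+-identityʳ _))))))

-- Products of power series

module _ {A : Set} (h : A → ℕ) where

  -- `Fin` of a sum is a disjoint union of blocks, and the membership proof says which block is
  -- meant.
  encode : ∀ {xs p} → p ∈ xs → Fin (h p) → Fin (sum (map h xs))
  encode {_ ∷ xs} (here refl) i = i ↑ˡ sum (map h xs)
  encode {x ∷ xs} (there p∈)  i = h x ↑ʳ encode p∈ i

  decode : ∀ xs → Fin (sum (map h xs)) → ∃[ p ] p ∈ xs × Fin (h p)
  decode (x ∷ xs) k with splitAt (h x) k
  ... | inj₁ i = x , here refl , i
  ... | inj₂ j = let p , p∈ , i = decode xs j in p , there p∈ , i

  decode-encode : ∀ {xs p} (p∈ : p ∈ xs) i → decode xs (encode p∈ i) ≡ (p , p∈ , i)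
  decode-encode {x ∷ xs} (here refl) i rewrite splitAt-↑ˡ (h x) i (sum (map h xs)) = refl
  decode-encode {x ∷ xs} (there p∈)  i rewrite splitAt-↑ʳ (h x) (sum (map h xs)) (encode p∈ i) | decode-encode p∈ i = refl

  encode-decode : ∀ xs k → let p , p∈ , i = decode xs k in encode p∈ i ≡ k
  encode-decode (x ∷ xs) k with splitAt (h x) k | join-splitAt (h x) (sum (map h xs)) k
  ... | inj₁ i | e = e
  ... | inj₂ j | e = trans (cong (h x ↑ʳ_) (encode-decode xs j)) e

factorizations-unique : ∀ α → Unique (factorizations α)
factorizations-unique []      = [] ∷ []
factorizations-unique (a ∷ α) = Unique.cartesianProductWith⁺ (λ b (β , γ) → (b ∷ β , a ∸ b ∷ γ))
  (λ e → proj₁ (∷-injective (cong proj₁ e)) ,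
         cong₂ _,_ (proj₂ (∷-injective (cong proj₁ e))) (proj₂ (∷-injective (cong proj₂ e))))
  (Unique.upTo⁺ (suc a)) (factorizations-unique α)

factorization : ∀ α (v w : ℕ → ℕ) → (∀ i → v i + w i ≡ exponent α i) →
                ∃[ β ] ∃[ γ ] (β , γ) ∈ factorizations α × (∀ i → v i ≡ exponent β i) × (∀ i → w i ≡ exponent γ i)
factorization []      v w e = [] , [] , here refl , (λ i → m+n≡0⇒m≡0 (v i) (e i)) , (λ i → m+n≡0⇒n≡0 (v i) (e i))
factorization (a ∷ α) v w e with factorization α (v ∘ suc) (w ∘ suc) (e ∘ suc)
... | β , γ , m , ev , ew = v 0 ∷ β , a ∸ v 0 ∷ γ
  , ∈-cartesianProductWith⁺ (λ b (β , γ) → (b ∷ β , a ∸ b ∷ γ)) (∈-upTo⁺ (s≤s (≤-trans (m≤m+n (v 0) (w 0)) (≤-reflexive (e 0))))) m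
  , (λ { zero → refl ; (suc i) → ev i })
  , (λ { zero → trans (sym (m+n∸m≡n (v 0) (w 0))) (cong (_∸ v 0) (e 0)) ; (suc i) → ew i })

factorization-sum : ∀ α {β γ} → (β , γ) ∈ factorizations α → ∀ i → exponent β i + exponent γ i ≡ exponent α i
factorization-sum []      (here refl) i = refl
factorization-sum (a ∷ α) m i with ∈-cartesianProductWith⁻ (λ b (β , γ) → (b ∷ β , a ∸ b ∷ γ)) (upTo (suc a)) (factorizations α) m
factorization-sum (a ∷ α) m zero    | b , (β , γ) , b∈ , _ , refl = m+[n∸m]≡n (s≤s⁻¹ (∈-upTo⁻ b∈))
factorization-sum (a ∷ α) m (suc i) | b , (β , γ) , _ , m′ , refl = factorization-sum α m′ i

-- Lists represent monomials only up to trailing zeros. Fixing the length makes a factor the only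
-- list with its exponents.
factorization-length : ∀ α {β γ} → (β , γ) ∈ factorizations α → length β ≡ length α × length γ ≡ length α
factorization-length []      (here refl) = refl , refl
factorization-length (a ∷ α) m with ∈-cartesianProductWith⁻ (λ b (β , γ) → (b ∷ β , a ∸ b ∷ γ)) (upTo (suc a)) (factorizations α) m
... | b , (β , γ) , _ , m′ , refl = let p , q = factorization-length α m′ in cong suc p , cong suc q

exponent-injective : ∀ β γ → length β ≡ length γ → (∀ i → exponent β i ≡ exponent γ i) → β ≡ γ
exponent-injective []      []      _ _ = refl
exponent-injective (b ∷ β) (c ∷ γ) l e = cong₂ _∷_ (e 0) (exponent-injective β γ (suc-injective l) (e ∘ suc))

WeightCong : WeightedFamily → Set
WeightCong F = ∀ t u → t ≈ u → ∀ i → weight t i ≡ weight u i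
  where open WeightedFamily F

productFamily : WeightedFamily → WeightedFamily → WeightedFamily
productFamily F G = record
  { objects = ×-setoid (WeightedFamily.objects F) (WeightedFamily.objects G)
  ; weight  = λ (t , u) i → WeightedFamily.weight F t i + WeightedFamily.weight G u i
  }

module _ {F G f g} (F-cong : WeightCong F) (G-cong : WeightCong G) (ΣF : Σx^ F ≈ f) (ΣG : Σx^ G ≈ g) where
  private
    module F = WeightedFamily F
    module G = WeightedFamily G
    module ΣF β = Inverse (ΣF β)
    module ΣG β = Inverse (ΣG β)

    h : Monomial × Monomial → ℕ
    h (β , γ) = f β * g γ

    index-of : ∀ α {β γ} → (β , γ) ∈ factorizations α → ∀ t u →
               (∀ i → F.weight t i ≡ exponent β i) → (∀ i → G.weight u i ≡ exponent γ i) → Fin ((f *ˢ g) α)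
    index-of α {β} {γ} m t u wt wu = encode h m (combine (ΣF.to β (t , wt)) (ΣG.to γ (u , wu)))

    index-cong : ∀ α {β γ β′ γ′} (m : (β , γ) ∈ factorizations α) (m′ : (β′ , γ′) ∈ factorizations α)
                 {t u t′ u′} wt wu wt′ wu′ → t F.≈ t′ → u G.≈ u′ → index-of α m t u wt wu ≡ index-of α m′ t′ u′ wt′ wu′
    index-cong α {β} {γ} {β′} {γ′} m m′ wt wu wt′ wu′ et eu
      with exponent-injective β β′ (trans (proj₁ (factorization-length α m)) (sym (proj₁ (factorization-length α m′))))
             (λ i → trans (sym (wt i)) (trans (F-cong _ _ et i) (wt′ i)))
         | exponent-injective γ γ′ (trans (proj₂ (factorization-length α m)) (sym (proj₂ (factorization-length α m′))))
             (λ i → trans (sym (wu i)) (trans (G-cong _ _ eu i) (wu′ i)))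
    -- As `factorizations α` has no repetitions, both membership proofs select the same block.
    ... | refl | refl with unique⇒irrelevant (factorizations-unique α) m m′
    ...   | refl = cong (encode h m) (cong₂ combine (ΣF.to-cong β et) (ΣG.to-cong γ eu))

    Pair : Monomial → Set
    Pair α = Setoid.Carrier (OfWeight (productFamily F G) α)

    to : ∀ α → Pair α → Fin ((f *ˢ g) α)
    to α ((t , u) , w) = let _ , _ , m , wt , wu = factorization α (F.weight t) (G.weight u) w in index-of α m t u wt wu

    pair : ∀ α {β γ} → (β , γ) ∈ factorizations α → Fin (f β) × Fin (g γ) → Pair α
    pair α {β} {γ} m (i , j) = (proj₁ t , proj₁ u) , λ k →
        trans (cong₂ _+_ (proj₂ t k) (proj₂ u k)) (factorization-sum α m k)
      where
      t = ΣF.from β i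
      u = ΣG.from γ j

    fromDecoded : ∀ α → ∃[ p ] p ∈ factorizations α × Fin (h p) → Pair α
    fromDecoded α ((β , γ) , m , x) = pair α m (remQuot {f β} (g γ) x)

    from : ∀ α → Fin ((f *ˢ g) α) → Pair α
    from α k = fromDecoded α (decode h (factorizations α) k)

    to-from : ∀ α k → to α (from α k) ≡ k
    to-from α k with decode h (factorizations α) k | encode-decode h (factorizations α) k
    ... | (β , γ) , m , x | e = trans
      (index-cong α (proj₁ (proj₂ (proj₂ fac))) m _ _ (proj₂ t) (proj₂ u) F.refl G.refl)
      (trans (cong (encode h m) (trans (cong₂ combine (proj₁ (ΣF.inverse β) (Setoid.refl (OfWeight F β) {t}))
                                                      (proj₁ (ΣG.inverse γ) (Setoid.refl (OfWeight G γ) {u})))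
                                       (combine-remQuot {f β} (g γ) x))) e)
      where
      t = ΣF.from β (proj₁ (remQuot {f β} (g γ) x))
      u = ΣG.from γ (proj₂ (remQuot {f β} (g γ) x))
      fac = factorization α (F.weight (proj₁ t)) (G.weight (proj₁ u)) (proj₂ (pair α m (remQuot {f β} (g γ) x)))

    to-cong : ∀ α {T U : Pair α} → Setoid._≈_ (OfWeight (productFamily F G) α) T U → to α T ≡ to α U
    to-cong α {(t , u) , w} {(t′ , u′) , w′} (et , eu) =
      let _ , _ , m  , wt  , wu  = factorization α (F.weight t) (G.weight u) w
          _ , _ , m′ , wt′ , wu′ = factorization α (F.weight t′) (G.weight u′) w′
      in index-cong α m m′ wt wu wt′ wu′ et eu

    from-to : ∀ α (T : Pair α) → Setoid._≈_ (OfWeight (productFamily F G) α) (from α (to α T)) T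
    from-to α T@((t , u) , w) = subst (λ U → Setoid._≈_ (OfWeight (productFamily F G) α) U T) (sym decoded)
        (proj₂ (ΣF.inverse β) refl , proj₂ (ΣG.inverse γ) refl)
      where
      fac = factorization α (F.weight t) (G.weight u) w
      β = proj₁ fac
      γ = proj₁ (proj₂ fac)
      m = proj₁ (proj₂ (proj₂ fac))
      i = ΣF.to β (t , proj₁ (proj₂ (proj₂ (proj₂ fac))))
      j = ΣG.to γ (u , proj₂ (proj₂ (proj₂ (proj₂ fac))))
      decoded : from α (to α T) ≡ pair α m (i , j)
      decoded = trans (cong (fromDecoded α) (decode-encode h m (combine i j))) (cong (pair α m) (remQuot-combine i j))

  Σx^-product : Σx^ productFamily F G ≈ (f *ˢ g)
  Σx^-product α = record
    { to        = to α
    ; from      = from α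
    ; to-cong   = λ {T} {U} → to-cong α {T} {U}
    ; from-cong = λ { {k} refl → Setoid.refl (OfWeight (productFamily F G) α) {from α k} }
    ; inverse   = (λ {k} {T} e → trans (to-cong α {T} {from α k} e) (to-from α k))
                , (λ { {T} refl → from-to α T })
    }

Σx^-transfer : ∀ {F G f} → WeightCong G → (I : Inverse (WeightedFamily.objects F) (WeightedFamily.objects G)) →
               (∀ T i → WeightedFamily.weight F T i ≡ WeightedFamily.weight G (Inverse.to I T) i) →
               Σx^ G ≈ f → Σx^ F ≈ f
Σx^-transfer {F} {G} G-cong I same ΣG α = Composition.inverse I′ (ΣG α)
  where
  module I = Inverse I
  I′ : Inverse (OfWeight F α) (OfWeight G α)
  I′ = record
    { to        = λ (T , w) → I.to T , λ i → trans (sym (same T i)) (w i)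
    ; from      = λ (T , w) → I.from T , λ i →
        trans (same (I.from T) i) (trans (G-cong _ _ (proj₁ I.inverse (Setoid.refl (WeightedFamily.objects F))) i) (w i))
    ; to-cong   = I.to-cong
    ; from-cong = I.from-cong
    ; inverse   = proj₁ I.inverse , proj₂ I.inverse
    }

productFamily-cong : ∀ {F G} → WeightCong F → WeightCong G → WeightCong (productFamily F G)
productFamily-cong F-cong G-cong _ _ (et , eu) i = cong₂ _+_ (F-cong _ _ et i) (G-cong _ _ eu i)

youngTableaux-cong : ∀ μ → WeightCong (youngTableaux μ)
youngTableaux-cong μ (t , _) (u , _) e i = go (lowCells μ) λ c∈ → e _ (∈-lowCells⁻ μ c∈)
  where
  open ShiftedYoungTableau
  go : ∀ cs → (∀ {c} → c ∈ cs → fill t c ≡ fill u c) →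
       length (filter (λ c → index (fill t c) ≟ i) cs) ≡ length (filter (λ c → index (fill u c) ≟ i) cs)
  go []       _ = refl
  go (c ∷ cs) h rewrite h {c} (here refl) with index (fill u c) ≡ᵇ i
  ... | true  = cong suc (go cs (h ∘ there))
  ... | false = go cs (h ∘ there)

Factors : WeightedFamily → WeightedFamily → WeightedFamily → Set
Factors H F G = Σ (Inverse (WeightedFamily.objects H) (WeightedFamily.objects (productFamily F G)))
  λ I → ∀ T i → WeightedFamily.weight H T i ≡ WeightedFamily.weight (productFamily F G) (Inverse.to I T) i

-- If ℓ is odd, subdiagonal 0 belongs to ν, and the bijection produces the pairs in the order ν, μ.
factors-comm : ∀ {H F G} → Factors H F G → Factors H G F
factors-comm {H} {F} {G} (I , same) = Composition.inverse I swap , λ T i →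
    trans (same T i) (+-comm (WeightedFamily.weight F (proj₁ (Inverse.to I T)) i) _)
  where
  swap : Inverse (WeightedFamily.objects (productFamily F G)) (WeightedFamily.objects (productFamily G F))
  swap = record
    { to        = λ (t , u) → u , t
    ; from      = λ (t , u) → u , t
    ; to-cong   = λ (e , e′) → e′ , e
    ; from-cong = λ (e , e′) → e′ , e
    ; inverse   = (λ (e , e′) → e′ , e) , (λ (e , e′) → e′ , e)
    }

mainTheorem3 : (Λ : List ℕ) → IsShiftedPavable Λ →
    let (μ , ν) = twoQuotient Λ in
    Σx^ dominoTableaux Λ ≈ (schurP μ *ˢ schurP ν)
mainTheorem3 Λ sp = Σx^-transfer {dominoTableaux Λ} {productFamily (youngTableaux μ) (youngTableaux ν)}
    (productFamily-cong {youngTableaux μ} {youngTableaux ν} (youngTableaux-cong μ) (youngTableaux-cong ν))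
    (proj₁ bijection) (proj₂ bijection)
    (Σx^-product {youngTableaux μ} {youngTableaux ν} (youngTableaux-cong μ) (youngTableaux-cong ν) (schurP-sum μ) (schurP-sum ν))
  where
  μ = proj₁ (twoQuotient Λ)
  ν = proj₂ (twoQuotient Λ)

  factors : ∀ δ → Quotient Λ (components δ Λ) → Factors (dominoTableaux Λ) (youngTableaux μ) (youngTableaux ν)
  factors false Q = tableaux↔pairs Q , tableaux↔pairs-weight Q
  factors true  Q = factors-comm {dominoTableaux Λ} {youngTableaux ν} {youngTableaux μ}
                                 (tableaux↔pairs Q , tableaux↔pairs-weight Q)

  bijection : Factors (dominoTableaux Λ) (youngTableaux μ) (youngTableaux ν)
  bijection = factors (isOdd (length Λ)) (shiftedPavable-quotient sp)
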